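{- Let $L=\mathbb{Q}(\sqrt m,\sqrt n)$ be a biquadratic extension of $\mathbb{Q}$ with $m,n$ square-free and $m\equiv n\equiv1\pmod 4$. Let $d=\gcd(m,n)$, $k=\frac{mn}{d^2}$, and let $H_1,H_2,H_3$ be the non-classical Hopf-Galois structures on $L/\mathbb{Q}$ corresponding to $\sqrt m,\sqrt n,\sqrt k$ respectively. For $i\in\{1,2,3\}$, $\mathcal{O}_L$ is $\mathfrak{A}_{H_i}$-free if and only if there exist integers $x,y\in\mathbb{Z}$ such that at least one of the following two equations (one for each sign) is satisfied: 1. $x^2+my^2=\pm2d$, if $i=1$. 2. $x^2+ny^2=\pm2d$, if $i=2$. 3. $x^2+ky^2=\pm2\frac nd$, if $i=3$. In that case, a generator of $\mathcal{O}_L$ as $\mathfrak{A}_{H_i}$-module is as follows: - if $i=1$: $\beta=\frac12\left(\frac{my-x}{2d}-\epsilon\right)\gamma_1+\frac{1-y}{2}\gamma_2+\frac{x-my}{2d}\gamma_3+y\gamma_4$, where $\epsilon\in\{0,1\}$ is the residue of $\frac{x-my}{2d}$ modulo $2$; - if $i=2$: $\beta=\frac14\left(\frac{my-x}{d}-\epsilon\right)\gamma_1+\frac{x-yd}{2d}\gamma_2+\frac{d-my}{2d}\gamma_3+y\gamma_4$, where $\epsilon\in\{0,1,2,3\}$ is the residue of $\frac{my-x}{d}$ modulo $4$; - if $i=3$: $\beta=\frac14\left(\frac{k-x}{n/d}-y+\epsilon\right)\gamma_1+\frac{y-1}{2}\gamma_2+\frac{x-k}{2n/d}\gamma_3+\gamma_4$,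 where $\epsilon\in\{1,-1\}$ satisfies $\epsilon\equiv-\left(\frac{k-x}{n/d}-y\right)\pmod 4$. Here $\gamma_1=1,\ \gamma_2=\frac{1+\sqrt m}{2},\ \gamma_3=\frac{1+\sqrt n}{2},\ \gamma_4=\left(\frac{1+\sqrt m}{2}\right)\left(\frac{1+\sqrt k}{2}\right)$.
   Context: $L=\mathbb{Q}(\sqrt m,\sqrt n)$ has Galois group $C_2\times C_2$; its quadratic subfields are $\mathbb{Q}(\sqrt m),\mathbb{Q}(\sqrt n),\mathbb{Q}(\sqrt k)$, with $\sqrt k=\sqrt m\sqrt n/d$ and $d=\gcd(m,n)>0$. Here $k\equiv1\pmod 4$ and $\{\gamma_1,\gamma_2,\gamma_3,\gamma_4\}$ is an integral basis of $L$. A Hopf-Galois structure on $L/\mathbb{Q}$ is a finite-dimensional cocommutative $\mathbb{Q}$-Hopf algebra $H$ with an action making $L$ a left $H$-module algebra such that $L\otimes_{\mathbb{Q}} H\to\mathrm{End}_{\mathbb{Q}}(L)$, $x\otimes h\mapsto(y\mapsto x(h\cdot y))$ is bijective. Besides the classical one $\mathbb{Q}[\mathrm{Gal}(L/\mathbb{Q})]$, there are exactly three, one for each $\zeta\in\{\sqrt m,\sqrt n,\sqrt k\}$. Explicitly, let $\tau$ generate $\mathrm{Gal}(L/\mathbb{Q}(\zeta))$ and let $\sigma\in\mathrm{Gal}(L/\mathbb{Q})\setminus\langle\tau\rangle$; since the action is faithful, the structure corresponding to $\zeta$ is identified, as an algebra acting on $L$, with the subalgebra of $\mathrm{End}_{\mathbb{Q}}(L)$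 having $\mathbb{Q}$-basis $\mathrm{id},\ \tau,\ \sigma+\sigma\tau,\ \zeta(\sigma-\sigma\tau)$. The associated order is $\mathfrak{A}_H=\{h\in H: h\cdot\mathcal{O}_L\subseteq\mathcal{O}_L\}$; "$\mathcal{O}_L$ is $\mathfrak{A}_H$-free" means free (of rank one) as $\mathfrak{A}_H$-module, and a generator is a $\beta\in\mathcal{O}_L$ such that $\mathfrak{A}_H\to\mathcal{O}_L$, $h\mapsto h\cdot\beta$, is bijective. -}

module Defs where

open import Algebra.Bundles.Raw using (RawRing)
open import Algebra.Morphism.Structures using (module RingMorphisms)
open import Data.Fin.Base using (Fin; toℕ)
open import Data.Integer.Base using (ℤ; +_; -_; _+_; _-_; _*_; ∣_∣; 0ℤ; 1ℤ; -1ℤ; NonZero; ≢-nonZero)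
open import Data.Integer.Divisibility.Signed using (_∣_; divides; quotient; ∣ᵤ⇒∣)
open import Data.Integer.GCD using (gcd; gcd[i,j]∣i; gcd[i,j]∣j; gcd[i,j]≡0⇒i≡0)
open import Data.Integer.Properties using (i*j≢0)
open import Data.Integer.Solver using (module +-*-Solver)
open import Data.List.Base using (List; []; _∷_)
open import Data.Product.Base using (Σ; ∃; _×_; _,_; proj₁; proj₂)
open import Data.Rational.Base using (ℚ; 0ℚ; 1ℚ; ½; _÷_)
open import Data.Rational.Literals using (fromℤ)
open import Data.Sum.Base using (_⊎_)
open import Function.Definitions using (Bijective)
open import Level using (0ℓ)
open import Relation.Binary.Core using (Rel)
open import Relation.Binary.PropositionalEquality using (_≡_; _≢_; refl; trans; cong; cong₂)
open import Relation.Nullary.Negation using (¬_)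
import Data.Rational.Base as ℚ
import Function.Endo.Propositional as Endo

SquareFree : ℤ → Set
SquareFree z = ∀ a → a * a ∣ z → ∣ a ∣ ≡ 1

squareFree⇒≢0 : ∀ {z} → SquareFree z → z ≢ 0ℤ
squareFree⇒≢0 sf refl with sf 0ℤ (divides 0ℤ refl)
... | ()

infix 4 _≡_[mod_] _≡ℚ_[mod_]

_≡_[mod_] : ℤ → ℤ → ℤ → Set
a ≡ b [mod N ] = N ∣ a - b

-- In particular this forces the rational number q to be an integer.
_≡ℚ_[mod_] : ℚ → ℤ → ℤ → Set
q ≡ℚ r [mod N ] = ∃ λ t → q ≡ fromℤ (r + t * N)

infixl 7 _∕_
_∕_ : (a b : ℤ) → .{{NonZero b}} → ℚ
a ∕ b = fromℤ a ÷ fromℤ b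

module Biquadratic (m n : ℤ) (m-sf : SquareFree m) (n-sf : SquareFree n) where

  d : ℤ
  d = gcd m n

  abstract
    d∣m : d ∣ m
    d∣m = ∣ᵤ⇒∣ (gcd[i,j]∣i m n)

    d∣n : d ∣ n
    d∣n = ∣ᵤ⇒∣ (gcd[i,j]∣j m n)

    d²∣mn : d * d ∣ m * n
    d²∣mn = divides (quotient d∣m * quotient d∣n)
      (trans (cong₂ _*_ (_∣_.equality d∣m) (_∣_.equality d∣n))
             (solve 3 (λ a b c → (a :* c) :* (b :* c) := (a :* b) :* (c :* c)) refl
                    (quotient d∣m) (quotient d∣n) d))
      where open +-*-Solver

  -- Exact quotients: n ≡ n/d * d and m * n ≡ k * (d * d), by the second field of _∣_.
  n/d k : ℤ
  n/d = quotient d∣n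
  k = quotient d²∣mn

  instance
    d≢0 : NonZero d
    d≢0 = ≢-nonZero {d} λ d≡0 → squareFree⇒≢0 m-sf (gcd[i,j]≡0⇒i≡0 m n d≡0)

    n/d≢0 : NonZero n/d
    n/d≢0 = ≢-nonZero {n/d} λ q≡0 →
      squareFree⇒≢0 n-sf (trans (_∣_.equality d∣n) (cong (_* d) q≡0))

    2d≢0 : NonZero (+ 2 * d)
    2d≢0 = i*j≢0 (+ 2) d

    2n/d≢0 : NonZero (+ 2 * n/d)
    2n/d≢0 = i*j≢0 (+ 2) n/d

  -- ⟨ a , b , c , e ⟩ stands for a + b√m + c√n + e√m√n.  This is the algebra
  -- ℚ[X,Y]/(X² - m, Y² - n); ℚ(√m,√n) has degree 4 over ℚ exactly when it is a
  -- field, and is then this algebra.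
  record L : Set where
    constructor ⟨_,_,_,_⟩
    field
      c₁ c√m c√n c√m√n : ℚ

  ι : ℚ → L
  ι q = ⟨ q , 0ℚ , 0ℚ , 0ℚ ⟩

  infixl 6 _⊕_ _⊖_
  infixl 7 _⊗_
  infixr 8 _·_

  _⊕_ : L → L → L
  ⟨ a , b , c , e ⟩ ⊕ ⟨ a′ , b′ , c′ , e′ ⟩ =
    ⟨ a ℚ.+ a′ , b ℚ.+ b′ , c ℚ.+ c′ , e ℚ.+ e′ ⟩

  ⊝_ : L → L
  ⊝ ⟨ a , b , c , e ⟩ = ⟨ ℚ.- a , ℚ.- b , ℚ.- c , ℚ.- e ⟩

  _⊖_ : L → L → L
  v ⊖ w = v ⊕ (⊝ w)

  _·_ : ℚ → L → L
  q · ⟨ a , b , c , e ⟩ = ⟨ q ℚ.* a , q ℚ.* b , q ℚ.* c , q ℚ.* e ⟩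

  _⊗_ : L → L → L
  ⟨ a , b , c , e ⟩ ⊗ ⟨ a′ , b′ , c′ , e′ ⟩ =
    ⟨ a ℚ.* a′ ℚ.+ M ℚ.* (b ℚ.* b′) ℚ.+ N ℚ.* (c ℚ.* c′) ℚ.+ M ℚ.* N ℚ.* (e ℚ.* e′)
    , a ℚ.* b′ ℚ.+ b ℚ.* a′ ℚ.+ N ℚ.* (c ℚ.* e′ ℚ.+ e ℚ.* c′)
    , a ℚ.* c′ ℚ.+ c ℚ.* a′ ℚ.+ M ℚ.* (b ℚ.* e′ ℚ.+ e ℚ.* b′)
    , a ℚ.* e′ ℚ.+ e ℚ.* a′ ℚ.+ b ℚ.* c′ ℚ.+ c ℚ.* b′
    ⟩
    where
    M N : ℚ
    M = fromℤ m
    N = fromℤ n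

  0L 1L √m √n √k : L
  0L = ι 0ℚ
  1L = ι 1ℚ
  √m = ⟨ 0ℚ , 1ℚ , 0ℚ , 0ℚ ⟩
  √n = ⟨ 0ℚ , 0ℚ , 1ℚ , 0ℚ ⟩
  √k = (1ℤ ∕ d) · (√m ⊗ √n)

  L-rawRing : RawRing 0ℓ 0ℓ
  L-rawRing = record
    { Carrier = L
    ; _≈_ = _≡_
    ; _+_ = _⊕_
    ; _*_ = _⊗_
    ; -_ = ⊝_
    ; 0# = 0L
    ; 1# = 1L
    }

  IsField : Set
  IsField = ∀ v → v ≢ 0L → ∃ λ w → v ⊗ w ≡ 1L

  -- For a list c₀, …, c_{r-1} of integers, the value at α of the monic polynomial
  -- c₀ + c₁ X + ⋯ + c_{r-1} X^{r-1} + X^r.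
  evalMonic : List ℤ → L → L
  evalMonic []       α = 1L
  evalMonic (c ∷ cs) α = ι (fromℤ c) ⊕ α ⊗ evalMonic cs α

  IsIntegral : L → Set
  IsIntegral α = ∃ λ cs → evalMonic cs α ≡ 0L

  𝒪 : Set
  𝒪 = Σ L IsIntegral

  _≈𝒪_ : Rel 𝒪 0ℓ
  v ≈𝒪 w = proj₁ v ≡ proj₁ w

  open RingMorphisms L-rawRing L-rawRing using (IsRingIsomorphism)
  open Endo L using (_^_)

  record InGal (g : L → L) : Set where
    field
      isRingIsomorphism : IsRingIsomorphism g
      fixes-ℚ           : ∀ q → g (ι q) ≡ ι q

  -- The data from which the non-classical structure attached to ζ is built: a
  -- generator τ of Gal(L/ℚ(ζ)) and some σ ∈ Gal(L/ℚ) ∖ ⟨τ⟩.  As the Galois group is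
  -- finite, the powers with exponents in ℕ exhaust ⟨τ⟩.
  record NonClassical (ζ : L) : Set where
    field
      τ σ         : L → L
      τ∈Gal       : InGal τ
      τ-fixes-ζ   : τ ζ ≡ ζ
      τ-generates : ∀ g → InGal g → g ζ ≡ ζ → ∃ λ j → ∀ v → g v ≡ (τ ^ j) v
      σ∈Gal       : InGal σ
      σ∉⟨τ⟩       : ∀ j → ¬ (∀ v → σ v ≡ (τ ^ j) v)

  module _ {ζ : L} (S : NonClassical ζ) where
    open NonClassical S

    -- The Hopf algebra, as the ℚ-span of id, τ, σ + στ, ζ(σ - στ) in End_ℚ(L).
    InH : (L → L) → Set
    InH h = ∃ λ a → ∃ λ b → ∃ λ c → ∃ λ e → ∀ v →
      h v ≡ a · v ⊕ b · τ v ⊕ c · (σ v ⊕ σ (τ v)) ⊕ e · (ζ ⊗ (σ v ⊖ σ (τ v)))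

    record 𝔄 : Set where
      field
        act        : L → L
        act∈H      : InH act
        preserves𝒪 : ∀ v → IsIntegral v → IsIntegral (act v)

    _≈𝔄_ : Rel 𝔄 0ℓ
    h ≈𝔄 h′ = ∀ v → 𝔄.act h v ≡ 𝔄.act h′ v

    orbit : 𝒪 → 𝔄 → 𝒪
    orbit (β , β∈𝒪) h = 𝔄.act h β , 𝔄.preserves𝒪 h β β∈𝒪

    IsGenerator : L → Set
    IsGenerator β = Σ (IsIntegral β) λ β∈𝒪 → Bijective _≈𝔄_ _≈𝒪_ (orbit (β , β∈𝒪))

    Free : Set
    Free = ∃ IsGenerator

  γ₁ γ₂ γ₃ γ₄ : L
  γ₁ = 1L
  γ₂ = ½ · (1L ⊕ √m)
  γ₃ = ½ · (1L ⊕ √n)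
  γ₄ = (½ · (1L ⊕ √m)) ⊗ (½ · (1L ⊕ √k))

  Eq₁ Eq₂ Eq₃ : ℤ → ℤ → Set
  Eq₁ x y = x * x + m * (y * y) ≡ + 2 * d   ⊎ x * x + m * (y * y) ≡ - (+ 2 * d)
  Eq₂ x y = x * x + n * (y * y) ≡ + 2 * d   ⊎ x * x + n * (y * y) ≡ - (+ 2 * d)
  Eq₃ x y = x * x + k * (y * y) ≡ + 2 * n/d ⊎ x * x + k * (y * y) ≡ - (+ 2 * n/d)

  β₁ β₂ β₃ : ℤ → ℤ → ℤ → L
  β₁ x y ε =
      (½ ℚ.* ((m * y - x) ∕ (+ 2 * d) ℚ.- fromℤ ε)) · γ₁
    ⊕ ((1ℤ - y) ∕ + 2) · γ₂
    ⊕ ((x - m * y) ∕ (+ 2 * d)) · γ₃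
    ⊕ fromℤ y · γ₄
  β₂ x y ε =
      ((1ℤ ∕ + 4) ℚ.* ((m * y - x) ∕ d ℚ.- fromℤ ε)) · γ₁
    ⊕ ((x - y * d) ∕ (+ 2 * d)) · γ₂
    ⊕ ((d - m * y) ∕ (+ 2 * d)) · γ₃
    ⊕ fromℤ y · γ₄
  β₃ x y ε =
      ((1ℤ ∕ + 4) ℚ.* ((k - x) ∕ n/d ℚ.- fromℤ y ℚ.+ fromℤ ε)) · γ₁
    ⊕ ((y - 1ℤ) ∕ + 2) · γ₂
    ⊕ ((x - k) ∕ (+ 2 * n/d)) · γ₃
    ⊕ γ₄

  -- The conditions on ε; each determines ε uniquely, if it exists at all.
  Residue₁ : ℤ → ℤ → Fin 2 → Set
  Residue₁ x y ε = (x - m * y) ∕ (+ 2 * d) ≡ℚ + toℕ ε [mod + 2 ]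

  Residue₂ : ℤ → ℤ → Fin 4 → Set
  Residue₂ x y ε = (m * y - x) ∕ d ≡ℚ + toℕ ε [mod + 4 ]

  Sign₃ : ℤ → ℤ → ℤ → Set
  Sign₃ x y ε = (ε ≡ 1ℤ ⊎ ε ≡ -1ℤ) × ℚ.- ((k - x) ∕ n/d ℚ.- fromℤ y) ≡ℚ ε [mod + 4 ]

{-# OPTIONS --safe #-}

-- An element of L is integral exactly when its powers have a common denominator
-- ("almost integral"); this notion is visibly closed under ring operations and the
-- Galois action, and on ℚ it singles out ℤ.  Relative norms to the three quadratic
-- subfields then give 𝒪 = ⟨γ₁,γ₂,γ₃,γ₄⟩.
--
-- The structure attached to ζ acts on L = ℚ ⊕ ℚζ ⊕ (a plane) by p, q and r + s J, with
-- J² = -uw.  In suitable coordinates (A , X , Y , Z) of 4v, 𝒪 consists of the integral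
-- quadruples of equal parity with A ≡ X + Y + Z mod 4, and the associated order of the
-- integral (p,q,r,s) with p ≡ r + s mod 2 and q ≡ p + 2s mod 4.  Comparing indices, v
-- is a generator iff A, X = ±1 and wY² + uZ² = ±2; multiplied by w, the latter is the
-- equation of the proposition, since w square-free and w ∣ x² give w ∣ x.
module Submission where

open import Defs
open import Algebra.Bundles using (CommutativeRing; CommutativeSemiring)
open import Algebra.Morphism.Structures using (module RingMorphisms)
import Algebra.Properties.Ring as RingProperties
import Algebra.Properties.Semiring.Exp as Exp
import Algebra.Solver.Ring.NaturalCoefficients.Default as NaturalCoefficients
open import Algebra.Structures using (IsCommutativeRing)
open import Data.Fin.Base using (Fin; toℕ; zero; suc)
open import Data.Integer.Base as ℤ using (ℤ; +_; -[1+_]; 0ℤ; 1ℤ; ∣_∣)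
open import Data.Integer.Coprimality using (coprime-divisor)
import Data.Integer.DivMod as DivMod
open import Data.Integer.Divisibility.Signed using (_∣_; divides; quotient; ∣ᵤ⇒∣; ∣⇒∣ᵤ; ∣-trans)
import Data.Integer.GCD as GCD
import Data.Integer.Properties as ℤₚ
import Data.Integer.Tactic.RingSolver as ℤ-Solver
open import Data.List.Base using (List; []; _∷_; length; map)
open import Data.List.Relation.Unary.All using (All; []; _∷_)
open import Data.Nat.Base as ℕ using (ℕ; zero; suc)
import Data.Nat.Coprimality as ℕ-Coprime
import Data.Nat.Properties as ℕₚ
open import Data.Product.Base using (∃; ∃₂; _×_; _,_; proj₁; proj₂)
open import Data.Rational.Base as ℚ using (ℚ; mkℚ; 0ℚ; 1ℚ; ½; toℚᵘ; ↥_; ↧_; ↧ₙ_)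
open import Data.Rational.Literals using (fromℤ)
import Data.Rational.Properties as ℚₚ
open import Data.Rational.Unnormalised.Base using (*≡*)
import Data.Rational.Unnormalised.Properties as ℚᵘₚ
open import Data.Sum.Base using (_⊎_; inj₁; inj₂; [_,_]′)
open import Function.Base using (_∘_; id)
open import Function.Bundles using (_⇔_; mk⇔)
import Function.Endo.Propositional as Endo
open import Level using (0ℓ)
open import Relation.Binary.Definitions using (_Respects_)
open import Relation.Binary.PropositionalEquality
open import Relation.Nullary.Decidable using (Dec; yes; no; dec⇒maybe; map′; _×-dec_)
open import Relation.Nullary.Negation using (contradiction; ¬_)
open import Tactic.RingSolver using (solve-∀)
open import Tactic.RingSolver.Core.AlmostCommutativeRing using (AlmostCommutativeRing; fromCommutativeRing)

-- Integrality asks for some monic polynomial, and producing one for a sum or a product would need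
-- determinants or resultants; a common denominator of all powers needs neither.
--
-- The obstacle to treating the three structures at once is d mod 4: γ₄ is ¼(1 + √m + (m/d)√n + √k),
-- and m/d ≡ d may be 1 or -1 mod 4. With δ = ±1, δ ≡ -d mod 4, and δ√k as third root, the
-- congruence describing 𝒪 becomes symmetric, so that any root can play the part of ζ. The constants
-- (u, w) of the plane are (δm/d, δd), (δn/d, δd) and (m/d, n/d): odd, coprime and congruent mod 4
-- in each case, which is all that the lattice computation uses.
--
-- No index is actually computed. If v generates, reaching one vector with odd coordinates makes X,
-- hence Y and Z, odd, so that wY² + uZ² is twice an odd number; reaching two vectors of the plane
-- makes it a divisor of 4. Conversely, Cramer's rule with determinant ±2 yields p, q, r, s, and
-- their congruences are polynomial identities with explicit cofactors.

ℚ-ring : AlmostCommutativeRing 0ℓ 0ℓ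
ℚ-ring = fromCommutativeRing ℚₚ.+-*-commutativeRing λ x → dec⇒maybe (0ℚ ℚₚ.≟ x)

-- Polynomial identities over ℚ, coordinate by coordinate.

¼ : ℚ
¼ = ½ ℚ.* ½

-- The coordinates of the ring laws of ℚ[X,Y]/(X² - M, Y² - N).
module Coordinatewise where
  open import Data.Rational.Base using (_+_; _*_)

  assoc₁ : ∀ M N a b c e a′ b′ c′ e′ a″ b″ c″ e″ →
    (a * a′ + M * (b * b′) + N * (c * c′) + M * N * (e * e′)) * a″ + M * ((a * b′ + b * a′ + N * (c * e′ + e * c′)) * b″) + N * ((a * c′ + c * a′ + M * (b * e′ + e * b′)) * c″) + M * N * ((a * e′ + e * a′ + b * c′ + c * b′) * e″)
    ≡ a * (a′ * a″ + M * (b′ * b″) + N * (c′ * c″) + M * N * (e′ * e″)) + M * (b * (a′ * b″ + b′ * a″ + N * (c′ * e″ + e′ * c″))) + N * (c * (a′ * c″ + c′ * a″ + M * (b′ * e″ + e′ * b″))) + M * N * (e * (a′ * e″ + e′ * a″ + b′ * c″ + c′ * b″))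
  assoc₁ = solve-∀ ℚ-ring

  assoc₂ : ∀ M N a b c e a′ b′ c′ e′ a″ b″ c″ e″ →
    (a * a′ + M * (b * b′) + N * (c * c′) + M * N * (e * e′)) * b″ + (a * b′ + b * a′ + N * (c * e′ + e * c′)) * a″ + N * ((a * c′ + c * a′ + M * (b * e′ + e * b′)) * e″ + (a * e′ + e * a′ + b * c′ + c * b′) * c″)
    ≡ a * (a′ * b″ + b′ * a″ + N * (c′ * e″ + e′ * c″)) + b * (a′ * a″ + M * (b′ * b″) + N * (c′ * c″) + M * N * (e′ * e″)) + N * (c * (a′ * e″ + e′ * a″ + b′ * c″ + c′ * b″) + e * (a′ * c″ + c′ * a″ + M * (b′ * e″ + e′ * b″)))
  assoc₂ = solve-∀ ℚ-ring

  assoc₃ : ∀ M N a b c e a′ b′ c′ e′ a″ b″ c″ e″ →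
    (a * a′ + M * (b * b′) + N * (c * c′) + M * N * (e * e′)) * c″ + (a * c′ + c * a′ + M * (b * e′ + e * b′)) * a″ + M * ((a * b′ + b * a′ + N * (c * e′ + e * c′)) * e″ + (a * e′ + e * a′ + b * c′ + c * b′) * b″)
    ≡ a * (a′ * c″ + c′ * a″ + M * (b′ * e″ + e′ * b″)) + c * (a′ * a″ + M * (b′ * b″) + N * (c′ * c″) + M * N * (e′ * e″)) + M * (b * (a′ * e″ + e′ * a″ + b′ * c″ + c′ * b″) + e * (a′ * b″ + b′ * a″ + N * (c′ * e″ + e′ * c″)))
  assoc₃ = solve-∀ ℚ-ring

  assoc₄ : ∀ M N a b c e a′ b′ c′ e′ a″ b″ c″ e″ →
    (a * a′ + M * (b * b′) + N * (c * c′) + M * N * (e * e′)) * e″ + (a * e′ + e * a′ + b * c′ + c * b′) * a″ + (a * b′ + b * a′ + N * (c * e′ + e * c′)) * c″ + (a * c′ + c * a′ + M * (b * e′ + e * b′)) * b″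
    ≡ a * (a′ * e″ + e′ * a″ + b′ * c″ + c′ * b″) + e * (a′ * a″ + M * (b′ * b″) + N * (c′ * c″) + M * N * (e′ * e″)) + b * (a′ * c″ + c′ * a″ + M * (b′ * e″ + e′ * b″)) + c * (a′ * b″ + b′ * a″ + N * (c′ * e″ + e′ * c″))
  assoc₄ = solve-∀ ℚ-ring

  comm₁ : ∀ M N a b c e a′ b′ c′ e′ →
    a * a′ + M * (b * b′) + N * (c * c′) + M * N * (e * e′)
    ≡ a′ * a + M * (b′ * b) + N * (c′ * c) + M * N * (e′ * e)
  comm₁ = solve-∀ ℚ-ring

  comm₂ : ∀ M N a b c e a′ b′ c′ e′ →
    a * b′ + b * a′ + N * (c * e′ + e * c′)
    ≡ a′ * b + b′ * a + N * (c′ * e + e′ * c)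
  comm₂ = solve-∀ ℚ-ring

  comm₃ : ∀ M N a b c e a′ b′ c′ e′ →
    a * c′ + c * a′ + M * (b * e′ + e * b′)
    ≡ a′ * c + c′ * a + M * (b′ * e + e′ * b)
  comm₃ = solve-∀ ℚ-ring

  comm₄ : ∀ M N a b c e a′ b′ c′ e′ →
    a * e′ + e * a′ + b * c′ + c * b′
    ≡ a′ * e + e′ * a + b′ * c + c′ * b
  comm₄ = solve-∀ ℚ-ring

  distrib₁ : ∀ M N a b c e a′ b′ c′ e′ a″ b″ c″ e″ →
    a * (a′ + a″) + M * (b * (b′ + b″)) + N * (c * (c′ + c″)) + M * N * (e * (e′ + e″))
    ≡ (a * a′ + M * (b * b′) + N * (c * c′) + M * N * (e * e′)) + (a * a″ + M * (b * b″) + N * (c * c″) + M * N * (e * e″))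
  distrib₁ = solve-∀ ℚ-ring

  distrib₂ : ∀ M N a b c e a′ b′ c′ e′ a″ b″ c″ e″ →
    a * (b′ + b″) + b * (a′ + a″) + N * (c * (e′ + e″) + e * (c′ + c″))
    ≡ (a * b′ + b * a′ + N * (c * e′ + e * c′)) + (a * b″ + b * a″ + N * (c * e″ + e * c″))
  distrib₂ = solve-∀ ℚ-ring

  distrib₃ : ∀ M N a b c e a′ b′ c′ e′ a″ b″ c″ e″ →
    a * (c′ + c″) + c * (a′ + a″) + M * (b * (e′ + e″) + e * (b′ + b″))
    ≡ (a * c′ + c * a′ + M * (b * e′ + e * b′)) + (a * c″ + c * a″ + M * (b * e″ + e * b″))
  distrib₃ = solve-∀ ℚ-ring

  distrib₄ : ∀ M N a b c e a′ b′ c′ e′ a″ b″ c″ e″ →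
    a * (e′ + e″) + e * (a′ + a″) + b * (c′ + c″) + c * (b′ + b″)
    ≡ (a * e′ + e * a′ + b * c′ + c * b′) + (a * e″ + e * a″ + b * c″ + c * b″)
  distrib₄ = solve-∀ ℚ-ring

  identity₁ : ∀ M N a b c e →
    1ℚ * a + M * (0ℚ * b) + N * (0ℚ * c) + M * N * (0ℚ * e)
    ≡ a
  identity₁ = solve-∀ ℚ-ring

  identity₂ : ∀ M N a b c e →
    1ℚ * b + 0ℚ * a + N * (0ℚ * e + 0ℚ * c)
    ≡ b
  identity₂ = solve-∀ ℚ-ring

  identity₃ : ∀ M N a b c e →
    1ℚ * c + 0ℚ * a + M * (0ℚ * e + 0ℚ * b)
    ≡ c
  identity₃ = solve-∀ ℚ-ring

  identity₄ : ∀ M N a b c e →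
    1ℚ * e + 0ℚ * a + 0ℚ * c + 0ℚ * b
    ≡ e
  identity₄ = solve-∀ ℚ-ring

module Scaling where
  open import Data.Rational.Base using (_+_; _*_; -_)

  neg-involutive : ∀ x → - (- x) ≡ x
  neg-involutive = solve-∀ ℚ-ring

  ι₁ : ∀ M N q a b c e → q * a + M * (0ℚ * b) + N * (0ℚ * c) + M * N * (0ℚ * e) ≡ q * a
  ι₁ = solve-∀ ℚ-ring
  ι₂ : ∀ M N q a b c e → q * b + 0ℚ * a + N * (0ℚ * e + 0ℚ * c) ≡ q * b
  ι₂ = solve-∀ ℚ-ring
  ι₃ : ∀ M N q a b c e → q * c + 0ℚ * a + M * (0ℚ * e + 0ℚ * b) ≡ q * c
  ι₃ = solve-∀ ℚ-ring
  ι₄ : ∀ M N q a b c e → q * e + 0ℚ * a + 0ℚ * c + 0ℚ * b ≡ q * e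
  ι₄ = solve-∀ ℚ-ring

  φ₁ : ∀ M N a b c e a′ b′ c′ e′ →
    a * a′ + M * (b * b′) + N * (c * c′) + M * N * (e * e′)
    ≡ a * a′ + M * (- b * - b′) + N * (c * c′) + M * N * (- e * - e′)
  φ₁ = solve-∀ ℚ-ring
  φ₂ : ∀ M N a b c e a′ b′ c′ e′ →
    - (a * b′ + b * a′ + N * (c * e′ + e * c′)) ≡ a * - b′ + - b * a′ + N * (c * - e′ + - e * c′)
  φ₂ = solve-∀ ℚ-ring
  φ₃ : ∀ M N a b c e a′ b′ c′ e′ →
    a * c′ + c * a′ + M * (b * e′ + e * b′) ≡ a * c′ + c * a′ + M * (- b * - e′ + - e * - b′)
  φ₃ = solve-∀ ℚ-ring
  φ₄ : ∀ M N a b c e a′ b′ c′ e′ →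
    - (a * e′ + e * a′ + b * c′ + c * b′) ≡ a * - e′ + - e * a′ + - b * c′ + c * - b′
  φ₄ = solve-∀ ℚ-ring

  ψ₁ : ∀ M N a b c e a′ b′ c′ e′ →
    a * a′ + M * (b * b′) + N * (c * c′) + M * N * (e * e′)
    ≡ a * a′ + M * (b * b′) + N * (- c * - c′) + M * N * (- e * - e′)
  ψ₁ = solve-∀ ℚ-ring
  ψ₂ : ∀ M N a b c e a′ b′ c′ e′ →
    a * b′ + b * a′ + N * (c * e′ + e * c′) ≡ a * b′ + b * a′ + N * (- c * - e′ + - e * - c′)
  ψ₂ = solve-∀ ℚ-ring
  ψ₃ : ∀ M N a b c e a′ b′ c′ e′ →
    - (a * c′ + c * a′ + M * (b * e′ + e * b′)) ≡ a * - c′ + - c * a′ + M * (b * - e′ + - e * b′)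
  ψ₃ = solve-∀ ℚ-ring
  ψ₄ : ∀ M N a b c e a′ b′ c′ e′ →
    - (a * e′ + e * a′ + b * c′ + c * b′) ≡ a * - e′ + - e * a′ + b * - c′ + - c * b′
  ψ₄ = solve-∀ ℚ-ring

  halve : ∀ b → b ≡ ½ * (b + b)
  halve = solve-∀ ℚ-ring

  cancel : ∀ b → ½ * (b + - b) ≡ 0ℚ
  cancel = solve-∀ ℚ-ring

  -b≡b⇒b≡0 : ∀ {b} → - b ≡ b → b ≡ 0ℚ
  -b≡b⇒b≡0 {b} eq = trans (halve b) (trans (cong (λ x → ½ * (b + x)) (sym eq)) (cancel b))

module BasisIdentities where
  open import Data.Rational.Base using (_+_; _*_; -_; _-_)

  2ℚ 4ℚ : ℚ
  2ℚ = fromℤ (+ 2)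
  4ℚ = fromℤ (+ 4)

  -- In this module `i` stands for 1/d; here it scales √m√n to √k.
  √k₁ : ∀ M N i → i * (0ℚ * 0ℚ + M * (1ℚ * 0ℚ) + N * (0ℚ * 1ℚ) + M * N * (0ℚ * 0ℚ)) ≡ 0ℚ
  √k₁ = solve-∀ ℚ-ring
  √k₂ : ∀ M N i → i * (0ℚ * 0ℚ + 1ℚ * 0ℚ + N * (0ℚ * 0ℚ + 0ℚ * 1ℚ)) ≡ 0ℚ
  √k₂ = solve-∀ ℚ-ring
  √k₃ : ∀ M N i → i * (0ℚ * 1ℚ + 0ℚ * 0ℚ + M * (1ℚ * 0ℚ + 0ℚ * 0ℚ)) ≡ 0ℚ
  √k₃ = solve-∀ ℚ-ring
  √k₄ : ∀ (i : ℚ) → i * (0ℚ * 0ℚ + 0ℚ * 0ℚ + 1ℚ * 1ℚ + 0ℚ * 0ℚ) ≡ i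
  √k₄ = solve-∀ ℚ-ring

  γ₄₁ : ∀ M N i → ½ * ½ + M * (½ * 0ℚ) + N * (0ℚ * 0ℚ) + M * N * (0ℚ * (½ * i)) ≡ ½ * ½
  γ₄₁ = solve-∀ ℚ-ring
  γ₄₂ : ∀ N i → ½ * 0ℚ + ½ * ½ + N * (0ℚ * (½ * i) + 0ℚ * 0ℚ) ≡ ½ * ½
  γ₄₂ = solve-∀ ℚ-ring
  γ₄₃ : ∀ M i → ½ * 0ℚ + 0ℚ * ½ + M * (½ * (½ * i) + 0ℚ * 0ℚ) ≡ ½ * ½ * (M * i)
  γ₄₃ = solve-∀ ℚ-ring
  γ₄₄ : ∀ i → ½ * (½ * i) + 0ℚ * ½ + ½ * 0ℚ + 0ℚ * 0ℚ ≡ ½ * ½ * i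
  γ₄₄ = solve-∀ ℚ-ring

  -- γ₂ is a root of X² - X - J with J = (m - 1)/4, and `1ℚ + 4ℚ * J` is m written through J. The
  -- same pattern serves γ₃ and ½(1 + √k).
  γ₂²₁ : ∀ N J →
    ½ * ½ + (1ℚ + 4ℚ * J) * (½ * ½) + N * (0ℚ * 0ℚ) + (1ℚ + 4ℚ * J) * N * (0ℚ * 0ℚ)
    ≡ ½ + J
  γ₂²₁ = solve-∀ ℚ-ring
  γ₂²₂ : ∀ N J →
    ½ * ½ + ½ * ½ + N * (0ℚ * 0ℚ + 0ℚ * 0ℚ)
    ≡ ½ + 0ℚ
  γ₂²₂ = solve-∀ ℚ-ring
  γ₂²₃ : ∀ N J →
    ½ * 0ℚ + 0ℚ * ½ + (1ℚ + 4ℚ * J) * (½ * 0ℚ + 0ℚ * ½)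
    ≡ 0ℚ + 0ℚ
  γ₂²₃ = solve-∀ ℚ-ring
  γ₂²₄ : ∀ N J →
    ½ * 0ℚ + 0ℚ * ½ + ½ * 0ℚ + 0ℚ * ½
    ≡ 0ℚ + 0ℚ
  γ₂²₄ = solve-∀ ℚ-ring

  γ₃²₁ : ∀ M J →
    ½ * ½ + M * (0ℚ * 0ℚ) + (1ℚ + 4ℚ * J) * (½ * ½) + M * (1ℚ + 4ℚ * J) * (0ℚ * 0ℚ)
    ≡ ½ + J
  γ₃²₁ = solve-∀ ℚ-ring
  γ₃²₂ : ∀ M J →
    ½ * 0ℚ + 0ℚ * ½ + (1ℚ + 4ℚ * J) * (½ * 0ℚ + 0ℚ * ½)
    ≡ 0ℚ + 0ℚ
  γ₃²₂ = solve-∀ ℚ-ring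
  γ₃²₃ : ∀ M J →
    ½ * ½ + ½ * ½ + M * (0ℚ * 0ℚ + 0ℚ * 0ℚ)
    ≡ ½ + 0ℚ
  γ₃²₃ = solve-∀ ℚ-ring
  γ₃²₄ : ∀ M J →
    ½ * 0ℚ + 0ℚ * ½ + 0ℚ * ½ + ½ * 0ℚ
    ≡ 0ℚ + 0ℚ
  γ₃²₄ = solve-∀ ℚ-ring

  κ²₁ : ∀ M N i →
    ½ * ½ + M * (0ℚ * 0ℚ) + N * (0ℚ * 0ℚ) + M * N * ((½ * i) * (½ * i))
    ≡ ¼ + ¼ * (M * N * (i * i))
  κ²₁ = solve-∀ ℚ-ring
  κ²₂ : ∀ M N i →
    ½ * 0ℚ + 0ℚ * ½ + N * (0ℚ * (½ * i) + (½ * i) * 0ℚ)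
    ≡ 0ℚ + 0ℚ
  κ²₂ = solve-∀ ℚ-ring
  κ²₃ : ∀ M N i →
    ½ * 0ℚ + 0ℚ * ½ + M * (0ℚ * (½ * i) + (½ * i) * 0ℚ)
    ≡ 0ℚ + 0ℚ
  κ²₃ = solve-∀ ℚ-ring
  κ²₄ : ∀ M N i →
    ½ * (½ * i) + (½ * i) * ½ + 0ℚ * 0ℚ + 0ℚ * 0ℚ
    ≡ ½ * i + 0ℚ
  κ²₄ = solve-∀ ℚ-ring

  κ²-K : ∀ J → ¼ + ¼ * (1ℚ + 4ℚ * J) ≡ ½ + J
  κ²-K = solve-∀ ℚ-ring

  quadratic₁ : ∀ a j → - j + (- 1ℚ * a + (a + j)) ≡ 0ℚ
  quadratic₁ = solve-∀ ℚ-ring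
  quadratic₂ : ∀ b → 0ℚ + (- 1ℚ * b + (b + 0ℚ)) ≡ 0ℚ
  quadratic₂ = solve-∀ ℚ-ring

  span₁ : ∀ (x₁ x₂ x₃ x₄ m′ i : ℚ) →
    x₁ * 1ℚ + x₂ * ½ + x₃ * ½ + x₄ * ¼
    ≡ ¼ * (4ℚ * x₁ + (2ℚ * x₂ + 2ℚ * x₃ + x₄))
  span₁ = solve-∀ ℚ-ring
  span₂ : ∀ (x₁ x₂ x₃ x₄ m′ i : ℚ) →
    x₁ * 0ℚ + x₂ * ½ + x₃ * 0ℚ + x₄ * ¼
    ≡ ¼ * (2ℚ * x₂ + x₄)
  span₂ = solve-∀ ℚ-ring
  span₃ : ∀ (x₁ x₂ x₃ x₄ m′ i : ℚ) →
    x₁ * 0ℚ + x₂ * 0ℚ + x₃ * ½ + x₄ * (¼ * m′)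
    ≡ ¼ * (2ℚ * x₃ + m′ * x₄)
  span₃ = solve-∀ ℚ-ring
  span₄ : ∀ (x₁ x₂ x₃ x₄ m′ i : ℚ) →
    x₁ * 0ℚ + x₂ * 0ℚ + x₃ * 0ℚ + x₄ * (¼ * i)
    ≡ ¼ * (i * x₄)
  span₄ = solve-∀ ℚ-ring

  trace₁ : ∀ (a b c e : ℚ) →
    a + a + (a + a)
    ≡ 4ℚ * a
  trace₁ = solve-∀ ℚ-ring
  trace₂ : ∀ (a b c e : ℚ) →
    b + b + - (b + b)
    ≡ 0ℚ
  trace₂ = solve-∀ ℚ-ring
  trace₃ : ∀ (a b c e : ℚ) →
    c + - c + (c + - c)
    ≡ 0ℚ
  trace₃ = solve-∀ ℚ-ring
  trace₄ : ∀ (a b c e : ℚ) →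
    e + - e + - (e + - e)
    ≡ 0ℚ
  trace₄ = solve-∀ ℚ-ring

  -- The relative trace `v ⊕ ψ v` lies in ℚ(√m), and this is its norm (2a)² - m(2b)² to ℚ, expressed
  -- in 4a and 4b because these will turn out to be integers. The variants for √n and √k use the
  -- other two relative traces.
  normₘ₁ : ∀ M N a b c e →
    (a + a) * (a + a) + M * ((b + b) * (- (b + b))) + N * ((c + - c) * (c + - c)) + M * N * ((e + - e) * (- (e + - e)))
    ≡ ¼ * (4ℚ * a * (4ℚ * a) - M * (4ℚ * b * (4ℚ * b)))
  normₘ₁ = solve-∀ ℚ-ring
  normₘ₂ : ∀ M N a b c e →
    (a + a) * (- (b + b)) + (b + b) * (a + a) + N * ((c + - c) * (- (e + - e)) + (e + - e) * (c + - c))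
    ≡ 0ℚ
  normₘ₂ = solve-∀ ℚ-ring
  normₘ₃ : ∀ M N a b c e →
    (a + a) * (c + - c) + (c + - c) * (a + a) + M * ((b + b) * (- (e + - e)) + (e + - e) * (- (b + b)))
    ≡ 0ℚ
  normₘ₃ = solve-∀ ℚ-ring
  normₘ₄ : ∀ M N a b c e →
    (a + a) * (- (e + - e)) + (e + - e) * (a + a) + (b + b) * (c + - c) + (c + - c) * (- (b + b))
    ≡ 0ℚ
  normₘ₄ = solve-∀ ℚ-ring

  normₙ₁ : ∀ M N a b c e →
    (a + a) * (a + a) + M * ((b + - b) * (b + - b)) + N * ((c + c) * (- (c + c))) + M * N * ((e + - e) * (- (e + - e)))
    ≡ ¼ * (4ℚ * a * (4ℚ * a) - N * (4ℚ * c * (4ℚ * c)))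
  normₙ₁ = solve-∀ ℚ-ring
  normₙ₂ : ∀ M N a b c e →
    (a + a) * (b + - b) + (b + - b) * (a + a) + N * ((c + c) * (- (e + - e)) + (e + - e) * (- (c + c)))
    ≡ 0ℚ
  normₙ₂ = solve-∀ ℚ-ring
  normₙ₃ : ∀ M N a b c e →
    (a + a) * (- (c + c)) + (c + c) * (a + a) + M * ((b + - b) * (- (e + - e)) + (e + - e) * (b + - b))
    ≡ 0ℚ
  normₙ₃ = solve-∀ ℚ-ring
  normₙ₄ : ∀ M N a b c e →
    (a + a) * (- (e + - e)) + (e + - e) * (a + a) + (b + - b) * (- (c + c)) + (c + c) * (b + - b)
    ≡ 0ℚ
  normₙ₄ = solve-∀ ℚ-ring

  normₖ₁ : ∀ M N a b c e →
    (a + a) * (a + a) + M * ((b + - b) * (- (b + - b))) + N * ((c + - c) * (c + - c)) + M * N * ((e + - - e) * (- (e + - - e)))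
    ≡ ¼ * (4ℚ * a * (4ℚ * a) - M * N * (4ℚ * e * (4ℚ * e)))
  normₖ₁ = solve-∀ ℚ-ring
  normₖ₂ : ∀ M N a b c e →
    (a + a) * (- (b + - b)) + (b + - b) * (a + a) + N * ((c + - c) * (- (e + - - e)) + (e + - - e) * (c + - c))
    ≡ 0ℚ
  normₖ₂ = solve-∀ ℚ-ring
  normₖ₃ : ∀ M N a b c e →
    (a + a) * (c + - c) + (c + - c) * (a + a) + M * ((b + - b) * (- (e + - - e)) + (e + - - e) * (- (b + - b)))
    ≡ 0ℚ
  normₖ₃ = solve-∀ ℚ-ring
  normₖ₄ : ∀ M N a b c e →
    (a + a) * (- (e + - - e)) + (e + - - e) * (a + a) + (b + - b) * (c + - c) + (c + - c) * (- (b + - b))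
    ≡ 0ℚ
  normₖ₄ = solve-∀ ℚ-ring

  quarter₄ : ∀ a → a ≡ ¼ * (4ℚ * a)
  quarter₄ = solve-∀ ℚ-ring
  quarter₄-d : ∀ i d e → ¼ * (i * (4ℚ * (d * e))) ≡ i * d * e
  quarter₄-d = solve-∀ ℚ-ring
  scale-√k : ∀ K D e → K * (D * D) * (4ℚ * e * (4ℚ * e)) ≡ K * (4ℚ * (D * e) * (4ℚ * (D * e)))
  scale-√k = solve-∀ ℚ-ring
  unscale-√k : ∀ K i d → K * (d * d) * (i * i) ≡ K * (i * d * (i * d))
  unscale-√k = solve-∀ ℚ-ring

module ActionIdentities where
  open import Data.Rational.Base using (_+_; _*_; -_; _-_)

  2ℚ : ℚ
  2ℚ = fromℤ (+ 2)

  -- For v = (x, y, z, t) this is the general element of H with ζ = √m, τ = ψ and σ = φ. The lines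
  -- of 1 and √m are scaled; on the plane of √n and √m√n the action is a - b plus 2e times (z, t) ↦
  -- (-mt, z).
  act₁-₁ : ∀ M N a b c e x y z t →
    a * x + b * x + c * (x + x) + e * (0ℚ * (x + - x) + M * (1ℚ * (- y + - - y)) + N * (0ℚ * (z + - - z)) + M * N * (0ℚ * (- t + - - - t)))
    ≡ (a + b + 2ℚ * c) * x
  act₁-₁ = solve-∀ ℚ-ring
  act₁-₂ : ∀ M N a b c e x y z t →
    a * y + b * y + c * (- y + - y) + e * (0ℚ * (- y + - - y) + 1ℚ * (x + - x) + N * (0ℚ * (- t + - - - t) + 0ℚ * (z + - - z)))
    ≡ (a + b - 2ℚ * c) * y
  act₁-₂ = solve-∀ ℚ-ring
  act₁-₃ : ∀ M N a b c e x y z t →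
    a * z + b * - z + c * (z + - z) + e * (0ℚ * (z + - - z) + 0ℚ * (x + - x) + M * (1ℚ * (- t + - - - t) + 0ℚ * (- y + - - y)))
    ≡ (a - b) * z - 2ℚ * e * (M * t)
  act₁-₃ = solve-∀ ℚ-ring
  act₁-₄ : ∀ M N a b c e x y z t →
    a * t + b * - t + c * (- t + - - t) + e * (0ℚ * (- t + - - - t) + 0ℚ * (x + - x) + 1ℚ * (z + - - z) + 0ℚ * (- y + - - y))
    ≡ (a - b) * t + 2ℚ * e * z
  act₁-₄ = solve-∀ ℚ-ring

  act₂-₁ : ∀ M N a b c e x y z t →
    a * x + b * x + c * (x + x) + e * (0ℚ * (x + - x) + M * (0ℚ * (y + - - y)) + N * (1ℚ * (- z + - - z)) + M * N * (0ℚ * (- t + - - - t)))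
    ≡ (a + b + 2ℚ * c) * x
  act₂-₁ = solve-∀ ℚ-ring
  act₂-₂ : ∀ M N a b c e x y z t →
    a * y + b * - y + c * (y + - y) + e * (0ℚ * (y + - - y) + 0ℚ * (x + - x) + N * (1ℚ * (- t + - - - t) + 0ℚ * (- z + - - z)))
    ≡ (a - b) * y - 2ℚ * e * (N * t)
  act₂-₂ = solve-∀ ℚ-ring
  act₂-₃ : ∀ M N a b c e x y z t →
    a * z + b * z + c * (- z + - z) + e * (0ℚ * (- z + - - z) + 1ℚ * (x + - x) + M * (0ℚ * (- t + - - - t) + 0ℚ * (y + - - y)))
    ≡ (a + b - 2ℚ * c) * z
  act₂-₃ = solve-∀ ℚ-ring
  act₂-₄ : ∀ M N a b c e x y z t →
    a * t + b * - t + c * (- t + - - t) + e * (0ℚ * (- t + - - - t) + 0ℚ * (x + - x) + 0ℚ * (- z + - - z) + 1ℚ * (y + - - y))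
    ≡ (a - b) * t + 2ℚ * e * y
  act₂-₄ = solve-∀ ℚ-ring

  act₃-₁ : ∀ M N i a b c e x y z t →
    a * x + b * x + c * (x + x) + e * (0ℚ * (x + - x) + M * (0ℚ * (y + - - y)) + N * (0ℚ * (- z + - - - z)) + M * N * (i * (- t + - - - - t)))
    ≡ (a + b + 2ℚ * c) * x
  act₃-₁ = solve-∀ ℚ-ring
  act₃-₂ : ∀ M N i a b c e x y z t →
    a * y + b * - y + c * (y + - y) + e * (0ℚ * (y + - - y) + 0ℚ * (x + - x) + N * (0ℚ * (- t + - - - - t) + i * (- z + - - - z)))
    ≡ (a - b) * y + - 2ℚ * e * (N * i * z)
  act₃-₂ = solve-∀ ℚ-ring
  act₃-₃ : ∀ M N i a b c e x y z t →
    a * z + b * - z + c * (- z + - - z) + e * (0ℚ * (- z + - - - z) + 0ℚ * (x + - x) + M * (0ℚ * (- t + - - - - t) + i * (y + - - y)))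
    ≡ (a - b) * z - - 2ℚ * e * (M * i * y)
  act₃-₃ = solve-∀ ℚ-ring
  act₃-₄ : ∀ M N i a b c e x y z t →
    a * t + b * - - t + c * (- t + - - - t) + e * (0ℚ * (- t + - - - - t) + i * (x + - x) + 0ℚ * (- z + - - - z) + 0ℚ * (y + - - y))
    ≡ (a + b - 2ℚ * c) * t
  act₃-₄ = solve-∀ ℚ-ring

  decompose₁ : ∀ M N a b c e → a + b * 0ℚ + c * 0ℚ + e * (0ℚ * 0ℚ + M * (1ℚ * 0ℚ) + N * (0ℚ * 1ℚ) + M * N * (0ℚ * 0ℚ)) ≡ a
  decompose₁ = solve-∀ ℚ-ring
  decompose₂ : ∀ N b c e → 0ℚ + b * 1ℚ + c * 0ℚ + e * (0ℚ * 0ℚ + 1ℚ * 0ℚ + N * (0ℚ * 0ℚ + 0ℚ * 1ℚ)) ≡ b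
  decompose₂ = solve-∀ ℚ-ring
  decompose₃ : ∀ M b c e → 0ℚ + b * 0ℚ + c * 1ℚ + e * (0ℚ * 1ℚ + 0ℚ * 0ℚ + M * (1ℚ * 0ℚ + 0ℚ * 0ℚ)) ≡ c
  decompose₃ = solve-∀ ℚ-ring
  decompose₄ : ∀ b c e → 0ℚ + b * 0ℚ + c * 0ℚ + e * (0ℚ * 0ℚ + 0ℚ * 0ℚ + 1ℚ * 1ℚ + 0ℚ * 0ℚ) ≡ e
  decompose₄ = solve-∀ ℚ-ring

  √m²₁ : ∀ M N → 0ℚ * 0ℚ + M * (1ℚ * 1ℚ) + N * (0ℚ * 0ℚ) + M * N * (0ℚ * 0ℚ) ≡ M
  √m²₁ = solve-∀ ℚ-ring
  √m²₂ : ∀ N → 0ℚ * 1ℚ + 1ℚ * 0ℚ + N * (0ℚ * 0ℚ + 0ℚ * 0ℚ) ≡ 0ℚ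
  √m²₂ = solve-∀ ℚ-ring
  √m²₃ : ∀ M → 0ℚ * 0ℚ + 0ℚ * 0ℚ + M * (1ℚ * 0ℚ + 0ℚ * 1ℚ) ≡ 0ℚ
  √m²₃ = solve-∀ ℚ-ring
  √n²₁ : ∀ M N → 0ℚ * 0ℚ + M * (0ℚ * 0ℚ) + N * (1ℚ * 1ℚ) + M * N * (0ℚ * 0ℚ) ≡ N
  √n²₁ = solve-∀ ℚ-ring
  √n²₂ : ∀ N → 0ℚ * 0ℚ + 0ℚ * 0ℚ + N * (1ℚ * 0ℚ + 0ℚ * 1ℚ) ≡ 0ℚ
  √n²₂ = solve-∀ ℚ-ring
  √n²₃ : ∀ M → 0ℚ * 1ℚ + 1ℚ * 0ℚ + M * (0ℚ * 0ℚ + 0ℚ * 0ℚ) ≡ 0ℚ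
  √n²₃ = solve-∀ ℚ-ring

module EmbeddingIdentities where
  open import Data.Rational.Base using (_+_; _*_; -_; _-_)
  open ActionIdentities using (2ℚ) public

  swap-difference : ∀ y z → z + - y ≡ - (y + - z)
  swap-difference = solve-∀ ℚ-ring
  swap-scalar : ∀ e x → e * - x ≡ - e * x
  swap-scalar = solve-∀ ℚ-ring

  line : ∀ p A → p * (¼ * A) ≡ ¼ * (p * A)
  line = solve-∀ ℚ-ring
  line-√k : ∀ q i δ X → q * (¼ * (i * (δ * X))) ≡ ¼ * (i * (δ * (q * X)))
  line-√k = solve-∀ ℚ-ring
  plane₁ : ∀ r s Y M i δ Z → r * (¼ * Y) - s * (M * (¼ * (i * (δ * Z)))) ≡ ¼ * (r * Y - s * (M * (i * δ)) * Z)
  plane₁ = solve-∀ ℚ-ring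
  plane₂-lhs : ∀ r s Y i δ Z → r * (¼ * (i * (δ * Z))) + s * (¼ * Y) ≡ ¼ * (i * (δ * (r * Z)) + s * 1ℚ * Y)
  plane₂-lhs = solve-∀ ℚ-ring
  plane₂-rhs : ∀ r s Y i δ Z w → ¼ * (i * (δ * (r * Z)) + s * (i * δ * w) * Y) ≡ ¼ * (i * (δ * (r * Z + s * w * Y)))
  plane₂-rhs = solve-∀ ℚ-ring
  plane₃ : ∀ r s Y w Z → r * (¼ * Z) + s * (w * (¼ * Y)) ≡ ¼ * (r * Z + s * w * Y)
  plane₃ = solve-∀ ℚ-ring
  plane₄ : ∀ r s Y u Z → r * (¼ * Y) - s * (u * (¼ * Z)) ≡ ¼ * (r * Y - s * u * Z)
  plane₄ = solve-∀ ℚ-ring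

  -- The system p = a + b + 2c, q = a + b - 2c, r = a - b is solved for a, b, c; thus every rational
  -- (p, q, r, s) occurs in H.
  coefficient-p : ∀ p q r → ¼ * (p + q) + ½ * r + (¼ * (p + q) - ½ * r) + 2ℚ * (¼ * (p - q)) ≡ p
  coefficient-p = solve-∀ ℚ-ring
  coefficient-q : ∀ p q r → ¼ * (p + q) + ½ * r + (¼ * (p + q) - ½ * r) - 2ℚ * (¼ * (p - q)) ≡ q
  coefficient-q = solve-∀ ℚ-ring
  coefficient-r : ∀ p q r → ¼ * (p + q) + ½ * r - (¼ * (p + q) - ½ * r) ≡ r
  coefficient-r = solve-∀ ℚ-ring
  coefficient-s : ∀ κ κ⁻¹ s → κ * (κ⁻¹ * s) ≡ κ * κ⁻¹ * s
  coefficient-s = solve-∀ ℚ-ring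

module CoreIdentities where
  open import Data.Rational.Base using (_+_; _*_; -_; _-_)
  open ActionIdentities using (2ℚ)

  zero-plane₁ : ∀ r su → r * 0ℚ - su * 0ℚ ≡ 0ℚ
  zero-plane₁ = solve-∀ ℚ-ring
  zero-plane₂ : ∀ r sw → r * 0ℚ + sw * 0ℚ ≡ 0ℚ
  zero-plane₂ = solve-∀ ℚ-ring
  only-first : ∀ r su → r * 2ℚ - su * 0ℚ ≡ r * 2ℚ
  only-first = solve-∀ ℚ-ring
  only-second : ∀ r sw → r * 0ℚ + sw * 2ℚ ≡ sw * 2ℚ
  only-second = solve-∀ ℚ-ring
  only-second⁻ : ∀ r su → r * 0ℚ - su * 2ℚ ≡ - su * 2ℚ
  only-second⁻ = solve-∀ ℚ-ring
  halve : ∀ q → ½ * (q * 2ℚ) ≡ q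
  halve = solve-∀ ℚ-ring
  halve′ : ∀ q → ½ * (2ℚ * q) ≡ q
  halve′ = solve-∀ ℚ-ring
  quarter-of : ∀ q → ¼ * (q * fromℤ (+ 4)) ≡ q
  quarter-of = solve-∀ ℚ-ring
  quarter-of′ : ∀ q → ¼ * (fromℤ (+ 4) * q) ≡ q
  quarter-of′ = solve-∀ ℚ-ring

  -- Cramer's rule for (r, s) ↦ (rY - suZ, rZ + swY), whose determinant is wY² + uZ².
  recover-r : ∀ r s u w Y Z → r * (w * (Y * Y) + u * (Z * Z)) ≡ w * Y * (r * Y - s * u * Z) + u * Z * (r * Z + s * w * Y)
  recover-r = solve-∀ ℚ-ring
  recover-s : ∀ r s u w Y Z → s * (w * (Y * Y) + u * (Z * Z)) ≡ Y * (r * Z + s * w * Y) - Z * (r * Y - s * u * Z)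
  recover-s = solve-∀ ℚ-ring

  cancelʳ : ∀ {p q d d⁻¹} → d * d⁻¹ ≡ 1ℚ → p * d ≡ q * d → p ≡ q
  cancelʳ {p} {q} {d} {d⁻¹} dd⁻¹≡1 pd≡qd = trans (sym (undo p)) (trans (cong (_* d⁻¹) pd≡qd) (undo q))
    where
    undo : ∀ p → p * d * d⁻¹ ≡ p
    undo p = trans (ℚₚ.*-assoc p d d⁻¹) (trans (cong (p *_) dd⁻¹≡1) (ℚₚ.*-identityʳ p))

-- Almost integral elements of a commutative semiring.

module CompleteIntegralClosure (R : CommutativeSemiring 0ℓ 0ℓ) where
  open CommutativeSemiring R renaming (refl to ≈-refl; sym to ≈-sym; trans to ≈-trans)
  open Exp semiring using (_^_)
  open NaturalCoefficients R using (solve; _:+_; _:*_; _:=_; con)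

  monic : List Carrier → Carrier → Carrier
  monic []       x = 1#
  monic (c ∷ cs) x = c + x * monic cs x

  -- Relative to a subring P of R, with denominators taken from the multiplicative set Den.
  module Closure
    (P Den : Carrier → Set) (P-resp : P Respects _≈_)
    (P-0 : P 0#) (P-1 : P 1#)
    (P-+ : ∀ {x y} → P x → P y → P (x + y))
    (P-* : ∀ {x y} → P x → P y → P (x * y))
    (P-cancel : ∀ {x y} → P (x + y) → P x → P y)
    (Den-1 : Den 1#)
    (Den-* : ∀ {x y} → Den x → Den y → Den (x * y))
    (Den⇒P : ∀ {x} → Den x → P x)
    (clear : ∀ x → ∃ λ δ → Den δ × P (δ * x))
    where

    record AlmostIntegral (x : Carrier) : Set where
      constructor ai
      field
        {denominator} : Carrier
        denominator∈  : Den denominator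
        powers∈       : ∀ j → P (denominator * x ^ j)

    ai-P : ∀ {x} → P x → AlmostIntegral x
    ai-P {x} Px = ai Den-1 λ j → P-* P-1 (P-^ j)
      where
      P-^ : ∀ j → P (x ^ j)
      P-^ zero    = P-1
      P-^ (suc j) = P-* Px (P-^ j)

    private
      module _ {x y} (x-ai : AlmostIntegral x) (y-ai : AlmostIntegral y) where
        open AlmostIntegral x-ai renaming (denominator to δ; denominator∈ to δ∈; powers∈ to Pδ)
        open AlmostIntegral y-ai renaming (denominator to ε; denominator∈ to ε∈; powers∈ to Pε)

        -- Carrying all monomials x^i y^j along makes the induction work: a further factor x + y or
        -- x * y only raises exponents, so no binomial expansion is needed.
        Multiplier : Carrier → Set
        Multiplier z = ∀ i j → P ((δ * ε) * ((x ^ i * y ^ j) * z))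

        multiplier-1 : Multiplier 1#
        multiplier-1 i j = P-resp
          (solve 4 (λ δ ε a b → (δ :* a) :* (ε :* b) := (δ :* ε) :* ((a :* b) :* con 1)) ≈-refl
            δ ε (x ^ i) (y ^ j))
          (P-* (Pδ i) (Pε j))

        multiplier-+ : ∀ {z} → Multiplier z → Multiplier ((x + y) * z)
        multiplier-+ {z} M i j = P-resp
          (solve 6 (λ δ a b x y z →
             δ :* (((x :* a) :* b) :* z) :+ δ :* ((a :* (y :* b)) :* z)
             := δ :* ((a :* b) :* ((x :+ y) :* z))) ≈-refl
            (δ * ε) (x ^ i) (y ^ j) x y z)
          (P-+ (M (suc i) j) (M i (suc j)))

        multiplier-* : ∀ {z} → Multiplier z → Multiplier ((x * y) * z)
        multiplier-* {z} M i j = P-resp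
          (solve 6 (λ δ a b x y z →
             δ :* (((x :* a) :* (y :* b)) :* z)
             := δ :* ((a :* b) :* ((x :* y) :* z))) ≈-refl
            (δ * ε) (x ^ i) (y ^ j) x y z)
          (M (suc i) (suc j))

        multiplier⇒ai : ∀ t → (∀ {z} → Multiplier z → Multiplier (t * z)) → AlmostIntegral t
        multiplier⇒ai t step = ai (Den-* δ∈ ε∈) λ j → P-resp
          (solve 3 (λ δ ε z → (δ :* ε) :* ((con 1 :* con 1) :* z) := (δ :* ε) :* z) ≈-refl δ ε (t ^ j))
          (powers j 0 0)
          where
          powers : ∀ j → Multiplier (t ^ j)
          powers zero    = multiplier-1
          powers (suc j) = step (powers j)

    ai-+ : ∀ {x y} → AlmostIntegral x → AlmostIntegral y → AlmostIntegral (x + y)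
    ai-+ {x} {y} a b = multiplier⇒ai a b (x + y) (multiplier-+ a b)

    ai-* : ∀ {x y} → AlmostIntegral x → AlmostIntegral y → AlmostIntegral (x * y)
    ai-* {x} {y} a b = multiplier⇒ai a b (x * y) (multiplier-* a b)

    private
      common-denominator : ∀ x r → ∃ λ δ → Den δ × ∀ i → i ℕ.< r → P (δ * x ^ i)
      common-denominator x zero    = 1# , Den-1 , λ _ ()
      common-denominator x (suc r) =
        let δ , δ∈ , Pδ = common-denominator x r
            ε , ε∈ , Pε = clear (x ^ r)
        in δ * ε , Den-* δ∈ ε∈ , λ where
             i (ℕ.s≤s i≤r) → [ (λ i<r → P-resp
                                  (solve 3 (λ δ ε z → ε :* (δ :* z) := (δ :* ε) :* z) ≈-refl δ ε (x ^ i))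
                                  (P-* (Den⇒P ε∈) (Pδ i i<r)))
                              , (λ where refl → P-resp (≈-sym (*-assoc δ ε (x ^ r))) (P-* (Den⇒P δ∈) Pε))
                              ]′ (ℕₚ.m≤n⇒m<n∨m≡n i≤r)

      module _ (δ x : Carrier) where

        -- The lower terms are removed one by one, by `P-cancel` in place of subtraction. After the
        -- constant term is gone, the Horner tail is again a monic polynomial, now applied to
        -- `x * v`.
        leading : ∀ {cs} → All P cs → ∀ v → (∀ i → i ℕ.< length cs → P (δ * (x ^ i * v))) →
          P (δ * (monic cs x * v)) → P (δ * (x ^ length cs * v))
        leading []                       v lower total = total
        leading {c ∷ cs} (Pc ∷ Pcs) v lower total = P-resp
          (shift (x ^ length cs) v)
          (leading Pcs (x * v)
            (λ i i<r → P-resp (≈-sym (shift (x ^ i) v)) (lower (suc i) (ℕ.s≤s i<r)))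
            (P-cancel
              (P-resp (solve 5 (λ δ c x t v → δ :* ((c :+ x :* t) :* v)
                                := c :* (δ :* (con 1 :* v)) :+ δ :* (t :* (x :* v))) ≈-refl
                       δ c x (monic cs x) v)
                total)
              (P-* Pc (lower 0 (ℕ.s≤s ℕ.z≤n)))))
          where
          shift : ∀ t v → δ * (t * (x * v)) ≈ δ * ((x * t) * v)
          shift = solve 4 (λ δ x t v → δ :* (t :* (x :* v)) := δ :* ((x :* t) :* v)) ≈-refl δ x

    integral⇒ai : ∀ {cs} x → All P cs → monic cs x ≈ 0# → AlmostIntegral x
    integral⇒ai {cs} x Pcs root =
      let δ , δ∈ , Pδ = common-denominator x (length cs)

          -- As x is a root, the full polynomial contributes 0, so a window of r consecutive
          -- multiples with denominator δ can be lengthened by one.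
          extend : ∀ v → (∀ i → i ℕ.< length cs → P (δ * (x ^ i * v))) →
                   ∀ i → i ℕ.≤ length cs → P (δ * (x ^ i * v))
          extend = λ v lower i i≤r →
            [ lower i
            , (λ where refl → leading δ x Pcs v lower (P-resp (≈-sym (≈-trans
                         (*-congˡ (≈-trans (*-congʳ root) (zeroˡ v))) (zeroʳ δ))) P-0))
            ]′ (ℕₚ.m≤n⇒m<n∨m≡n i≤r)
      in ai δ∈ λ j → P-resp (*-congˡ (*-identityˡ (x ^ j))) (powers δ extend Pδ j 0 ℕ.z≤n)
      where
      -- The induction slides a window of consecutive powers: all exponents j, ..., j + r are
      -- cleared at once, since the step takes its lower entries from the previous window and only
      -- its top entry from `extend`.
      powers : ∀ δ →
        (∀ v → (∀ i → i ℕ.< length cs → P (δ * (x ^ i * v))) →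
               ∀ i → i ℕ.≤ length cs → P (δ * (x ^ i * v))) →
        (∀ i → i ℕ.< length cs → P (δ * x ^ i)) →
        ∀ j i → i ℕ.≤ length cs → P (δ * (x ^ i * x ^ j))
      powers δ extend Pδ zero = extend 1# λ i i<r →
        P-resp (*-congˡ (≈-sym (*-identityʳ (x ^ i)))) (Pδ i i<r)
      powers δ extend Pδ (suc j) = extend (x ^ suc j) λ i i<r →
        P-resp (solve 4 (λ δ x a b → δ :* ((x :* a) :* b) := δ :* (a :* (x :* b))) ≈-refl δ x (x ^ i) (x ^ j))
          (powers δ extend Pδ j (suc i) i<r)

-- Elementary symmetric functions of four elements.

module MonicQuartic (R : CommutativeSemiring 0ℓ 0ℓ) where
  open CommutativeSemiring R using (Carrier; _≈_; _+_; _*_; 0#; 1#) renaming (refl to ≈-refl)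
  open NaturalCoefficients R using (solve; _:+_; _:*_; _:=_; con)

  e₁ e₂ e₃ e₄ : (w x y z : Carrier) → Carrier
  e₁ w x y z = (w + x) + (y + z)
  e₂ w x y z = w * x + (w + x) * (y + z) + y * z
  e₃ w x y z = (w * x) * (y + z) + (w + x) * (y * z)
  e₄ w x y z = (w * x) * (y * z)

  -- The two double transpositions are the ones by which φ and ψ permute the four conjugates; they
  -- generate all that is required for invariance.
  e₁-swap₁ : ∀ w x y z → e₁ w x y z ≈ e₁ x w z y
  e₁-swap₁ = solve 4 (λ w x y z → (w :+ x) :+ (y :+ z) := (x :+ w) :+ (z :+ y)) ≈-refl

  e₁-swap₂ : ∀ w x y z → e₁ w x y z ≈ e₁ y z w x
  e₁-swap₂ = solve 4 (λ w x y z → (w :+ x) :+ (y :+ z) := (y :+ z) :+ (w :+ x)) ≈-refl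

  e₂-swap₁ : ∀ w x y z → e₂ w x y z ≈ e₂ x w z y
  e₂-swap₁ = solve 4 (λ w x y z → w :* x :+ (w :+ x) :* (y :+ z) :+ y :* z
                               := x :* w :+ (x :+ w) :* (z :+ y) :+ z :* y) ≈-refl

  e₂-swap₂ : ∀ w x y z → e₂ w x y z ≈ e₂ y z w x
  e₂-swap₂ = solve 4 (λ w x y z → w :* x :+ (w :+ x) :* (y :+ z) :+ y :* z
                               := y :* z :+ (y :+ z) :* (w :+ x) :+ w :* x) ≈-refl

  e₃-swap₁ : ∀ w x y z → e₃ w x y z ≈ e₃ x w z y
  e₃-swap₁ = solve 4 (λ w x y z → (w :* x) :* (y :+ z) :+ (w :+ x) :* (y :* z)
                               := (x :* w) :* (z :+ y) :+ (x :+ w) :* (z :* y)) ≈-refl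

  e₃-swap₂ : ∀ w x y z → e₃ w x y z ≈ e₃ y z w x
  e₃-swap₂ = solve 4 (λ w x y z → (w :* x) :* (y :+ z) :+ (w :+ x) :* (y :* z)
                               := (y :* z) :* (w :+ x) :+ (y :+ z) :* (w :* x)) ≈-refl

  e₄-swap₁ : ∀ w x y z → e₄ w x y z ≈ e₄ x w z y
  e₄-swap₁ = solve 4 (λ w x y z → (w :* x) :* (y :* z) := (x :* w) :* (z :* y)) ≈-refl

  e₄-swap₂ : ∀ w x y z → e₄ w x y z ≈ e₄ y z w x
  e₄-swap₂ = solve 4 (λ w x y z → (w :* x) :* (y :* z) := (y :* z) :* (w :* x)) ≈-refl

  -- The left side has the Horner shape of `evalMonic`, and taking w = -v makes the right side
  -- vanish.
  factorise : ∀ v w x y z →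
    e₄ w x y z + v * (e₃ w x y z + v * (e₂ w x y z + v * (e₁ w x y z + v * 1#)))
    ≈ (v + w) * ((v + x) * ((v + y) * (v + z)))
  factorise = solve 5 (λ v w x y z →
    (w :* x) :* (y :* z) :+ v :* ((w :* x) :* (y :+ z) :+ (w :+ x) :* (y :* z)
      :+ v :* (w :* x :+ (w :+ x) :* (y :+ z) :+ y :* z
      :+ v :* ((w :+ x) :+ (y :+ z) :+ v :* con 1)))
    := (v :+ w) :* ((v :+ x) :* ((v :+ y) :* (v :+ z)))) ≈-refl

-- The solver is one for semirings, so w′ stands for -w.
module DifferenceOfSquares (R : CommutativeSemiring 0ℓ 0ℓ) where
  open CommutativeSemiring R using (_≈_; _+_; _*_) renaming (refl to ≈-refl)
  open NaturalCoefficients R using (solve; _:+_; _:*_; _:=_; con)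

  expand : ∀ v w w′ → (v + w′) * (v + w) ≈ v * v + v * (w + w′) + w * w′
  expand = solve 3 (λ v w w′ → (v :+ w′) :* (v :+ w) := v :* v :+ v :* (w :+ w′) :+ w :* w′) ≈-refl

  factor : ∀ w w′ → w * w + w * w′ ≈ w * (w + w′)
  factor = solve 2 (λ w w′ → w :* w :+ w :* w′ := w :* (w :+ w′)) ≈-refl

open import Data.Integer.Base using (_+_; _*_; _-_; -_; -1ℤ)

-- Integers and denominators in ℚ.

fromℤ-injective : ∀ {a b} → fromℤ a ≡ fromℤ b → a ≡ b
fromℤ-injective = cong ↥_

fromℤ-+ : ∀ a b → fromℤ (a + b) ≡ fromℤ a ℚ.+ fromℤ b
fromℤ-+ a b = sym (trans
  (cong (ℚ._/ 1) (cong₂ _+_ (ℤₚ.*-identityʳ a) (ℤₚ.*-identityʳ b)))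
  (ℚₚ.↥p/↧p≡p (fromℤ (a + b))))

fromℤ-* : ∀ a b → fromℤ (a * b) ≡ fromℤ a ℚ.* fromℤ b
fromℤ-* a b = sym (ℚₚ.↥p/↧p≡p (fromℤ (a * b)))

fromℤ-neg : ∀ a → fromℤ (- a) ≡ ℚ.- fromℤ a
fromℤ-neg (+ zero)    = refl
fromℤ-neg (+ suc _)   = refl
fromℤ-neg -[1+ _ ]    = refl

fromℤ-- : ∀ a b → fromℤ (a - b) ≡ fromℤ a ℚ.- fromℤ b
fromℤ-- a b = trans (fromℤ-+ a (- b)) (cong (fromℤ a ℚ.+_) (fromℤ-neg b))

IsInt : ℚ → Set
IsInt q = ∃ λ z → q ≡ fromℤ z

isInt : ∀ z → IsInt (fromℤ z)
isInt z = z , refl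

IsInt-+ : ∀ {p q} → IsInt p → IsInt q → IsInt (p ℚ.+ q)
IsInt-+ (a , refl) (b , refl) = a + b , sym (fromℤ-+ a b)

IsInt-* : ∀ {p q} → IsInt p → IsInt q → IsInt (p ℚ.* q)
IsInt-* (a , refl) (b , refl) = a * b , sym (fromℤ-* a b)

IsInt-neg : ∀ {p} → IsInt p → IsInt (ℚ.- p)
IsInt-neg (a , refl) = - a , sym (fromℤ-neg a)

IsInt-cancelʳ : ∀ {p q} → IsInt (p ℚ.+ q) → IsInt p → IsInt q
IsInt-cancelʳ {p} {q} i j = subst IsInt (eq p q) (IsInt-+ i (IsInt-neg j))
  where
  eq : ∀ p q → (p ℚ.+ q) ℚ.+ ℚ.- p ≡ q
  eq = solve-∀ ℚ-ring

∣unit∣ : ∀ {a b} → a * b ≡ 1ℤ → a ≡ 1ℤ ⊎ a ≡ -1ℤ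
∣unit∣ {a} {b} ab≡1 = ∣a∣≡1⇒a≡±1 a
  (ℕₚ.m*n≡1⇒m≡1 ∣ a ∣ ∣ b ∣ (trans (sym (ℤₚ.abs-* a b)) (cong ∣_∣ ab≡1)))
  where
  ∣a∣≡1⇒a≡±1 : ∀ a → ∣ a ∣ ≡ 1 → a ≡ 1ℤ ⊎ a ≡ -1ℤ
  ∣a∣≡1⇒a≡±1 (+ .1)      refl = inj₁ refl
  ∣a∣≡1⇒a≡±1 -[1+ zero ] refl = inj₂ refl

fromℤ*q≡fromℤ⇒ : ∀ u q z → fromℤ u ℚ.* q ≡ fromℤ z → z * ↧ q ≡ u * ↥ q
fromℤ*q≡fromℤ⇒ u q@(mkℚ _ _ _) z eq
  with *≡* e ← ℚᵘₚ.≃-trans (ℚᵘₚ.≃-sym (ℚₚ.toℚᵘ-homo-* (fromℤ u) q)) (ℚᵘₚ.≃-reflexive (cong toℚᵘ eq))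
  = trans (trans (cong (z *_) (sym (ℤₚ.*-identityˡ (↧ q)))) (sym e)) (ℤₚ.*-identityʳ _)

fromℤ*q≡fromℤ⇐ : ∀ u q z → z * ↧ q ≡ u * ↥ q → fromℤ u ℚ.* q ≡ fromℤ z
fromℤ*q≡fromℤ⇐ u q@(mkℚ _ _ _) z eq = ℚₚ.toℚᵘ-injective (ℚᵘₚ.≃-trans
  (ℚₚ.toℚᵘ-homo-* (fromℤ u) q)
  (*≡* (trans (ℤₚ.*-identityʳ _) (trans (sym eq) (cong (z *_) (sym (ℤₚ.*-identityˡ (↧ q))))))))

↥-↧-coprime : ∀ q → ℕ-Coprime.Coprime ∣ ↧ q ∣ ∣ ↥ q ∣
↥-↧-coprime (mkℚ _ _ c) = ℕ-Coprime.sym (ℕ-Coprime.recompute c)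

↧∣u*↥⇒↧∣u : ∀ q u → ↧ q ∣ u * ↥ q → ↧ q ∣ u
↧∣u*↥⇒↧∣u q u h = ∣ᵤ⇒∣ (coprime-divisor (↧ q) (↥ q) u (↥-↧-coprime q)
  (∣⇒∣ᵤ (subst (↧ q ∣_) (ℤₚ.*-comm u (↥ q)) h)))

-- In lowest terms the denominator is coprime to the numerator, so it has to be absorbed by u
-- entirely.
↧∣multiplier : ∀ u q → IsInt (fromℤ u ℚ.* q) → ↧ q ∣ u
↧∣multiplier u q (z , eq) = ↧∣u*↥⇒↧∣u q u (divides z (sym (fromℤ*q≡fromℤ⇒ u q z eq)))

∣↧∣≡1⇒IsInt : ∀ q → ∣ ↧ q ∣ ≡ 1 → IsInt q
∣↧∣≡1⇒IsInt q@(mkℚ n zero _) refl = n , refl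

↧*q≡↥ : ∀ q → fromℤ (↧ q) ℚ.* q ≡ fromℤ (↥ q)
↧*q≡↥ q = fromℤ*q≡fromℤ⇐ (↧ q) q (↥ q) (ℤₚ.*-comm (↥ q) (↧ q))

IsCoprime : ℤ → ℤ → Set
IsCoprime u w = ∀ g → g ∣ u → g ∣ w → ∣ g ∣ ≡ 1

coprime-multipliers : ∀ u w q → IsCoprime u w →
  IsInt (fromℤ u ℚ.* q) → IsInt (fromℤ w ℚ.* q) → IsInt q
coprime-multipliers u w q c i j =
  ∣↧∣≡1⇒IsInt q (c (↧ q) (↧∣multiplier u q i) (↧∣multiplier w q j))

-- For q = n/d in lowest terms sn² = zd². Coprimality with n is used twice to get d ∣ s and twice
-- more, after cancelling one d, to get d ∣ s/d. Hence d² ∣ s and d is a unit.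
squareFree-multiplier : ∀ s q → SquareFree s → IsInt (fromℤ s ℚ.* (q ℚ.* q)) → IsInt q
squareFree-multiplier s q sf (z , eq) = ∣↧∣≡1⇒IsInt q (sf d d²∣s)
  where
  d n : ℤ
  d = ↧ q
  n = ↥ q

  rearrange : ∀ S D q → S ℚ.* (D ℚ.* q) ℚ.* q ≡ S ℚ.* (q ℚ.* q) ℚ.* D
  rearrange = solve-∀ ℚ-ring

  multiply-by-D : ∀ {S N D Z SN ZD} → SN ≡ S ℚ.* N → ZD ≡ Z ℚ.* D →
    D ℚ.* q ≡ N → S ℚ.* (q ℚ.* q) ≡ Z → SN ℚ.* q ≡ ZD
  multiply-by-D {S} {D = D} refl refl refl refl = rearrange S D q

  e : (s * n) * n ≡ (z * d) * d
  e = sym (fromℤ*q≡fromℤ⇒ (s * n) q (z * d)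
    (multiply-by-D (fromℤ-* s n) (fromℤ-* z d) (↧*q≡↥ q) eq))

  d∣s : d ∣ s
  d∣s = ↧∣u*↥⇒↧∣u q s (↧∣u*↥⇒↧∣u q (s * n) (divides (z * d) e))

  s₁ : ℤ
  s₁ = _∣_.quotient d∣s

  comm : ∀ s d n → s * n * n * d ≡ s * d * n * n
  comm = ℤ-Solver.solve-∀

  d∣s₁ : d ∣ s₁
  d∣s₁ = ↧∣u*↥⇒↧∣u q s₁ (↧∣u*↥⇒↧∣u q (s₁ * n) (divides z
    (ℤₚ.*-cancelʳ-≡ (s₁ * n * n) (z * d) d
      (trans (comm s₁ d n) (trans (cong (λ a → a * n * n) (sym (_∣_.equality d∣s))) e)))))

  d²∣s : d * d ∣ s
  d²∣s = divides s₂ (trans (_∣_.equality d∣s)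
    (trans (cong (_* d) (_∣_.equality d∣s₁)) (ℤₚ.*-assoc s₂ d d)))
    where
    s₂ = _∣_.quotient d∣s₁

-- Dividing a common denominator D of all powers of q by the denominator of q
-- gives a smaller one.
geometric⇒IsInt : ∀ {q} (z : ℕ → ℤ) → z 0 ≢ 0ℤ →
  (∀ j → fromℤ (z j) ℚ.* q ≡ fromℤ (z (suc j))) → IsInt q
geometric⇒IsInt {q} z z₀≢0 step = go (suc ∣ z 0 ∣) z z₀≢0 step ℕₚ.≤-refl
  where
  go : ∀ fuel (z : ℕ → ℤ) → z 0 ≢ 0ℤ →
    (∀ j → fromℤ (z j) ℚ.* q ≡ fromℤ (z (suc j))) → ∣ z 0 ∣ ℕ.< fuel → IsInt q
  go (suc fuel) z z₀≢0 step (ℕ.s≤s ≤fuel) with ↧ₙ q ℕₚ.≟ 1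
  ... | yes ↧≡1 = ∣↧∣≡1⇒IsInt q ↧≡1
  ... | no  ↧≢1 = go fuel y y₀≢0 y-step (ℕₚ.<-≤-trans y₀<z₀ ≤fuel)
    where
    ↧∣z : ∀ j → ↧ q ∣ z j
    ↧∣z j = ↧∣multiplier (z j) q (z (suc j) , step j)

    y : ℕ → ℤ
    y j = _∣_.quotient (↧∣z j)

    z≡y*↧ : ∀ j → z j ≡ y j * ↧ q
    z≡y*↧ j = _∣_.equality (↧∣z j)

    y₀≢0 : y 0 ≢ 0ℤ
    y₀≢0 y₀≡0 = z₀≢0 (trans (z≡y*↧ 0) (cong (_* ↧ q) y₀≡0))

    comm : ∀ a b c → a * b * c ≡ a * c * b
    comm = ℤ-Solver.solve-∀

    y-step : ∀ j → fromℤ (y j) ℚ.* q ≡ fromℤ (y (suc j))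
    y-step j = fromℤ*q≡fromℤ⇐ (y j) q (y (suc j)) (ℤₚ.*-cancelʳ-≡ _ _ (↧ q) (begin
      y (suc j) * ↧ q * ↧ q  ≡⟨ cong (_* ↧ q) (z≡y*↧ (suc j)) ⟨
      z (suc j) * ↧ q          ≡⟨ fromℤ*q≡fromℤ⇒ (z j) q (z (suc j)) (step j) ⟩
      z j * ↥ q                ≡⟨ cong (_* ↥ q) (z≡y*↧ j) ⟩
      y j * ↧ q * ↥ q        ≡⟨ comm (y j) (↧ q) (↥ q) ⟩
      y j * ↥ q * ↧ q        ∎))
      where open ≡-Reasoning

    y₀<z₀ : ∣ y 0 ∣ ℕ.< ∣ z 0 ∣
    y₀<z₀ = subst (∣ y 0 ∣ ℕ.<_)
      (trans (sym (ℤₚ.abs-* (y 0) (↧ q))) (cong ∣_∣ (sym (z≡y*↧ 0))))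
      (ℕₚ.m<m*n ∣ y 0 ∣ (↧ₙ q) {{ℕ.≢-nonZero λ ∣y₀∣≡0 → y₀≢0 (ℤₚ.∣i∣≡0⇒i≡0 ∣y₀∣≡0)}}
        (ℕₚ.≤∧≢⇒< (ℕ.s≤s ℕ.z≤n) (λ 1≡↧ → ↧≢1 (sym 1≡↧))))

-- The commutative ring L.

module Arithmetic (m n : ℤ) (m-sf : SquareFree m) (n-sf : SquareFree n) where
  open Biquadratic m n m-sf n-sf public

  private
    M N : ℚ
    M = fromℤ m
    N = fromℤ n

  ⟨⟩-cong : ∀ {a b c e a′ b′ c′ e′} → a ≡ a′ → b ≡ b′ → c ≡ c′ → e ≡ e′ →
    ⟨ a , b , c , e ⟩ ≡ ⟨ a′ , b′ , c′ , e′ ⟩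
  ⟨⟩-cong refl refl refl refl = refl

  ⊕-⊗-isCommutativeRing : IsCommutativeRing _≡_ _⊕_ _⊗_ ⊝_ 0L 1L
  ⊕-⊗-isCommutativeRing = record
    { isRing = record
      { +-isAbelianGroup = record
        { isGroup = record
          { isMonoid = record
            { isSemigroup = record
              { isMagma = record { isEquivalence = isEquivalence ; ∙-cong = cong₂ _⊕_ }
              ; assoc   = λ u v w → ⟨⟩-cong (ℚₚ.+-assoc (c₁ u) (c₁ v) (c₁ w)) (ℚₚ.+-assoc (c√m u) (c√m v) (c√m w)) (ℚₚ.+-assoc (c√n u) (c√n v) (c√n w)) (ℚₚ.+-assoc (c√m√n u) (c√m√n v) (c√m√n w))
              }
            ; identity = (λ v → ⟨⟩-cong (ℚₚ.+-identityˡ (c₁ v)) (ℚₚ.+-identityˡ (c√m v)) (ℚₚ.+-identityˡ (c√n v)) (ℚₚ.+-identityˡ (c√m√n v)))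
                       , (λ v → ⟨⟩-cong (ℚₚ.+-identityʳ (c₁ v)) (ℚₚ.+-identityʳ (c√m v)) (ℚₚ.+-identityʳ (c√n v)) (ℚₚ.+-identityʳ (c√m√n v)))
            }
          ; inverse = (λ v → ⟨⟩-cong (ℚₚ.+-inverseˡ (c₁ v)) (ℚₚ.+-inverseˡ (c√m v)) (ℚₚ.+-inverseˡ (c√n v)) (ℚₚ.+-inverseˡ (c√m√n v)))
                    , (λ v → ⟨⟩-cong (ℚₚ.+-inverseʳ (c₁ v)) (ℚₚ.+-inverseʳ (c√m v)) (ℚₚ.+-inverseʳ (c√n v)) (ℚₚ.+-inverseʳ (c√m√n v)))
          ; ⁻¹-cong = cong ⊝_
          }
        ; comm = λ v w → ⟨⟩-cong (ℚₚ.+-comm (c₁ v) (c₁ w)) (ℚₚ.+-comm (c√m v) (c√m w)) (ℚₚ.+-comm (c√n v) (c√n w)) (ℚₚ.+-comm (c√m√n v) (c√m√n w))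
        }
      ; *-cong = cong₂ _⊗_
      ; *-assoc = ⊗-assoc
      ; *-identity = ⊗-identityˡ , λ v → trans (⊗-comm v 1L) (⊗-identityˡ v)
      ; distrib = ⊗-distribˡ , λ u v w → trans (⊗-comm (v ⊕ w) u)
          (trans (⊗-distribˡ u v w) (cong₂ _⊕_ (⊗-comm u v) (⊗-comm u w)))
      }
    ; *-comm = ⊗-comm
    }
    where
    open Coordinatewise
    open L

    ⊗-assoc : ∀ u v w → (u ⊗ v) ⊗ w ≡ u ⊗ (v ⊗ w)
    ⊗-assoc ⟨ a , b , c , e ⟩ ⟨ a′ , b′ , c′ , e′ ⟩ ⟨ a″ , b″ , c″ , e″ ⟩ = ⟨⟩-cong
      (assoc₁ M N a b c e a′ b′ c′ e′ a″ b″ c″ e″) (assoc₂ M N a b c e a′ b′ c′ e′ a″ b″ c″ e″)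
      (assoc₃ M N a b c e a′ b′ c′ e′ a″ b″ c″ e″) (assoc₄ M N a b c e a′ b′ c′ e′ a″ b″ c″ e″)

    ⊗-comm : ∀ v w → v ⊗ w ≡ w ⊗ v
    ⊗-comm ⟨ a , b , c , e ⟩ ⟨ a′ , b′ , c′ , e′ ⟩ = ⟨⟩-cong
      (comm₁ M N a b c e a′ b′ c′ e′) (comm₂ M N a b c e a′ b′ c′ e′)
      (comm₃ M N a b c e a′ b′ c′ e′) (comm₄ M N a b c e a′ b′ c′ e′)

    ⊗-distribˡ : ∀ u v w → u ⊗ (v ⊕ w) ≡ u ⊗ v ⊕ u ⊗ w
    ⊗-distribˡ ⟨ a , b , c , e ⟩ ⟨ a′ , b′ , c′ , e′ ⟩ ⟨ a″ , b″ , c″ , e″ ⟩ = ⟨⟩-cong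
      (distrib₁ M N a b c e a′ b′ c′ e′ a″ b″ c″ e″) (distrib₂ M N a b c e a′ b′ c′ e′ a″ b″ c″ e″)
      (distrib₃ M N a b c e a′ b′ c′ e′ a″ b″ c″ e″) (distrib₄ M N a b c e a′ b′ c′ e′ a″ b″ c″ e″)

    ⊗-identityˡ : ∀ v → 1L ⊗ v ≡ v
    ⊗-identityˡ ⟨ a , b , c , e ⟩ = ⟨⟩-cong
      (identity₁ M N a b c e) (identity₂ M N a b c e) (identity₃ M N a b c e) (identity₄ M N a b c e)

  L-commutativeRing : CommutativeRing 0ℓ 0ℓ
  L-commutativeRing = record { isCommutativeRing = ⊕-⊗-isCommutativeRing }

-- Integral and almost integral elements of L.

module Integrality (m n : ℤ) (m-sf : SquareFree m) (n-sf : SquareFree n) where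
  open Arithmetic m n m-sf n-sf public
  open Scaling

  private
    M N : ℚ
    M = fromℤ m
    N = fromℤ n

  open CommutativeRing L-commutativeRing public
    using ()
    renaming (commutativeSemiring to L-commutativeSemiring; semiring to L-semiring
             ; *-assoc to ⊗-assoc; *-comm to ⊗-comm; *-identityʳ to ⊗-identityʳ
             ; *-identityˡ to ⊗-identityˡ; distribˡ to ⊗-distribˡ
             ; zeroˡ to ⊗-zeroˡ; +-identityʳ to ⊕-identityʳ; zeroʳ to ⊗-zeroʳ; -‿inverseʳ to ⊖-inverseʳ)
  open Exp L-semiring public using () renaming (_^_ to _^L_)

  ι-⊗ : ∀ q v → ι q ⊗ v ≡ q · v
  ι-⊗ q ⟨ a , b , c , e ⟩ = ⟨⟩-cong
    (ι₁ M N q a b c e) (ι₂ M N q a b c e) (ι₃ M N q a b c e) (ι₄ M N q a b c e)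

  IntegerCoordinates : L → Set
  IntegerCoordinates ⟨ a , b , c , e ⟩ = IsInt a × IsInt b × IsInt c × IsInt e

  Denominator : L → Set
  Denominator v = ∃ λ D → D ≢ 0ℤ × v ≡ ι (fromℤ D)

  ic-ι : ∀ z → IntegerCoordinates (ι (fromℤ z))
  ic-ι z = isInt z , isInt 0ℤ , isInt 0ℤ , isInt 0ℤ

  ic-⊕ : ∀ {v w} → IntegerCoordinates v → IntegerCoordinates w → IntegerCoordinates (v ⊕ w)
  ic-⊕ (a , b , c , e) (a′ , b′ , c′ , e′) =
    IsInt-+ a a′ , IsInt-+ b b′ , IsInt-+ c c′ , IsInt-+ e e′

  ic-⊗ : ∀ {v w} → IntegerCoordinates v → IntegerCoordinates w → IntegerCoordinates (v ⊗ w)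
  ic-⊗ (a , b , c , e) (a′ , b′ , c′ , e′) =
      IsInt-+ (IsInt-+ (IsInt-+ (IsInt-* a a′) (IsInt-* (isInt m) (IsInt-* b b′)))
                       (IsInt-* (isInt n) (IsInt-* c c′)))
              (IsInt-* (IsInt-* (isInt m) (isInt n)) (IsInt-* e e′))
    , IsInt-+ (IsInt-+ (IsInt-* a b′) (IsInt-* b a′))
              (IsInt-* (isInt n) (IsInt-+ (IsInt-* c e′) (IsInt-* e c′)))
    , IsInt-+ (IsInt-+ (IsInt-* a c′) (IsInt-* c a′))
              (IsInt-* (isInt m) (IsInt-+ (IsInt-* b e′) (IsInt-* e b′)))
    , IsInt-+ (IsInt-+ (IsInt-+ (IsInt-* a e′) (IsInt-* e a′)) (IsInt-* b c′)) (IsInt-* c b′)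

  ic-cancel : ∀ {v w} → IntegerCoordinates (v ⊕ w) → IntegerCoordinates v → IntegerCoordinates w
  ic-cancel (a , b , c , e) (a′ , b′ , c′ , e′) =
    IsInt-cancelʳ a a′ , IsInt-cancelʳ b b′ , IsInt-cancelʳ c c′ , IsInt-cancelʳ e e′

  ι-* : ∀ a b → ι a ⊗ ι b ≡ ι (a ℚ.* b)
  ι-* a b = trans (ι-⊗ a (ι b)) (⟨⟩-cong refl (ℚₚ.*-zeroʳ a) (ℚₚ.*-zeroʳ a) (ℚₚ.*-zeroʳ a))

  denominator-* : ∀ {v w} → Denominator v → Denominator w → Denominator (v ⊗ w)
  denominator-* (D , D≢0 , refl) (E , E≢0 , refl) =
      D * E
    , (λ DE≡0 → [ D≢0 , E≢0 ]′ (ℤₚ.i*j≡0⇒i≡0∨j≡0 D DE≡0))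
    , trans (ι-* (fromℤ D) (fromℤ E)) (cong ι (sym (fromℤ-* D E)))

  clear-denominators : ∀ v → ∃ λ δ → Denominator δ × IntegerCoordinates (δ ⊗ v)
  clear-denominators v@(⟨ a , b , c , e ⟩) =
      ι (fromℤ D) , (D , D≢0 , refl)
    , subst IntegerCoordinates (sym (ι-⊗ (fromℤ D) v))
        ( scaleʳ a (↧ a * ↧ b) (↧ c * ↧ e) (scaleʳ a (↧ a) (↧ b) (↥ a , ↧*q≡↥ a))
        , scaleʳ b (↧ a * ↧ b) (↧ c * ↧ e) (scaleˡ b (↧ a) (↧ b) (↥ b , ↧*q≡↥ b))
        , scaleˡ c (↧ a * ↧ b) (↧ c * ↧ e) (scaleʳ c (↧ c) (↧ e) (↥ c , ↧*q≡↥ c))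
        , scaleˡ e (↧ a * ↧ b) (↧ c * ↧ e) (scaleˡ e (↧ c) (↧ e) (↥ e , ↧*q≡↥ e)))
    where
    D : ℤ
    D = (↧ a * ↧ b) * (↧ c * ↧ e)

    D≢0 : D ≢ 0ℤ
    -- Every `↧` has the form `+ suc _`, so D computes to a positive integer.
    D≢0 ()

    swap : ∀ x y q → x ℚ.* y ℚ.* q ≡ x ℚ.* q ℚ.* y
    swap = solve-∀ ℚ-ring

    scaleʳ : ∀ q x y → IsInt (fromℤ x ℚ.* q) → IsInt (fromℤ (x * y) ℚ.* q)
    scaleʳ q x y i = subst IsInt
      (sym (trans (cong (ℚ._* q) (fromℤ-* x y)) (swap (fromℤ x) (fromℤ y) q)))
      (IsInt-* i (isInt y))

    scaleˡ : ∀ q x y → IsInt (fromℤ y ℚ.* q) → IsInt (fromℤ (x * y) ℚ.* q)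
    scaleˡ q x y i = subst (λ z → IsInt (fromℤ z ℚ.* q)) (ℤₚ.*-comm y x) (scaleʳ q y x i)

  denominator-1 : Denominator 1L
  denominator-1 = 1ℤ , (λ ()) , refl

  denominator⇒ic : ∀ {v} → Denominator v → IntegerCoordinates v
  denominator⇒ic (D , _ , refl) = ic-ι D

  open CompleteIntegralClosure L-commutativeSemiring using (monic; module Closure) public
  open Closure IntegerCoordinates Denominator
    (subst IntegerCoordinates) (ic-ι 0ℤ) (ic-ι 1ℤ) ic-⊕ ic-⊗ ic-cancel
    denominator-1 denominator-* denominator⇒ic clear-denominators public

  isIntegral⇒ai : ∀ {v} → IsIntegral v → AlmostIntegral v
  isIntegral⇒ai {v} (cs , eq) = integral⇒ai v (integers cs) (trans (monic≡evalMonic cs) eq)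
    where
    integers : ∀ cs → All IntegerCoordinates (map (λ c → ι (fromℤ c)) cs)
    integers []       = []
    integers (c ∷ cs) = ic-ι c ∷ integers cs

    monic≡evalMonic : ∀ cs → monic (map (λ c → ι (fromℤ c)) cs) v ≡ evalMonic cs v
    monic≡evalMonic []       = refl
    monic≡evalMonic (c ∷ cs) = cong (λ w → ι (fromℤ c) ⊕ v ⊗ w) (monic≡evalMonic cs)

  -- The rational coordinates of D q^j form a geometric progression of integers with ratio q and
  -- nonzero first term D.
  ai-ι⇒IsInt : ∀ q → AlmostIntegral (ι q) → IsInt q
  ai-ι⇒IsInt q (ai (D , D≢0 , refl) P) = geometric⇒IsInt {q} z z₀≢0 step
    where
    first : ∀ {v} → IntegerCoordinates v → IsInt (L.c₁ v)
    first (a , _) = a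

    z : ℕ → ℤ
    z j = proj₁ (first (P j))

    z≡ : ∀ j → L.c₁ (ι (fromℤ D) ⊗ ι q ^L j) ≡ fromℤ (z j)
    z≡ j = proj₂ (first (P j))

    z₀≢0 : z 0 ≢ 0ℤ
    z₀≢0 z₀≡0 = D≢0 (fromℤ-injective (trans
      (sym (cong L.c₁ (⊗-identityʳ (ι (fromℤ D))))) (trans (z≡ 0) (cong fromℤ z₀≡0))))

    pull : ∀ v w → v ⊗ (ι q ⊗ w) ≡ q · (v ⊗ w)
    pull v w = trans (sym (⊗-assoc v (ι q) w)) (trans (cong (_⊗ w) (⊗-comm v (ι q)))
      (trans (⊗-assoc (ι q) v w) (ι-⊗ q (v ⊗ w))))

    step : ∀ j → fromℤ (z j) ℚ.* q ≡ fromℤ (z (suc j))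
    step j = trans (ℚₚ.*-comm (fromℤ (z j)) q) (trans (cong (q ℚ.*_) (sym (z≡ j)))
      (trans (sym (cong L.c₁ (pull (ι (fromℤ D)) (ι q ^L j)))) (z≡ (suc j))))

  φ ψ : L → L
  φ ⟨ a , b , c , e ⟩ = ⟨ a , ℚ.- b , c , ℚ.- e ⟩
  ψ ⟨ a , b , c , e ⟩ = ⟨ a , b , ℚ.- c , ℚ.- e ⟩

  φ-⊗ : ∀ v w → φ (v ⊗ w) ≡ φ v ⊗ φ w
  φ-⊗ ⟨ a , b , c , e ⟩ ⟨ a′ , b′ , c′ , e′ ⟩ = ⟨⟩-cong
    (φ₁ M N a b c e a′ b′ c′ e′) (φ₂ M N a b c e a′ b′ c′ e′)
    (φ₃ M N a b c e a′ b′ c′ e′) (φ₄ M N a b c e a′ b′ c′ e′)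

  ψ-⊗ : ∀ v w → ψ (v ⊗ w) ≡ ψ v ⊗ ψ w
  ψ-⊗ ⟨ a , b , c , e ⟩ ⟨ a′ , b′ , c′ , e′ ⟩ = ⟨⟩-cong
    (ψ₁ M N a b c e a′ b′ c′ e′) (ψ₂ M N a b c e a′ b′ c′ e′)
    (ψ₃ M N a b c e a′ b′ c′ e′) (ψ₄ M N a b c e a′ b′ c′ e′)

  φ-⊕ : ∀ v w → φ (v ⊕ w) ≡ φ v ⊕ φ w
  φ-⊕ ⟨ _ , b , _ , e ⟩ ⟨ _ , b′ , _ , e′ ⟩ =
    ⟨⟩-cong refl (ℚₚ.neg-distrib-+ b b′) refl (ℚₚ.neg-distrib-+ e e′)

  ψ-⊕ : ∀ v w → ψ (v ⊕ w) ≡ ψ v ⊕ ψ w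
  ψ-⊕ ⟨ _ , _ , c , e ⟩ ⟨ _ , _ , c′ , e′ ⟩ =
    ⟨⟩-cong refl refl (ℚₚ.neg-distrib-+ c c′) (ℚₚ.neg-distrib-+ e e′)

  φ-involutive : ∀ v → φ (φ v) ≡ v
  φ-involutive ⟨ _ , b , _ , e ⟩ = ⟨⟩-cong refl (neg-involutive b) refl (neg-involutive e)

  ψ-involutive : ∀ v → ψ (ψ v) ≡ v
  ψ-involutive ⟨ _ , _ , c , e ⟩ = ⟨⟩-cong refl refl (neg-involutive c) (neg-involutive e)

  ⊝-involutive : ∀ v → ⊝ (⊝ v) ≡ v
  ⊝-involutive ⟨ a , b , c , e ⟩ =
    ⟨⟩-cong (neg-involutive a) (neg-involutive b) (neg-involutive c) (neg-involutive e)

  ai-hom : (g : L → L) → (∀ v w → g (v ⊗ w) ≡ g v ⊗ g w) → (∀ q → g (ι q) ≡ ι q) →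
    (∀ {v} → IntegerCoordinates v → IntegerCoordinates (g v)) →
    ∀ {v} → AlmostIntegral v → AlmostIntegral (g v)
  ai-hom g g-⊗ g-ι g-ic {v} (ai (D , D≢0 , refl) P) =
    ai (D , D≢0 , refl) λ j →
      subst IntegerCoordinates (trans (g-⊗ _ _) (cong₂ _⊗_ (g-ι (fromℤ D)) (g-^ j))) (g-ic (P j))
    where
    g-^ : ∀ j → g (v ^L j) ≡ g v ^L j
    g-^ zero    = g-ι 1ℚ
    g-^ (suc j) = trans (g-⊗ v (v ^L j)) (cong (g v ⊗_) (g-^ j))

  ai-φ : ∀ {v} → AlmostIntegral v → AlmostIntegral (φ v)
  ai-φ = ai-hom φ φ-⊗ (λ _ → refl) λ (a , b , c , e) → a , IsInt-neg b , c , IsInt-neg e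

  ai-ψ : ∀ {v} → AlmostIntegral v → AlmostIntegral (ψ v)
  ai-ψ = ai-hom ψ ψ-⊗ (λ _ → refl) λ (a , b , c , e) → a , b , IsInt-neg c , IsInt-neg e

  ai-ℤ : ∀ z → AlmostIntegral (ι (fromℤ z))
  ai-ℤ z = ai-P (ic-ι z)

  ai-⊝ : ∀ {v} → AlmostIntegral v → AlmostIntegral (⊝ v)
  ai-⊝ {v} i = subst AlmostIntegral (trans (ι-⊗ (fromℤ -1ℤ) v) (-1· v)) (ai-* (ai-ℤ -1ℤ) i)
    where
    -1* : ∀ q → fromℤ -1ℤ ℚ.* q ≡ ℚ.- q
    -1* = solve-∀ ℚ-ring
    -1· : ∀ v → fromℤ -1ℤ · v ≡ ⊝ v
    -1· ⟨ a , b , c , e ⟩ = ⟨⟩-cong (-1* a) (-1* b) (-1* c) (-1* e)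

  ai-fixed⇒ℤ : ∀ {v} → AlmostIntegral v → φ v ≡ v → ψ v ≡ v → ∃ λ z → ι (fromℤ z) ≡ v
  ai-fixed⇒ℤ {v} i φv≡v ψv≡v = proj₁ int , trans (cong ι (sym (proj₂ int))) (sym rational)
    where
    rational : v ≡ ι (L.c₁ v)
    rational = ⟨⟩-cong refl (-b≡b⇒b≡0 (cong L.c√m φv≡v)) (-b≡b⇒b≡0 (cong L.c√n ψv≡v))
                            (-b≡b⇒b≡0 (cong L.c√m√n φv≡v))
    int : IsInt (L.c₁ v)
    int = ai-ι⇒IsInt (L.c₁ v) (subst AlmostIntegral rational i)

  -- The coefficients of ∏ (X - g v), g running over the four sign changes, are
  -- almost integral and fixed by φ and ψ.
  ai⇒isIntegral : ∀ {v} → AlmostIntegral v → IsIntegral v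
  ai⇒isIntegral {v} i =
      proj₁ z₄ ∷ proj₁ z₃ ∷ proj₁ z₂ ∷ proj₁ z₁ ∷ []
    , trans (substitute (proj₂ z₄) (proj₂ z₃) (proj₂ z₂) (proj₂ z₁))
        (trans (factorise v w x y z)
          (trans (cong (_⊗ ((v ⊕ x) ⊗ ((v ⊕ y) ⊗ (v ⊕ z)))) (⊖-inverseʳ v)) (⊗-zeroˡ ((v ⊕ x) ⊗ ((v ⊕ y) ⊗ (v ⊕ z))))))
    where
    open MonicQuartic L-commutativeSemiring

    w x y z : L
    -- With the conjugates of -v in place of those of v, the coefficients are the symmetric
    -- functions without alternating signs.
    w = ⊝ v
    x = φ w
    y = ψ w
    z = φ y

    w-ai : AlmostIntegral w
    w-ai = ai-⊝ i
    x-ai : AlmostIntegral x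
    x-ai = ai-φ w-ai
    y-ai : AlmostIntegral y
    y-ai = ai-ψ w-ai
    z-ai : AlmostIntegral z
    z-ai = ai-φ y-ai

    φx : φ x ≡ w
    φx = φ-involutive w
    φz : φ z ≡ y
    φz = φ-involutive y
    ψy : ψ y ≡ w
    ψy = ψ-involutive w
    ψz : ψ z ≡ x
    ψz = cong φ (ψ-involutive w)

    φ-e : (f : L → L → L → L → L) →
      (∀ a b c e → φ (f a b c e) ≡ f (φ a) (φ b) (φ c) (φ e)) →
      (∀ a b c e → f a b c e ≡ f b a e c) → φ (f w x y z) ≡ f w x y z
    φ-e f hom swap = trans (hom w x y z) (trans (cong₂ (λ p q → f x p z q) φx φz) (swap x w z y))

    ψ-e : (f : L → L → L → L → L) →
      (∀ a b c e → ψ (f a b c e) ≡ f (ψ a) (ψ b) (ψ c) (ψ e)) →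
      (∀ a b c e → f a b c e ≡ f c e a b) → ψ (f w x y z) ≡ f w x y z
    ψ-e f hom swap = trans (hom w x y z) (trans (cong₂ (λ p q → f y z p q) ψy ψz) (swap y z w x))

    module Hom (g : L → L) (g-⊕ : ∀ v w → g (v ⊕ w) ≡ g v ⊕ g w)
                           (g-⊗ : ∀ v w → g (v ⊗ w) ≡ g v ⊗ g w) where
      hom₁ : ∀ a b c e → g (e₁ a b c e) ≡ e₁ (g a) (g b) (g c) (g e)
      hom₁ a b c e = trans (g-⊕ (a ⊕ b) (c ⊕ e)) (cong₂ _⊕_ (g-⊕ a b) (g-⊕ c e))
      hom₂ : ∀ a b c e → g (e₂ a b c e) ≡ e₂ (g a) (g b) (g c) (g e)
      hom₂ a b c e = trans (g-⊕ (a ⊗ b ⊕ (a ⊕ b) ⊗ (c ⊕ e)) (c ⊗ e)) (cong₂ _⊕_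
        (trans (g-⊕ (a ⊗ b) ((a ⊕ b) ⊗ (c ⊕ e))) (cong₂ _⊕_ (g-⊗ a b)
          (trans (g-⊗ (a ⊕ b) (c ⊕ e)) (cong₂ _⊗_ (g-⊕ a b) (g-⊕ c e)))))
        (g-⊗ c e))
      hom₃ : ∀ a b c e → g (e₃ a b c e) ≡ e₃ (g a) (g b) (g c) (g e)
      hom₃ a b c e = trans (g-⊕ ((a ⊗ b) ⊗ (c ⊕ e)) ((a ⊕ b) ⊗ (c ⊗ e))) (cong₂ _⊕_
        (trans (g-⊗ (a ⊗ b) (c ⊕ e)) (cong₂ _⊗_ (g-⊗ a b) (g-⊕ c e)))
        (trans (g-⊗ (a ⊕ b) (c ⊗ e)) (cong₂ _⊗_ (g-⊕ a b) (g-⊗ c e))))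
      hom₄ : ∀ a b c e → g (e₄ a b c e) ≡ e₄ (g a) (g b) (g c) (g e)
      hom₄ a b c e = trans (g-⊗ (a ⊗ b) (c ⊗ e)) (cong₂ _⊗_ (g-⊗ a b) (g-⊗ c e))

    module Φ = Hom φ φ-⊕ φ-⊗
    module Ψ = Hom ψ ψ-⊕ ψ-⊗

    z₁ : ∃ λ c → ι (fromℤ c) ≡ e₁ w x y z
    z₁ = ai-fixed⇒ℤ (ai-+ (ai-+ w-ai x-ai) (ai-+ y-ai z-ai))
           (φ-e e₁ Φ.hom₁ e₁-swap₁) (ψ-e e₁ Ψ.hom₁ e₁-swap₂)
    z₂ : ∃ λ c → ι (fromℤ c) ≡ e₂ w x y z
    z₂ = ai-fixed⇒ℤ (ai-+ (ai-+ (ai-* w-ai x-ai) (ai-* (ai-+ w-ai x-ai) (ai-+ y-ai z-ai))) (ai-* y-ai z-ai))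
           (φ-e e₂ Φ.hom₂ e₂-swap₁) (ψ-e e₂ Ψ.hom₂ e₂-swap₂)
    z₃ : ∃ λ c → ι (fromℤ c) ≡ e₃ w x y z
    z₃ = ai-fixed⇒ℤ (ai-+ (ai-* (ai-* w-ai x-ai) (ai-+ y-ai z-ai)) (ai-* (ai-+ w-ai x-ai) (ai-* y-ai z-ai)))
           (φ-e e₃ Φ.hom₃ e₃-swap₁) (ψ-e e₃ Ψ.hom₃ e₃-swap₂)
    z₄ : ∃ λ c → ι (fromℤ c) ≡ e₄ w x y z
    z₄ = ai-fixed⇒ℤ (ai-* (ai-* w-ai x-ai) (ai-* y-ai z-ai))
           (φ-e e₄ Φ.hom₄ e₄-swap₁) (ψ-e e₄ Ψ.hom₄ e₄-swap₂)

    substitute : ∀ {c₄ c₃ c₂ c₁ d₄ d₃ d₂ d₁} → c₄ ≡ d₄ → c₃ ≡ d₃ → c₂ ≡ d₂ → c₁ ≡ d₁ →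
      c₄ ⊕ v ⊗ (c₃ ⊕ v ⊗ (c₂ ⊕ v ⊗ (c₁ ⊕ v ⊗ 1L)))
      ≡ d₄ ⊕ v ⊗ (d₃ ⊕ v ⊗ (d₂ ⊕ v ⊗ (d₁ ⊕ v ⊗ 1L)))
    substitute refl refl refl refl = refl

-- Parity, congruences mod 4 and square-free integers.

Even Odd : ℤ → Set
Even z = ∃ λ h → z ≡ + 2 * h
Odd  z = ∃ λ h → z ≡ 1ℤ + + 2 * h

even⊎odd : ∀ z → Even z ⊎ Odd z
even⊎odd z = go (z DivMod.%ℕ 2) (DivMod.n%ℕd<d z 2) (DivMod.a≡a%ℕn+[a/ℕn]*n z 2)
  where
  h = z DivMod./ℕ 2
  go : ∀ r → r ℕ.< 2 → z ≡ + r + h * + 2 → Even z ⊎ Odd z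
  go 0 _ eq = inj₁ (h , trans eq (trans (ℤₚ.+-identityˡ (h * + 2)) (ℤₚ.*-comm h (+ 2))))
  go 1 _ eq = inj₂ (h , trans eq (cong (λ x → 1ℤ + x) (ℤₚ.*-comm h (+ 2))))
  go (suc (suc _)) (ℕ.s≤s (ℕ.s≤s ())) _

even≢odd : ∀ {z} → Even z → ¬ Odd z
even≢odd (a , refl) (b , 2a≡1+2b) = 2≢±1 (∣unit∣ {+ 2} {a - b}
  (trans (expand a b) (trans (cong (_- + 2 * b) 2a≡1+2b) (collapse b))))
  where
  expand : ∀ a b → + 2 * (a - b) ≡ + 2 * a - + 2 * b
  expand = ℤ-Solver.solve-∀
  collapse : ∀ b → 1ℤ + + 2 * b - + 2 * b ≡ 1ℤ
  collapse = ℤ-Solver.solve-∀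
  2≢±1 : ¬ (+ 2 ≡ 1ℤ ⊎ + 2 ≡ -1ℤ)
  2≢±1 (inj₁ ())
  2≢±1 (inj₂ ())

*-odd⁻ˡ : ∀ a b → Odd (a * b) → Odd a
*-odd⁻ˡ a b odd = [ (λ (h , a≡2h) → contradiction odd (even≢odd (h * b , trans (cong (_* b) a≡2h) (ℤₚ.*-assoc (+ 2) h b)))) , (λ o → o) ]′ (even⊎odd a)

mod4⇒ : ∀ s → s ≡ 1ℤ [mod + 4 ] → ∃ λ j → s ≡ 1ℤ + + 4 * j
mod4⇒ s (divides j eq) = j , trans (add s) (cong (λ x → 1ℤ + x) (trans eq (ℤₚ.*-comm j (+ 4))))
  where
  add : ∀ s → s ≡ 1ℤ + (s - 1ℤ)
  add = ℤ-Solver.solve-∀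

module Quotients where
  open ℚₚ using (*-assoc; *-inverseˡ; *-identityʳ)

  ∕-* : ∀ a b .{{_ : ℤ.NonZero b}} → (a ∕ b) ℚ.* fromℤ b ≡ fromℤ a
  ∕-* a b = trans (*-assoc (fromℤ a) (ℚ.1/ fromℤ b) (fromℤ b))
    (trans (cong (fromℤ a ℚ.*_) (*-inverseˡ (fromℤ b))) (*-identityʳ (fromℤ a)))

  ∕-exact : ∀ a b z .{{_ : ℤ.NonZero b}} → a ≡ z * b → a ∕ b ≡ fromℤ z
  ∕-exact a b z refl = trans (cong (ℚ._* (ℚ.1/ fromℤ b)) (fromℤ-* z b))
    (trans (*-assoc (fromℤ z) (fromℤ b) (ℚ.1/ fromℤ b))
      (trans (cong (fromℤ z ℚ.*_) (ℚₚ.*-inverseʳ (fromℤ b))) (*-identityʳ (fromℤ z))))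

open Quotients

squareFree-∣ : ∀ {s t} → s ∣ t → SquareFree t → SquareFree s
squareFree-∣ s∣t sf a a²∣s = sf a (∣-trans a²∣s s∣t)

-- From st = za² follows s(t/a)² = zt, an integer, and a square-free multiplier s of a square forces
-- t/a to be an integer.
a²∣st⇒a∣t : ∀ {s t} a → a ≢ 0ℤ → SquareFree s → a * a ∣ s * t → a ∣ t
a²∣st⇒a∣t {s} {t} a a≢0 sf (divides z st≡zaa) =
  divides (proj₁ t/a-int) (fromℤ-injective (trans (sym (∕-* t a))
    (trans (cong (ℚ._* fromℤ a) (proj₂ t/a-int)) (sym (fromℤ-* (proj₁ t/a-int) a)))))
  where
  instance _ = ℤ.≢-nonZero a≢0

  collect : ∀ {s t a z i} → s ℚ.* t ≡ z ℚ.* (a ℚ.* a) → a ℚ.* i ≡ 1ℚ →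
    s ℚ.* ((t ℚ.* i) ℚ.* (t ℚ.* i)) ≡ z ℚ.* t
  collect {s} {t} {a} {z} {i} st≡zaa ai≡1 = trans (step₁ s t i)
    (trans (cong (λ x → x ℚ.* (t ℚ.* (i ℚ.* i))) st≡zaa)
      (trans (step₂ z a t i) (trans (cong (λ x → z ℚ.* t ℚ.* (x ℚ.* x)) ai≡1) (step₃ z t))))
    where
    step₁ : ∀ s t i → s ℚ.* ((t ℚ.* i) ℚ.* (t ℚ.* i)) ≡ s ℚ.* t ℚ.* (t ℚ.* (i ℚ.* i))
    step₁ = solve-∀ ℚ-ring
    step₂ : ∀ z a t i → z ℚ.* (a ℚ.* a) ℚ.* (t ℚ.* (i ℚ.* i)) ≡ z ℚ.* t ℚ.* ((a ℚ.* i) ℚ.* (a ℚ.* i))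
    step₂ = solve-∀ ℚ-ring
    step₃ : ∀ z t → z ℚ.* t ℚ.* (1ℚ ℚ.* 1ℚ) ≡ z ℚ.* t
    step₃ = solve-∀ ℚ-ring

  t/a-int : IsInt (t ∕ a)
  t/a-int = squareFree-multiplier s (t ∕ a) sf (z * t , trans
    (collect {fromℤ s} {fromℤ t} {fromℤ a} {fromℤ z} {ℚ.1/ fromℤ a} (trans (sym (fromℤ-* s t)) (trans (cong fromℤ st≡zaa)
               (trans (fromℤ-* z (a * a)) (cong (fromℤ z ℚ.*_) (fromℤ-* a a)))))
             (ℚₚ.*-inverseʳ (fromℤ a)))
    (sym (fromℤ-* z t)))

-- Applying the previous lemma from both sides makes a a common divisor of the two coprime factors.
squareFree-* : ∀ {s t} → SquareFree s → SquareFree t → IsCoprime s t → SquareFree (s * t)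
squareFree-* {s} {t} s-sf t-sf c a a²∣st = c a
  (a²∣st⇒a∣t {t} {s} a a≢0 t-sf (subst (a * a ∣_) (ℤₚ.*-comm s t) a²∣st))
  (a²∣st⇒a∣t {s} {t} a a≢0 s-sf a²∣st)
  where
  zero-product : ∀ {a} → a ≡ 0ℤ → a * a ∣ s * t → s * t ≡ 0ℤ
  zero-product refl (divides q eq) = trans eq (ℤₚ.*-zeroʳ q)

  a≢0 : a ≢ 0ℤ
  a≢0 a≡0 = [ squareFree⇒≢0 s-sf , squareFree⇒≢0 t-sf ]′
    (ℤₚ.i*j≡0⇒i≡0∨j≡0 s (zero-product a≡0 a²∣st))

-- This is about the element (A + V√s)/2 of norm ¼(A² - sV²).
half-integral : ∀ {s} A V → SquareFree s → s ≡ 1ℤ [mod + 4 ] →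
  IsInt (¼ ℚ.* (fromℤ A ℚ.* fromℤ A ℚ.- fromℤ s ℚ.* (V ℚ.* V))) →
  ∃ λ j → V ≡ fromℤ (A + + 2 * j)
half-integral {s} A V sf s≡1 (z , eq) =
  same-parity (proj₁ V-int) (even⊎odd (proj₁ V-int - A)) (proj₂ V-int)
  where
  clear : ∀ A² sV² z → ¼ ℚ.* (A² ℚ.- sV²) ≡ z → sV² ≡ A² ℚ.- fromℤ (+ 4) ℚ.* z
  clear A² sV² .(¼ ℚ.* (A² ℚ.- sV²)) refl = ring A² sV²
    where
    ring : ∀ A² sV² → sV² ≡ A² ℚ.- fromℤ (+ 4) ℚ.* (¼ ℚ.* (A² ℚ.- sV²))
    ring = solve-∀ ℚ-ring

  sV² : fromℤ s ℚ.* (V ℚ.* V) ≡ fromℤ (A * A - + 4 * z)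
  sV² = trans (clear (fromℤ A ℚ.* fromℤ A) (fromℤ s ℚ.* (V ℚ.* V)) (fromℤ z) eq)
    (trans (cong₂ ℚ._-_ (sym (fromℤ-* A A)) (sym (fromℤ-* (+ 4) z)))
      (sym (fromℤ-- (A * A) (+ 4 * z))))

  V-int : IsInt V
  V-int = squareFree-multiplier s V sf (A * A - + 4 * z , sV²)

  integer-equation : ∀ B → V ≡ fromℤ B → s * (B * B) ≡ A * A - + 4 * z
  integer-equation B refl = fromℤ-injective (trans (fromℤ-* s (B * B))
    (trans (cong (fromℤ s ℚ.*_) (fromℤ-* B B)) sV²))

  -- Were B - A = 1 + 2h odd, then sB² and A² would have opposite parities because s is odd,
  -- although they differ by 4z.
  parity : ∀ A h j z → (1ℤ + + 4 * j) * ((A + (1ℤ + + 2 * h)) * (A + (1ℤ + + 2 * h)))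
      ≡ A * A - + 4 * z →
    Even 1ℤ
  parity A h j z eq = k , trans (ring₁ A h j) (trans (cong (λ x → x - rest) eq) (ring₂ A h j z))
    where
    rest = A * A + + 2 * A + + 4 * (A * h + h + h * h)
      + + 4 * j * ((A + (1ℤ + + 2 * h)) * (A + (1ℤ + + 2 * h)))
    k = - (A + + 2 * (A * h + h + h * h)
      + + 2 * j * ((A + (1ℤ + + 2 * h)) * (A + (1ℤ + + 2 * h))) + + 2 * z)
    ring₁ : ∀ A h j → 1ℤ ≡ (1ℤ + + 4 * j) * ((A + (1ℤ + + 2 * h)) * (A + (1ℤ + + 2 * h)))
      - (A * A + + 2 * A + + 4 * (A * h + h + h * h)
      + + 4 * j * ((A + (1ℤ + + 2 * h)) * (A + (1ℤ + + 2 * h))))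
    ring₁ = ℤ-Solver.solve-∀
    ring₂ : ∀ A h j z → A * A - + 4 * z - (A * A + + 2 * A + + 4 * (A * h + h + h * h)
      + + 4 * j * ((A + (1ℤ + + 2 * h)) * (A + (1ℤ + + 2 * h))))
      ≡ + 2 * - (A + + 2 * (A * h + h + h * h)
      + + 2 * j * ((A + (1ℤ + + 2 * h)) * (A + (1ℤ + + 2 * h))) + + 2 * z)
    ring₂ = ℤ-Solver.solve-∀

  difference : ∀ A B → B ≡ A + (B - A)
  difference = ℤ-Solver.solve-∀

  same-parity : ∀ B → Even (B - A) ⊎ Odd (B - A) → V ≡ fromℤ B →
    ∃ λ j → V ≡ fromℤ (A + + 2 * j)
  same-parity B (inj₁ (j , B-A≡2j)) V≡B =
    j , trans V≡B (cong fromℤ (trans (difference A B) (cong (λ x → A + x) B-A≡2j)))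
  same-parity B (inj₂ (h , B-A≡1+2h)) V≡B = contradiction (0ℤ , refl) (even≢odd
    (parity A h (proj₁ (mod4⇒ s s≡1)) z (trans
      (cong₂ (λ s B → s * (B * B)) (sym (proj₂ (mod4⇒ s s≡1)))
        (sym (trans (difference A B) (cong (λ x → A + x) B-A≡1+2h))))
      (integer-equation B V≡B))))

squareFree⇒coprime : ∀ {a b} → SquareFree (a * b) → IsCoprime a b
squareFree⇒coprime sf g (divides p refl) (divides q refl) =
  sf g (divides (p * q) (regroup p q g))
  where
  regroup : ∀ p q g → p * g * (q * g) ≡ p * q * (g * g)
  regroup = ℤ-Solver.solve-∀

1[mod4]⇒odd : ∀ s → s ≡ 1ℤ [mod + 4 ] → Odd s
1[mod4]⇒odd s s≡1 = let j , s≡ = mod4⇒ s s≡1 in + 2 * j , trans s≡ (double j)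
  where
  double : ∀ j → 1ℤ + + 4 * j ≡ 1ℤ + + 2 * (+ 2 * j)
  double = ℤ-Solver.solve-∀

-- As d is odd, a ≡ a d² ≡ d mod 4.
cofactor-mod4 : ∀ a d → a * d ≡ 1ℤ [mod + 4 ] → ∃ λ μ → a ≡ d + + 4 * μ
-- With d = 1 + 2h and ad = 1 + 4j one has a = ad² - 4a(h² + h) = (1 + 4j)d - 4a(h² + h).
cofactor-mod4 a d ad≡1 = d * j - a * (h * h + h) ,
  trans (ring₁ a h) (trans (cong (λ x → x * (1ℤ + + 2 * h) - + 4 * (a * (h * h + h)))
    (trans (cong (a *_) (sym d≡)) ad≡))
    (trans (cong (λ x → (1ℤ + + 4 * j) * x - + 4 * (a * (h * h + h))) (sym d≡)) (ring₂ a d h j)))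
  where
  j = proj₁ (mod4⇒ (a * d) ad≡1)
  ad≡ = proj₂ (mod4⇒ (a * d) ad≡1)

  d-odd : Odd d
  d-odd = *-odd⁻ˡ d a (subst Odd (ℤₚ.*-comm a d) (1[mod4]⇒odd (a * d) ad≡1))
  h = proj₁ d-odd
  d≡ = proj₂ d-odd

  ring₁ : ∀ a h → a ≡ a * (1ℤ + + 2 * h) * (1ℤ + + 2 * h) - + 4 * (a * (h * h + h))
  ring₁ = ℤ-Solver.solve-∀
  ring₂ : ∀ a d h j → (1ℤ + + 4 * j) * d - + 4 * (a * (h * h + h))
    ≡ d + + 4 * (d * j - a * (h * h + h))
  ring₂ = ℤ-Solver.solve-∀

mod4-square : ∀ {a b} d → Odd d → (∃ λ μ → a ≡ d + + 4 * μ) → (∃ λ ν → b ≡ d + + 4 * ν) →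
  a * b ≡ 1ℤ [mod + 4 ]
mod4-square .(1ℤ + + 2 * h) (h , refl) (μ , refl) (ν , refl) = divides
  (h * h + h + (1ℤ + + 2 * h) * (μ + ν) + + 4 * (μ * ν)) (ring h μ ν)
  where
  ring : ∀ h μ ν → (1ℤ + + 2 * h + + 4 * μ) * (1ℤ + + 2 * h + + 4 * ν) - 1ℤ
    ≡ (h * h + h + (1ℤ + + 2 * h) * (μ + ν) + + 4 * (μ * ν)) * + 4
  ring = ℤ-Solver.solve-∀

-- The integers m/d, n/d, d and k.

module Arithmetic-mod4 (m n : ℤ) (m-sf : SquareFree m) (n-sf : SquareFree n)
  (m≡1 : m ≡ 1ℤ [mod + 4 ]) (n≡1 : n ≡ 1ℤ [mod + 4 ]) where
  open Biquadratic m n m-sf n-sf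

  m/d : ℤ
  m/d = quotient d∣m

  m≡ : m ≡ m/d * d
  m≡ = _∣_.equality d∣m

  n≡ : n ≡ n/d * d
  n≡ = _∣_.equality d∣n

  k≡ : k ≡ m/d * n/d
  k≡ = ℤₚ.*-cancelʳ-≡ k (m/d * n/d) (d * d) {{ℤₚ.i*j≢0 d d}}
    (trans (sym (_∣_.equality d²∣mn)) (trans (cong₂ _*_ m≡ n≡) (regroup m/d n/d d)))
    where
    regroup : ∀ a b d → a * d * (b * d) ≡ a * b * (d * d)
    regroup = ℤ-Solver.solve-∀

  m/d-coprime-d : IsCoprime m/d d
  m/d-coprime-d = squareFree⇒coprime {m/d} {d} (subst SquareFree m≡ m-sf)

  n/d-coprime-d : IsCoprime n/d d
  n/d-coprime-d = squareFree⇒coprime {n/d} {d} (subst SquareFree n≡ n-sf)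

  -- For a common divisor g the product gd divides m and n, hence their gcd d, so g is a unit.
  m/d-coprime-n/d : IsCoprime m/d n/d
  m/d-coprime-n/d g g∣m/d g∣n/d = unit gd∣d
    where
    gd∣_ : ∀ {a} → g ∣ a → g * d ∣ a * d
    gd∣ divides q refl = divides q (ℤₚ.*-assoc q g d)

    gd∣d : g * d ∣ d
    gd∣d = ∣ᵤ⇒∣ (GCD.gcd-greatest {m} {n} {g * d}
      (∣⇒∣ᵤ (subst (g * d ∣_) (sym m≡) (gd∣ g∣m/d)))
      (∣⇒∣ᵤ (subst (g * d ∣_) (sym n≡) (gd∣ g∣n/d))))

    unit : g * d ∣ d → ∣ g ∣ ≡ 1
    unit (divides q d≡) = [ cong ∣_∣ , cong ∣_∣ ]′ (∣unit∣ {g} {q}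
      (ℤₚ.*-cancelʳ-≡ (g * q) 1ℤ d (trans (regroup g q d)
        (trans (sym d≡) (sym (ℤₚ.*-identityˡ d))))))
      where
      regroup : ∀ g q d → g * q * d ≡ q * (g * d)
      regroup = ℤ-Solver.solve-∀

  m/d-squareFree : SquareFree m/d
  m/d-squareFree = squareFree-∣ (divides d (trans m≡ (ℤₚ.*-comm m/d d))) m-sf

  n/d-squareFree : SquareFree n/d
  n/d-squareFree = squareFree-∣ (divides d (trans n≡ (ℤₚ.*-comm n/d d))) n-sf

  d-squareFree : SquareFree d
  d-squareFree = squareFree-∣ d∣m m-sf

  k-squareFree : SquareFree k
  k-squareFree = subst SquareFree (sym k≡)
    (squareFree-* m/d-squareFree n/d-squareFree m/d-coprime-n/d)

  m/d-mod4 : ∃ λ μ → m/d ≡ d + + 4 * μ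
  m/d-mod4 = cofactor-mod4 m/d d (subst (_≡ 1ℤ [mod + 4 ]) m≡ m≡1)

  n/d-mod4 : ∃ λ μ → n/d ≡ d + + 4 * μ
  n/d-mod4 = cofactor-mod4 n/d d (subst (_≡ 1ℤ [mod + 4 ]) n≡ n≡1)

  m/d-odd : Odd m/d
  m/d-odd = *-odd⁻ˡ m/d d (subst Odd m≡ (1[mod4]⇒odd m m≡1))

  n/d-odd : Odd n/d
  n/d-odd = *-odd⁻ˡ n/d d (subst Odd n≡ (1[mod4]⇒odd n n≡1))

  d-odd : Odd d
  d-odd = *-odd⁻ˡ d m/d (subst Odd (trans m≡ (ℤₚ.*-comm m/d d)) (1[mod4]⇒odd m m≡1))

  k≡1 : k ≡ 1ℤ [mod + 4 ]
  k≡1 = subst (_≡ 1ℤ [mod + 4 ]) (sym k≡) (mod4-square d d-odd m/d-mod4 n/d-mod4)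

  -- With δ√k in place of √k the congruence describing 𝒪 becomes symmetric in the roots.
  sign-of-d : ∃ λ δ → (δ ≡ 1ℤ ⊎ δ ≡ -1ℤ) × ∃ λ ν → d + δ ≡ + 4 * ν
  sign-of-d = [ (λ (i , h≡) → -1ℤ , inj₂ refl , i , trans (cong (_+ -1ℤ) (trans d≡ (cong (λ x → 1ℤ + + 2 * x) h≡))) (ring₁ i))
              , (λ (i , h≡) → 1ℤ , inj₁ refl , 1ℤ + i , trans (cong (_+ 1ℤ) (trans d≡ (cong (λ x → 1ℤ + + 2 * x) h≡))) (ring₂ i))
              ]′ (even⊎odd (proj₁ d-odd))
    where
    d≡ = proj₂ d-odd
    ring₁ : ∀ i → 1ℤ + + 2 * (+ 2 * i) + -1ℤ ≡ + 4 * i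
    ring₁ = ℤ-Solver.solve-∀
    ring₂ : ∀ i → 1ℤ + + 2 * (1ℤ + + 2 * i) + 1ℤ ≡ + 4 * (1ℤ + i)
    ring₂ = ℤ-Solver.solve-∀

-- The integral basis.

module IntegralBasis (m n : ℤ) (m-sf : SquareFree m) (n-sf : SquareFree n)
  (m≡1 : m ≡ 1ℤ [mod + 4 ]) (n≡1 : n ≡ 1ℤ [mod + 4 ]) where
  open Integrality m n m-sf n-sf public
  open Arithmetic-mod4 m n m-sf n-sf m≡1 n≡1 public
  open BasisIdentities

  private
    M N : ℚ
    M = fromℤ m
    N = fromℤ n

  d⁻¹ : ℚ
  d⁻¹ = 1ℤ ∕ d

  d⁻¹*d : d⁻¹ ℚ.* fromℤ d ≡ 1ℚ
  d⁻¹*d = ∕-* 1ℤ d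

  -- ¼ (A + B √m + C √n + E √k)
  quarter : (A B C E : ℚ) → L
  quarter A B C E = ⟨ ¼ ℚ.* A , ¼ ℚ.* B , ¼ ℚ.* C , ¼ ℚ.* (d⁻¹ ℚ.* E) ⟩

  √k≡ : √k ≡ ⟨ 0ℚ , 0ℚ , 0ℚ , d⁻¹ ⟩
  √k≡ = ⟨⟩-cong (√k₁ M N d⁻¹) (√k₂ M N d⁻¹) (√k₃ M N d⁻¹) (√k₄ d⁻¹)

  κ : L
  κ = ½ · (1L ⊕ √k)

  κ≡ : κ ≡ ⟨ ½ , 0ℚ , 0ℚ , ½ ℚ.* d⁻¹ ⟩
  κ≡ = trans (cong (λ v → ½ · (1L ⊕ v)) √k≡) (⟨⟩-cong refl refl refl (cong (½ ℚ.*_) (ℚₚ.+-identityˡ d⁻¹)))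

  *d⁻¹ : ∀ {a b} → a ≡ b * d → fromℤ a ℚ.* d⁻¹ ≡ fromℤ b
  *d⁻¹ {b = b} refl = trans (cong (ℚ._* d⁻¹) (fromℤ-* b d)) (trans (ring (fromℤ b) (fromℤ d) d⁻¹)
    (trans (cong (fromℤ b ℚ.*_) d⁻¹*d) (ℚₚ.*-identityʳ (fromℤ b))))
    where
    ring : ∀ a b i → a ℚ.* b ℚ.* i ≡ a ℚ.* (i ℚ.* b)
    ring = solve-∀ ℚ-ring

  M*d⁻¹ : M ℚ.* d⁻¹ ≡ fromℤ m/d
  M*d⁻¹ = *d⁻¹ m≡

  γ₄≡ : γ₄ ≡ ⟨ ¼ , ¼ , ¼ ℚ.* fromℤ m/d , ¼ ℚ.* d⁻¹ ⟩
  γ₄≡ = trans (cong ((½ · (1L ⊕ √m)) ⊗_) κ≡) (⟨⟩-cong (γ₄₁ M N d⁻¹) (γ₄₂ N d⁻¹)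
    (trans (γ₄₃ M d⁻¹) (cong (¼ ℚ.*_) M*d⁻¹)) (γ₄₄ d⁻¹))

  MN≡KD² : M ℚ.* N ≡ fromℤ k ℚ.* (fromℤ d ℚ.* fromℤ d)
  MN≡KD² = trans (sym (fromℤ-* m n)) (trans (cong fromℤ (_∣_.equality d²∣mn))
    (trans (fromℤ-* k (d * d)) (cong (fromℤ k ℚ.*_) (fromℤ-* d d))))

  fromℤ-1+4* : ∀ {s} j → s ≡ 1ℤ + + 4 * j → fromℤ s ≡ 1ℚ ℚ.+ 4ℚ ℚ.* fromℤ j
  fromℤ-1+4* j refl = trans (fromℤ-+ 1ℤ (+ 4 * j)) (cong (1ℚ ℚ.+_) (fromℤ-* (+ 4) j))

  quadratic⇒ai : ∀ w j → w ⊗ w ≡ w ⊕ ι (fromℤ j) → AlmostIntegral w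
  quadratic⇒ai w@(⟨ a , b , c , e ⟩) j w²≡ = isIntegral⇒ai (- j ∷ -1ℤ ∷ [] ,
    trans (cong (ι (fromℤ (- j)) ⊕_) (trans (⊗-distribˡ w (ι (fromℤ -1ℤ)) (w ⊗ 1L))
      (cong₂ _⊕_ (trans (⊗-comm w (ι (fromℤ -1ℤ))) (ι-⊗ (fromℤ -1ℤ) w))
                 (trans (cong (w ⊗_) (⊗-identityʳ w)) w²≡))))
      (⟨⟩-cong (trans (cong (ℚ._+ (ℚ.- 1ℚ ℚ.* a ℚ.+ (a ℚ.+ fromℤ j))) (fromℤ-neg j)) (quadratic₁ a (fromℤ j)))
               (quadratic₂ b) (quadratic₂ c) (quadratic₂ e)))

  ai-γ₂ : AlmostIntegral γ₂
  ai-γ₂ = quadratic⇒ai γ₂ j (⟨⟩-cong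
      (trans (cong (λ M → ½ ℚ.* ½ ℚ.+ M ℚ.* (½ ℚ.* ½) ℚ.+ N ℚ.* (0ℚ ℚ.* 0ℚ) ℚ.+ M ℚ.* N ℚ.* (0ℚ ℚ.* 0ℚ)) M≡) (γ₂²₁ N (fromℤ j)))
      (γ₂²₂ N (fromℤ j))
      (trans (cong (λ M → ½ ℚ.* 0ℚ ℚ.+ 0ℚ ℚ.* ½ ℚ.+ M ℚ.* (½ ℚ.* 0ℚ ℚ.+ 0ℚ ℚ.* ½)) M≡) (γ₂²₃ N (fromℤ j)))
      (γ₂²₄ N (fromℤ j)))
    where
    j = proj₁ (mod4⇒ m m≡1)
    M≡ : M ≡ 1ℚ ℚ.+ 4ℚ ℚ.* fromℤ j
    M≡ = fromℤ-1+4* j (proj₂ (mod4⇒ m m≡1))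

  ai-γ₃ : AlmostIntegral γ₃
  ai-γ₃ = quadratic⇒ai γ₃ j (⟨⟩-cong
      (trans (cong (λ N → ½ ℚ.* ½ ℚ.+ M ℚ.* (0ℚ ℚ.* 0ℚ) ℚ.+ N ℚ.* (½ ℚ.* ½) ℚ.+ M ℚ.* N ℚ.* (0ℚ ℚ.* 0ℚ)) N≡) (γ₃²₁ M (fromℤ j)))
      (trans (cong (λ N → ½ ℚ.* 0ℚ ℚ.+ 0ℚ ℚ.* ½ ℚ.+ N ℚ.* (½ ℚ.* 0ℚ ℚ.+ 0ℚ ℚ.* ½)) N≡) (γ₃²₂ M (fromℤ j)))
      (γ₃²₃ M (fromℤ j))
      (γ₃²₄ M (fromℤ j)))
    where
    j = proj₁ (mod4⇒ n n≡1)
    N≡ : N ≡ 1ℚ ℚ.+ 4ℚ ℚ.* fromℤ j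
    N≡ = fromℤ-1+4* j (proj₂ (mod4⇒ n n≡1))

  ai-κ : AlmostIntegral κ
  ai-κ = subst AlmostIntegral (sym κ≡) (quadratic⇒ai ⟨ ½ , 0ℚ , 0ℚ , ½ ℚ.* d⁻¹ ⟩ j (⟨⟩-cong
      (trans (κ²₁ M N d⁻¹) (trans (cong (λ x → ¼ ℚ.+ ¼ ℚ.* x) MNd⁻²≡) (κ²-K (fromℤ j))))
      (κ²₂ M N d⁻¹) (κ²₃ M N d⁻¹) (κ²₄ M N d⁻¹)))
    where
    j = proj₁ (mod4⇒ k k≡1)
    MNd⁻²≡ : M ℚ.* N ℚ.* (d⁻¹ ℚ.* d⁻¹) ≡ 1ℚ ℚ.+ 4ℚ ℚ.* fromℤ j
    MNd⁻²≡ = trans (cong (ℚ._* (d⁻¹ ℚ.* d⁻¹)) MN≡KD²) (trans (unscale-√k (fromℤ k) d⁻¹ (fromℤ d))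
      (trans (cong (λ x → fromℤ k ℚ.* (x ℚ.* x)) d⁻¹*d) (trans (ℚₚ.*-identityʳ (fromℤ k))
        (fromℤ-1+4* j (proj₂ (mod4⇒ k k≡1))))))

  ai-γ₄ : AlmostIntegral γ₄
  ai-γ₄ = ai-* ai-γ₂ ai-κ

  ai-· : ∀ x {v} → AlmostIntegral v → AlmostIntegral (fromℤ x · v)
  ai-· x {v} i = subst AlmostIntegral (ι-⊗ (fromℤ x) v) (ai-* (ai-ℤ x) i)

  span : (x₁ x₂ x₃ x₄ : ℚ) → L
  span x₁ x₂ x₃ x₄ = x₁ · γ₁ ⊕ x₂ · γ₂ ⊕ x₃ · γ₃ ⊕ x₄ · γ₄

  span≡quarter : ∀ x₁ x₂ x₃ x₄ → span x₁ x₂ x₃ x₄ ≡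
    quarter (4ℚ ℚ.* x₁ ℚ.+ (2ℚ ℚ.* x₂ ℚ.+ 2ℚ ℚ.* x₃ ℚ.+ x₄)) (2ℚ ℚ.* x₂ ℚ.+ x₄)
            (2ℚ ℚ.* x₃ ℚ.+ fromℤ m/d ℚ.* x₄) x₄
  span≡quarter x₁ x₂ x₃ x₄ = trans (cong (λ v → x₁ · γ₁ ⊕ x₂ · γ₂ ⊕ x₃ · γ₃ ⊕ x₄ · v) γ₄≡)
    (⟨⟩-cong (span₁ x₁ x₂ x₃ x₄ m′ d⁻¹) (span₂ x₁ x₂ x₃ x₄ m′ d⁻¹)
             (span₃ x₁ x₂ x₃ x₄ m′ d⁻¹) (span₄ x₁ x₂ x₃ x₄ m′ d⁻¹))
    where
    m′ = fromℤ m/d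

  ai-span : ∀ x₁ x₂ x₃ x₄ → AlmostIntegral (span (fromℤ x₁) (fromℤ x₂) (fromℤ x₃) (fromℤ x₄))
  ai-span x₁ x₂ x₃ x₄ = ai-+ (ai-+ (ai-+ (ai-· x₁ (ai-ℤ 1ℤ)) (ai-· x₂ ai-γ₂)) (ai-· x₃ ai-γ₃)) (ai-· x₄ ai-γ₄)

  rational-int : ∀ q {w} → AlmostIntegral w → w ≡ ι q → IsInt q
  rational-int q i refl = ai-ι⇒IsInt q i

  -- Equal parities suffice to match the three irrational coordinates by an integral combination of
  -- γ₂, γ₃, γ₄. What remains is rational and almost integral, hence an integer multiple of γ₁, so A
  -- needs no congruence of its own.
  quarter-ai⇒span : ∀ A j₁ j₂ j₃ →
    let B = A + + 2 * j₁ ; C = A + + 2 * j₂ ; E = A + + 2 * j₃ in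
    AlmostIntegral (quarter (fromℤ A) (fromℤ B) (fromℤ C) (fromℤ E)) →
    ∃₂ λ x₁ x₂ → ∃₂ λ x₃ x₄ →
      quarter (fromℤ A) (fromℤ B) (fromℤ C) (fromℤ E) ≡ span (fromℤ x₁) (fromℤ x₂) (fromℤ x₃) (fromℤ x₄)
  quarter-ai⇒span A j₁ j₂ j₃ i = proj₁ x₁ , x₂ , x₃ , x₄ , sym span≡
    where
    B C E h : ℤ
    B = A + + 2 * j₁
    C = A + + 2 * j₂
    E = A + + 2 * j₃
    h = proj₁ m/d-odd

    x₂ x₃ x₄ A₀ : ℤ
    -- Solves B = 2x₂ + x₄ and C = 2x₃ + (m/d)x₄ with x₄ = E and m/d = 1 + 2h.
    x₂ = j₁ - j₃
    x₃ = j₂ - j₃ - h * E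
    x₄ = E
    A₀ = + 2 * x₂ + + 2 * x₃ + x₄

    B≡ : fromℤ B ≡ 2ℚ ℚ.* fromℤ x₂ ℚ.+ fromℤ x₄
    B≡ = trans (cong fromℤ (ring A j₁ j₃)) (trans (fromℤ-+ (+ 2 * x₂) x₄) (cong (ℚ._+ fromℤ x₄) (fromℤ-* (+ 2) x₂)))
      where
      ring : ∀ A j₁ j₃ → A + + 2 * j₁ ≡ + 2 * (j₁ - j₃) + (A + + 2 * j₃)
      ring = ℤ-Solver.solve-∀

    C≡ : fromℤ C ≡ 2ℚ ℚ.* fromℤ x₃ ℚ.+ fromℤ m/d ℚ.* fromℤ x₄
    C≡ = trans (cong fromℤ (trans (ring A j₂ j₃ h) (cong (λ t → + 2 * x₃ + t * x₄) (sym (proj₂ m/d-odd)))))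
      (trans (fromℤ-+ (+ 2 * x₃) (m/d * x₄)) (cong₂ ℚ._+_ (fromℤ-* (+ 2) x₃) (fromℤ-* m/d x₄)))
      where
      ring : ∀ A j₂ j₃ h → A + + 2 * j₂ ≡
        + 2 * (j₂ - j₃ - h * (A + + 2 * j₃)) + (1ℤ + + 2 * h) * (A + + 2 * j₃)
      ring = ℤ-Solver.solve-∀

    A₀≡ : fromℤ A₀ ≡ 2ℚ ℚ.* fromℤ x₂ ℚ.+ 2ℚ ℚ.* fromℤ x₃ ℚ.+ fromℤ x₄
    A₀≡ = trans (fromℤ-+ (+ 2 * x₂ + + 2 * x₃) x₄) (cong (ℚ._+ fromℤ x₄)
      (trans (fromℤ-+ (+ 2 * x₂) (+ 2 * x₃)) (cong₂ ℚ._+_ (fromℤ-* (+ 2) x₂) (fromℤ-* (+ 2) x₃))))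

    span-shape : ∀ q → span q (fromℤ x₂) (fromℤ x₃) (fromℤ x₄)
      ≡ quarter (4ℚ ℚ.* q ℚ.+ fromℤ A₀) (fromℤ B) (fromℤ C) (fromℤ E)
    span-shape q = trans (span≡quarter q (fromℤ x₂) (fromℤ x₃) (fromℤ x₄))
      (shape (sym A₀≡) (sym B≡) (sym C≡))
      where
      shape : ∀ {A A′ B B′ C C′ E} → A ≡ A′ → B ≡ B′ → C ≡ C′ →
        quarter (4ℚ ℚ.* q ℚ.+ A) B C E ≡ quarter (4ℚ ℚ.* q ℚ.+ A′) B′ C′ E
      shape refl refl refl = refl

    remainder : ℚ
    remainder = ¼ ℚ.* (fromℤ A ℚ.- fromℤ A₀)

    remainder≡ : quarter (fromℤ A) (fromℤ B) (fromℤ C) (fromℤ E) ⊕ (⊝ span 0ℚ (fromℤ x₂) (fromℤ x₃) (fromℤ x₄)) ≡ ι remainder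
    remainder≡ = trans (cong (λ w → quarter (fromℤ A) (fromℤ B) (fromℤ C) (fromℤ E) ⊕ (⊝ w)) (span-shape 0ℚ))
      (⟨⟩-cong (ring (fromℤ A) (fromℤ A₀)) (ℚₚ.+-inverseʳ (¼ ℚ.* fromℤ B)) (ℚₚ.+-inverseʳ (¼ ℚ.* fromℤ C))
               (ℚₚ.+-inverseʳ (¼ ℚ.* (d⁻¹ ℚ.* fromℤ E))))
      where
      ring : ∀ A A₀ → ¼ ℚ.* A ℚ.+ ℚ.- (¼ ℚ.* (4ℚ ℚ.* 0ℚ ℚ.+ A₀)) ≡ ¼ ℚ.* (A ℚ.- A₀)
      ring = solve-∀ ℚ-ring

    x₁ : IsInt remainder
    x₁ = rational-int remainder (ai-+ i (ai-⊝ (ai-span 0ℤ x₂ x₃ x₄))) remainder≡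

    span≡ : span (fromℤ (proj₁ x₁)) (fromℤ x₂) (fromℤ x₃) (fromℤ x₄)
      ≡ quarter (fromℤ A) (fromℤ B) (fromℤ C) (fromℤ E)
    span≡ = trans (cong (λ q → span q (fromℤ x₂) (fromℤ x₃) (fromℤ x₄)) (sym (proj₂ x₁)))
      (trans (span-shape remainder) (cong (λ A → quarter A (fromℤ B) (fromℤ C) (fromℤ E))
        (ring (fromℤ A) (fromℤ A₀))))
      where
      ring : ∀ A A₀ → 4ℚ ℚ.* (¼ ℚ.* (A ℚ.- A₀)) ℚ.+ A₀ ≡ A
      ring = solve-∀ ℚ-ring

  ai⇒span : ∀ {v} → AlmostIntegral v →
    ∃₂ λ x₁ x₂ → ∃₂ λ x₃ x₄ → v ≡ span (fromℤ x₁) (fromℤ x₂) (fromℤ x₃) (fromℤ x₄)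
  ai⇒span {v@(⟨ a , b , c , e ⟩)} i =
    let x₁ , x₂ , x₃ , x₄ , q≡ = quarter-ai⇒span A (proj₁ B-int) (proj₁ C-int) (proj₁ E-int)
                                   (subst AlmostIntegral v≡ i)
    in x₁ , x₂ , x₃ , x₄ , trans v≡ q≡
    where
    A-int : IsInt (4ℚ ℚ.* a)
    A-int = rational-int (4ℚ ℚ.* a)
      (ai-+ (ai-+ i (ai-ψ i)) (ai-φ (ai-+ i (ai-ψ i))))
      (⟨⟩-cong (trace₁ a b c e) (trace₂ a b c e) (trace₃ a b c e) (trace₄ a b c e))
    A : ℤ
    A = proj₁ A-int

    with-A : ∀ {s V X} → IsInt (¼ ℚ.* (4ℚ ℚ.* a ℚ.* (4ℚ ℚ.* a) ℚ.- X)) → X ≡ fromℤ s ℚ.* (V ℚ.* V) →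
      IsInt (¼ ℚ.* (fromℤ A ℚ.* fromℤ A ℚ.- fromℤ s ℚ.* (V ℚ.* V)))
    with-A {s} {V} j X≡ = subst₂ (λ x X → IsInt (¼ ℚ.* (x ℚ.* x ℚ.- X))) (proj₂ A-int) X≡ j

    B-int : ∃ λ j → 4ℚ ℚ.* b ≡ fromℤ (A + + 2 * j)
    B-int = half-integral A (4ℚ ℚ.* b) m-sf m≡1 (with-A {m} {4ℚ ℚ.* b} (rational-int
      (¼ ℚ.* (4ℚ ℚ.* a ℚ.* (4ℚ ℚ.* a) ℚ.- M ℚ.* (4ℚ ℚ.* b ℚ.* (4ℚ ℚ.* b))))
      (ai-* (ai-+ i (ai-ψ i)) (ai-φ (ai-+ i (ai-ψ i))))
      (⟨⟩-cong (normₘ₁ M N a b c e) (normₘ₂ M N a b c e) (normₘ₃ M N a b c e) (normₘ₄ M N a b c e))) refl)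

    C-int : ∃ λ j → 4ℚ ℚ.* c ≡ fromℤ (A + + 2 * j)
    C-int = half-integral A (4ℚ ℚ.* c) n-sf n≡1 (with-A {n} {4ℚ ℚ.* c} (rational-int
      (¼ ℚ.* (4ℚ ℚ.* a ℚ.* (4ℚ ℚ.* a) ℚ.- N ℚ.* (4ℚ ℚ.* c ℚ.* (4ℚ ℚ.* c))))
      (ai-* (ai-+ i (ai-φ i)) (ai-ψ (ai-+ i (ai-φ i))))
      (⟨⟩-cong (normₙ₁ M N a b c e) (normₙ₂ M N a b c e) (normₙ₃ M N a b c e) (normₙ₄ M N a b c e))) refl)

    -- Since √m√n = d√k, the coordinate with respect to √k is d e, and it is k that has to be
    -- square-free.
    E-int : ∃ λ j → 4ℚ ℚ.* (fromℤ d ℚ.* e) ≡ fromℤ (A + + 2 * j)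
    E-int = half-integral A (4ℚ ℚ.* (fromℤ d ℚ.* e)) k-squareFree k≡1 (with-A {k} {4ℚ ℚ.* (fromℤ d ℚ.* e)} (rational-int
      (¼ ℚ.* (4ℚ ℚ.* a ℚ.* (4ℚ ℚ.* a) ℚ.- M ℚ.* N ℚ.* (4ℚ ℚ.* e ℚ.* (4ℚ ℚ.* e))))
      (ai-* (ai-+ i (ai-φ (ai-ψ i))) (ai-φ (ai-+ i (ai-φ (ai-ψ i)))))
      (⟨⟩-cong (normₖ₁ M N a b c e) (normₖ₂ M N a b c e) (normₖ₃ M N a b c e) (normₖ₄ M N a b c e)))
      (trans (cong (ℚ._* (4ℚ ℚ.* e ℚ.* (4ℚ ℚ.* e))) MN≡KD²) (scale-√k (fromℤ k) (fromℤ d) e)))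

    v≡ : v ≡ quarter (fromℤ A) (fromℤ (A + + 2 * proj₁ B-int))
               (fromℤ (A + + 2 * proj₁ C-int)) (fromℤ (A + + 2 * proj₁ E-int))
    v≡ = ⟨⟩-cong (trans (quarter₄ a) (cong (¼ ℚ.*_) (proj₂ A-int)))
                 (trans (quarter₄ b) (cong (¼ ℚ.*_) (proj₂ B-int)))
                 (trans (quarter₄ c) (cong (¼ ℚ.*_) (proj₂ C-int)))
                 (trans (sym (trans (quarter₄-d d⁻¹ (fromℤ d) e)
                          (trans (cong (ℚ._* e) d⁻¹*d) (ℚₚ.*-identityˡ e))))
                        (cong (λ x → ¼ ℚ.* (d⁻¹ ℚ.* x)) (proj₂ E-int)))

-- The associated order acting on integer coordinates.

±1 ±2 : ℤ → Set
±1 z = z ≡ 1ℤ ⊎ z ≡ -1ℤ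
±2 z = z ≡ + 2 ⊎ z ≡ - + 2

±1⇒square : ∀ {z} → ±1 z → z * z ≡ 1ℤ
±1⇒square (inj₁ refl) = refl
±1⇒square (inj₂ refl) = refl

±1⇒odd : ∀ {z} → ±1 z → Odd z
±1⇒odd (inj₁ refl) = 0ℤ , refl
±1⇒odd (inj₂ refl) = -1ℤ , refl

-- (A , X , Y , Z) are the coordinates of 4v with respect to the square roots, suitably
-- ordered and signed, for an integral v.
record Admissible (A X Y Z : ℤ) : Set where
  constructor admissible
  field
    {i j x} : ℤ
    Y≡ : Y ≡ X + + 2 * i
    Z≡ : Z ≡ X + + 2 * j
    A≡ : A ≡ X + Y + Z + + 4 * x

-- The associated order: H acts by p and q on two lines, and on the remaining plane as
-- r + s J with J² = -uw.
record InOrder (p q r s : ℤ) : Set where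
  constructor inOrder
  field
    {a b} : ℤ
    p≡ : p ≡ r + s + + 2 * a
    q≡ : q ≡ p + + 2 * s + + 4 * b

module IntegerAction (υ μ : ℤ) where
  -- This parametrises an odd u and a w congruent to it mod 4, so that the congruences become ring
  -- identities.
  u w : ℤ
  u = 1ℤ + + 2 * υ
  w = u + + 4 * μ

  order-preserves : ∀ {p q r s A X Y Z} → InOrder p q r s → Admissible A X Y Z →
    Admissible (p * A) (q * X) (r * Y - s * u * Z) (r * Z + s * w * Y)
  order-preserves {r = r} {s} {X = X} (inOrder {a} {b} refl refl) (admissible {i} {j} {x} refl refl refl) =
    admissible (eqY r s a b X i j υ) (eqZ r s a b X i j υ μ) (eqA r s a b X i j x υ μ)
    where
    eqY : ∀ r s a b X i j υ →
      r * (X + + 2 * i) - s * (1ℤ + + 2 * υ) * (X + + 2 * j)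
      ≡ (r + s + + 2 * a + + 2 * s + + 4 * b) * X
        + + 2 * (r * i - (a + + 2 * (b + s) + s * υ) * X - s * j - + 2 * (s * j * υ))
    eqY = ℤ-Solver.solve-∀
    eqZ : ∀ r s a b X i j υ μ →
      r * (X + + 2 * j) + s * (1ℤ + + 2 * υ + + 4 * μ) * (X + + 2 * i)
      ≡ (r + s + + 2 * a + + 2 * s + + 4 * b) * X
        + + 2 * (r * j + s * (υ + + 2 * μ) * (X + + 2 * i) + s * i - (a + + 2 * b + s) * X)
    eqZ = ℤ-Solver.solve-∀
    eqA : ∀ r s a b X i j x υ μ →
      (r + s + + 2 * a) * (X + (X + + 2 * i) + (X + + 2 * j) + + 4 * x)
      ≡ (r + s + + 2 * a + + 2 * s + + 4 * b) * X
        + (r * (X + + 2 * i) - s * (1ℤ + + 2 * υ) * (X + + 2 * j))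
        + (r * (X + + 2 * j) + s * (1ℤ + + 2 * υ + + 4 * μ) * (X + + 2 * i))
        + + 4 * (a * (X + i + j + + 2 * x) - b * X - μ * s * (X + + 2 * i) - s * i * υ + s * j + s * j * υ + (r + s) * x)
    eqA = ℤ-Solver.solve-∀

  norm : ℤ → ℤ → ℤ
  norm Y Z = w * (Y * Y) + u * (Z * Z)

  -- Odd squares are 1 mod 4, so the norm is w + u ≡ 2u mod 4, and u is odd.
  norm≡2odd : ∀ {Y Z} → Odd Y → Odd Z → ∃ λ κ → norm Y Z ≡ + 2 * (1ℤ + + 2 * κ)
  norm≡2odd (y , refl) (z , refl) =
    υ + (1ℤ + + 2 * υ) * (y * y + y + z * z + z) + μ * ((1ℤ + + 2 * y) * (1ℤ + + 2 * y)) , ring υ μ y z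
    where
    ring : ∀ υ μ y z →
      (1ℤ + + 2 * υ + + 4 * μ) * ((1ℤ + + 2 * y) * (1ℤ + + 2 * y)) + (1ℤ + + 2 * υ) * ((1ℤ + + 2 * z) * (1ℤ + + 2 * z))
      ≡ + 2 * (1ℤ + + 2 * (υ + (1ℤ + + 2 * υ) * (y * y + y + z * z + z) + μ * ((1ℤ + + 2 * y) * (1ℤ + + 2 * y))))
    ring = ℤ-Solver.solve-∀

  -- Cancelling 2 leaves t(1 + 2κ) = 2; so t carries the factor 2 and the odd factor is a unit.
  2odd∣4⇒±2 : ∀ t κ → t * (+ 2 * (1ℤ + + 2 * κ)) ≡ + 4 → ±2 (+ 2 * (1ℤ + + 2 * κ))
  2odd∣4⇒±2 t κ eq = [ case-even , case-odd ]′ (even⊎odd t)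
    where
    halved : t * (1ℤ + + 2 * κ) ≡ + 2
    halved = ℤₚ.*-cancelˡ-≡ (+ 2) _ _ (trans (regroup t κ) eq)
      where
      regroup : ∀ t κ → + 2 * (t * (1ℤ + + 2 * κ)) ≡ t * (+ 2 * (1ℤ + + 2 * κ))
      regroup = ℤ-Solver.solve-∀

    case-even : Even t → ±2 (+ 2 * (1ℤ + + 2 * κ))
    case-even (h , refl) = [ (λ e → inj₁ (cong (+ 2 *_) e)) , (λ e → inj₂ (cong (+ 2 *_) e)) ]′
      (∣unit∣ {1ℤ + + 2 * κ} {h} (ℤₚ.*-cancelˡ-≡ (+ 2) _ _ (trans (regroup h κ) halved)))
      where
      regroup : ∀ h κ → + 2 * ((1ℤ + + 2 * κ) * h) ≡ + 2 * h * (1ℤ + + 2 * κ)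
      regroup = ℤ-Solver.solve-∀

    case-odd : Odd t → ±2 (+ 2 * (1ℤ + + 2 * κ))
    case-odd (h , refl) = contradiction (h + κ + + 2 * (h * κ) , trans (sym halved) (expand h κ)) (even≢odd (1ℤ , refl))
      where
      expand : ∀ h κ → (1ℤ + + 2 * h) * (1ℤ + + 2 * κ) ≡ 1ℤ + + 2 * (h + κ + + 2 * (h * κ))
      expand = ℤ-Solver.solve-∀

  -- Solving for two vectors that span a sublattice of index 4 of the plane, the
  -- determinant of (r , s) ↦ (rY - suZ , rZ + swY) must divide 4; it is the norm.
  transitive⇒norm≡±2 : ∀ {A X Y Z} → Admissible A X Y Z →
    (q r s r′ s′ : ℤ) → q * X ≡ 1ℤ →
    r * Y - s * u * Z ≡ + 2 → r * Z + s * w * Y ≡ 0ℤ →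
    r′ * Y - s′ * u * Z ≡ 0ℤ → r′ * Z + s′ * w * Y ≡ + 2 → ±2 (norm Y Z)
  transitive⇒norm≡±2 {X = X} {Y} {Z} (admissible {i} {j} Y≡ Z≡ _) q r s r′ s′ qX≡1 e₁ e₂ e₃ e₄ =
    subst ±2 (sym (proj₂ D)) (2odd∣4⇒±2 (r * s′ - s * r′) (proj₁ D)
      (trans (cong ((r * s′ - s * r′) *_) (sym (proj₂ D))) (trans (determinant r s r′ s′ Y Z u w)
        (trans (cong₂ (λ a b → a * (r′ * Z + s′ * w * Y) - b * (r′ * Y - s′ * u * Z)) e₁ e₂)
          (cong₂ (λ a b → + 2 * a - 0ℤ * b) e₄ e₃)))))
    where
    determinant : ∀ r s r′ s′ Y Z u w → (r * s′ - s * r′) * (w * (Y * Y) + u * (Z * Z))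
      ≡ (r * Y - s * u * Z) * (r′ * Z + s′ * w * Y) - (r * Z + s * w * Y) * (r′ * Y - s′ * u * Z)
    determinant = ℤ-Solver.solve-∀

    odd+2* : ∀ {X Y} i → Odd X → Y ≡ X + + 2 * i → Odd Y
    odd+2* i (h , refl) refl = h + i , ring h i
      where
      ring : ∀ h i → 1ℤ + + 2 * h + + 2 * i ≡ 1ℤ + + 2 * (h + i)
      ring = ℤ-Solver.solve-∀

    X-odd : Odd X
    X-odd = ±1⇒odd (∣unit∣ {X} {q} (trans (ℤₚ.*-comm X q) qX≡1))

    D : ∃ λ κ → norm Y Z ≡ + 2 * (1ℤ + + 2 * κ)
    D = norm≡2odd (odd+2* i X-odd Y≡) (odd+2* j X-odd Z≡)

  -- A and X are their own inverses, which gives p = AA′ and q = XX′. On the plane Cramer's rule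
  -- gives r = (wYY′ + uZZ′)/D and s = (YZ′ - ZY′)/D with D = 2η, η = ±1; both numerators are even
  -- because the parities agree within each vector.
  norm≡±2⇒transitive : ∀ {A X Y Z A′ X′ Y′ Z′} → Admissible A X Y Z → ±1 A → ±1 X → ±2 (norm Y Z) →
    Admissible A′ X′ Y′ Z′ →
    ∃₂ λ p q → ∃₂ λ r s → InOrder p q r s ×
      p * A ≡ A′ × q * X ≡ X′ × r * Y - s * u * Z ≡ Y′ × r * Z + s * w * Y ≡ Z′
  norm≡±2⇒transitive {A} {X} {Y} {Z} {A′} {X′} {Y′} {Z′}
    (admissible {i} {j} {x} refl refl refl) A²≡1 X²≡1 D≡±2
    (admissible {i′} {j′} {x′} refl refl refl) =
      p , q , r , s , inOrder {a = a} {b} (p≡ X i j x X′ i′ j′ x′ e υ μ) (q≡ X i j x X′ i′ j′ x′ e)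
    , cancel A A′ (±1⇒square A²≡1) , cancel X X′ (±1⇒square X²≡1) , eqY , eqZ
    where
    halve : ∀ {D} → ±2 D → ∃ λ e → D ≡ + 2 * (1ℤ + + 2 * e) × (1ℤ + + 2 * e) * (1ℤ + + 2 * e) ≡ 1ℤ
    halve (inj₁ refl) = 0ℤ , refl , refl
    halve (inj₂ refl) = -1ℤ , refl , refl

    e η R S ω U p q r s a b : ℤ
    e = proj₁ (halve D≡±2)
    η = 1ℤ + + 2 * e
    -- 2R = YY′ + ZZ′ and 2S = YZ′ - ZY′
    R = X′ * (X + i + j) + Y * i′ + Z * j′
    S = X′ * (i - j) + Y * j′ - Z * i′
    -- With w = 1 + 2ω one has r + s = ηU = U + 2eU; the term -eU in `a` removes the dependence on
    -- the sign η.
    ω = υ + + 2 * μ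
    U = R + S + + 2 * (ω * R - μ * (Z * Z′))
    p = A * A′
    q = X * X′
    -- As u = w - 4μ, the numerator wYY′ + uZZ′ equals 2wR - 4μZZ′.
    r = η * (w * R - + 2 * (μ * (Z * Z′)))
    s = η * S
    a = (X + i + j + + 2 * x) * X′ + (X′ + i′ + j′ + + 2 * x′) * X
      + + 2 * ((X + i + j + + 2 * x) * (X′ + i′ + j′ + + 2 * x′))
      - (i * X′ + j′ * X + i * (i′ + j′) + j * (j′ - i′)) - (ω * R - μ * (Z * Z′)) - e * U
    b = - ((X + i + j + + 2 * x) * (X′ + i′ + j′ + + 2 * x′)
           + X * X′ + i * X′ + j′ * X + x * X′ + x′ * X + i * j′ - j * i′ + e * S)

    cancel : ∀ A A′ → A * A ≡ 1ℤ → A * A′ * A ≡ A′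
    cancel A A′ A²≡1 = trans (regroup A A′) (trans (cong (_* A′) A²≡1) (ℤₚ.*-identityˡ A′))
      where
      regroup : ∀ A A′ → A * A′ * A ≡ A * A * A′
      regroup = ℤ-Solver.solve-∀

    p≡ : ∀ X i j x X′ i′ j′ x′ e υ μ →
      let Y = X + + 2 * i ; Z = X + + 2 * j ; A = X + Y + Z + + 4 * x
          Y′ = X′ + + 2 * i′ ; Z′ = X′ + + 2 * j′ ; A′ = X′ + Y′ + Z′ + + 4 * x′
          R = X′ * (X + i + j) + Y * i′ + Z * j′
          S = X′ * (i - j) + Y * j′ - Z * i′
          ω = υ + + 2 * μ
          U = R + S + + 2 * (ω * R - μ * (Z * Z′)) in
      A * A′ ≡ (1ℤ + + 2 * e) * ((1ℤ + + 2 * υ + + 4 * μ) * R - + 2 * (μ * (Z * Z′))) + (1ℤ + + 2 * e) * S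
        + + 2 * ((X + i + j + + 2 * x) * X′ + (X′ + i′ + j′ + + 2 * x′) * X
          + + 2 * ((X + i + j + + 2 * x) * (X′ + i′ + j′ + + 2 * x′))
          - (i * X′ + j′ * X + i * (i′ + j′) + j * (j′ - i′)) - (ω * R - μ * (Z * Z′)) - e * U)
    p≡ = ℤ-Solver.solve-∀

    q≡ : ∀ X i j x X′ i′ j′ x′ e →
      let Y = X + + 2 * i ; Z = X + + 2 * j ; A = X + Y + Z + + 4 * x
          Y′ = X′ + + 2 * i′ ; Z′ = X′ + + 2 * j′ ; A′ = X′ + Y′ + Z′ + + 4 * x′
          S = X′ * (i - j) + Y * j′ - Z * i′ in
      X * X′ ≡ A * A′ + + 2 * ((1ℤ + + 2 * e) * S) + + 4 *
        - ((X + i + j + + 2 * x) * (X′ + i′ + j′ + + 2 * x′)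
           + X * X′ + i * X′ + j′ * X + x * X′ + x′ * X + i * j′ - j * i′ + e * S)
    q≡ = ℤ-Solver.solve-∀

    -- The norm is 2η with η² = 1, so multiplying by η and the norm amounts to doubling.
    doubled : ∀ {y Y} → + 2 * y ≡ η * Y * norm (X + + 2 * i) (X + + 2 * j) → y ≡ Y
    doubled {y} {Y} eq = ℤₚ.*-cancelˡ-≡ (+ 2) _ _ (trans eq
      (trans (cong (η * Y *_) (proj₁ (proj₂ (halve D≡±2)))) (trans (regroup η Y)
        (cong (+ 2 *_) (trans (cong (_* Y) (proj₂ (proj₂ (halve D≡±2)))) (ℤₚ.*-identityˡ Y))))))
      where
      regroup : ∀ η Y → η * Y * (+ 2 * η) ≡ + 2 * (η * η * Y)
      regroup = ℤ-Solver.solve-∀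

    eqY : r * Y - s * u * Z ≡ Y′
    eqY = doubled (ring X i j X′ i′ j′ η u μ)
      where
      ring : ∀ X i j X′ i′ j′ η u μ →
        let Y = X + + 2 * i ; Z = X + + 2 * j ; Y′ = X′ + + 2 * i′ ; Z′ = X′ + + 2 * j′ ; w = u + + 4 * μ
            R = X′ * (X + i + j) + Y * i′ + Z * j′
            S = X′ * (i - j) + Y * j′ - Z * i′ in
        + 2 * (η * (w * R - + 2 * (μ * (Z * Z′))) * Y - η * S * u * Z)
        ≡ η * Y′ * (w * (Y * Y) + u * (Z * Z))
      ring = ℤ-Solver.solve-∀

    eqZ : r * Z + s * w * Y ≡ Z′
    eqZ = doubled (ring X i j X′ i′ j′ η u μ)
      where
      ring : ∀ X i j X′ i′ j′ η u μ →
        let Y = X + + 2 * i ; Z = X + + 2 * j ; Y′ = X′ + + 2 * i′ ; Z′ = X′ + + 2 * j′ ; w = u + + 4 * μ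
            R = X′ * (X + i + j) + Y * i′ + Z * j′
            S = X′ * (i - j) + Y * j′ - Z * i′ in
        + 2 * (η * (w * R - + 2 * (μ * (Z * Z′))) * Z + η * S * w * Y)
        ≡ η * Z′ * (w * (Y * Y) + u * (Z * Z))
      ring = ℤ-Solver.solve-∀

-- The Galois group of L.

module Galois (m n : ℤ) (m-sf : SquareFree m) (n-sf : SquareFree n)
  (m≡1 : m ≡ 1ℤ [mod + 4 ]) (n≡1 : n ≡ 1ℤ [mod + 4 ])
  (isField : Biquadratic.IsField m n m-sf n-sf) where
  open IntegralBasis m n m-sf n-sf m≡1 n≡1 public
  open ActionIdentities
  open RingMorphisms L-rawRing L-rawRing using (IsRingIsomorphism)
  open Endo L using (_^_)

  private
    M N : ℚ
    M = fromℤ m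
    N = fromℤ n

  infix 4 _≟L_ _≗L_
  _≟L_ : ∀ (v w : L) → Dec (v ≡ w)
  ⟨ a , b , c , e ⟩ ≟L ⟨ a′ , b′ , c′ , e′ ⟩ = map′
    (λ (p , q , r , s) → ⟨⟩-cong p q r s)
    (λ v≡w → cong L.c₁ v≡w , cong L.c√m v≡w , cong L.c√n v≡w , cong L.c√m√n v≡w)
    (a ℚₚ.≟ a′ ×-dec b ℚₚ.≟ b′ ×-dec c ℚₚ.≟ c′ ×-dec e ℚₚ.≟ e′)

  _≗L_ : (g h : L → L) → Set
  g ≗L h = ∀ v → g v ≡ h v

  no-zero-divisors : ∀ {v w} → v ⊗ w ≡ 0L → v ≢ 0L → w ≡ 0L
  no-zero-divisors {v} {w} vw≡0 v≢0 = begin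
    w            ≡⟨ ⊗-identityˡ w ⟨
    1L ⊗ w       ≡⟨ cong (_⊗ w) (trans (⊗-comm x v) (proj₂ (isField v v≢0))) ⟨
    (x ⊗ v) ⊗ w  ≡⟨ ⊗-assoc x v w ⟩
    x ⊗ (v ⊗ w)  ≡⟨ cong (x ⊗_) vw≡0 ⟩
    x ⊗ 0L       ≡⟨ ⊗-zeroʳ x ⟩
    0L           ∎
    where
    open ≡-Reasoning
    x : L
    x = proj₁ (isField v v≢0)

  ⊖≡0⇒≡ : ∀ {v w} → v ⊖ w ≡ 0L → v ≡ w
  ⊖≡0⇒≡ {⟨ a , b , c , e ⟩} {⟨ a′ , b′ , c′ , e′ ⟩} eq = ⟨⟩-cong
    (coordinate a a′ (cong L.c₁ eq)) (coordinate b b′ (cong L.c√m eq))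
    (coordinate c c′ (cong L.c√n eq)) (coordinate e e′ (cong L.c√m√n eq))
    where
    add : ∀ a a′ → a ≡ a ℚ.+ ℚ.- a′ ℚ.+ a′
    add = solve-∀ ℚ-ring
    coordinate : ∀ a a′ → a ℚ.+ ℚ.- a′ ≡ 0ℚ → a ≡ a′
    coordinate a a′ eq = trans (add a a′) (trans (cong (ℚ._+ a′) eq) (ℚₚ.+-identityˡ a′))

  same-square : ∀ {v w} → v ⊗ v ≡ w ⊗ w → v ≡ w ⊎ v ≡ ⊝ w
  same-square {v} {w} v²≡w² = by-cases (v ⊖ w ≟L 0L)
    where
    open DifferenceOfSquares L-commutativeSemiring
    open ≡-Reasoning

    product≡0 : (v ⊖ w) ⊗ (v ⊕ w) ≡ 0L
    product≡0 = begin
      (v ⊖ w) ⊗ (v ⊕ w)                 ≡⟨ expand v w (⊝ w) ⟩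
      v ⊗ v ⊕ v ⊗ (w ⊖ w) ⊕ w ⊗ (⊝ w)   ≡⟨ cong (λ x → v ⊗ v ⊕ x ⊕ w ⊗ (⊝ w)) (trans (cong (v ⊗_) (⊖-inverseʳ w)) (⊗-zeroʳ v)) ⟩
      v ⊗ v ⊕ 0L ⊕ w ⊗ (⊝ w)            ≡⟨ cong (_⊕ w ⊗ (⊝ w)) (trans (⊕-identityʳ (v ⊗ v)) v²≡w²) ⟩
      w ⊗ w ⊕ w ⊗ (⊝ w)                 ≡⟨ factor w (⊝ w) ⟩
      w ⊗ (w ⊖ w)                       ≡⟨ trans (cong (w ⊗_) (⊖-inverseʳ w)) (⊗-zeroʳ w) ⟩
      0L                                ∎

    by-cases : Dec (v ⊖ w ≡ 0L) → v ≡ w ⊎ v ≡ ⊝ w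
    by-cases (yes eq) = inj₁ (⊖≡0⇒≡ eq)
    by-cases (no neq) = inj₂ (⊖≡0⇒≡ (trans (cong (v ⊕_) (⊝-involutive w)) (no-zero-divisors product≡0 neq)))

  involution⇒InGal : ∀ g → (∀ v w → g (v ⊕ w) ≡ g v ⊕ g w) → (∀ v w → g (v ⊗ w) ≡ g v ⊗ g w) →
    (∀ v → g (⊝ v) ≡ ⊝ g v) → (∀ q → g (ι q) ≡ ι q) → (∀ v → g (g v) ≡ v) → InGal g
  involution⇒InGal g g-⊕ g-⊗ g-⊝ g-ι gg≡id = record
    { isRingIsomorphism = record
      { isRingMonomorphism = record
        { isRingHomomorphism = record
          { isSemiringHomomorphism = record
            { isNearSemiringHomomorphism = record
              { +-isMonoidHomomorphism = record
                { isMagmaHomomorphism = record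
                  { isRelHomomorphism = record { cong = cong g }
                  ; homo = g-⊕
                  }
                ; ε-homo = g-ι 0ℚ
                }
              ; *-homo = g-⊗
              }
            ; 1#-homo = g-ι 1ℚ
            }
          ; -‿homo = g-⊝
          }
        ; injective = λ {v} {w} gv≡gw → trans (sym (gg≡id v)) (trans (cong g gv≡gw) (gg≡id w))
        }
      ; surjective = λ v → g v , λ { refl → gg≡id v }
      }
    ; fixes-ℚ = g-ι
    }

  χ : L → L
  χ = φ ∘ ψ

  id∈Gal : InGal id
  id∈Gal = involution⇒InGal id (λ _ _ → refl) (λ _ _ → refl) (λ _ → refl) (λ _ → refl) (λ _ → refl)

  φ∈Gal : InGal φ
  φ∈Gal = involution⇒InGal φ φ-⊕ φ-⊗ (λ _ → refl) (λ _ → refl) φ-involutive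

  ψ∈Gal : InGal ψ
  ψ∈Gal = involution⇒InGal ψ ψ-⊕ ψ-⊗ (λ _ → refl) (λ _ → refl) ψ-involutive

  χ∈Gal : InGal χ
  χ∈Gal = involution⇒InGal χ
    (λ v w → trans (cong φ (ψ-⊕ v w)) (φ-⊕ (ψ v) (ψ w)))
    (λ v w → trans (cong φ (ψ-⊗ v w)) (φ-⊗ (ψ v) (ψ w)))
    (λ _ → refl) (λ _ → refl)
    (λ v → trans (cong φ (cong φ (ψ-involutive v))) (φ-involutive v))

  module _ {g} (g∈Gal : InGal g) where
    private module G = IsRingIsomorphism (InGal.isRingIsomorphism g∈Gal)

    gal-⊗ : ∀ v w → g (v ⊗ w) ≡ g v ⊗ g w
    gal-⊗ = G.*-homo

    decompose : ∀ a b c e → ⟨ a , b , c , e ⟩ ≡ ι a ⊕ ι b ⊗ √m ⊕ ι c ⊗ √n ⊕ ι e ⊗ (√m ⊗ √n)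
    decompose a b c e = sym (trans
      (cong₂ _⊕_ (cong₂ _⊕_ (cong (ι a ⊕_) (ι-⊗ b √m)) (ι-⊗ c √n)) (ι-⊗ e (√m ⊗ √n)))
      (⟨⟩-cong (decompose₁ M N a b c e) (decompose₂ N b c e) (decompose₃ M b c e) (decompose₄ b c e)))

    gal-linear : ∀ a b c e → g ⟨ a , b , c , e ⟩ ≡ ι a ⊕ ι b ⊗ g √m ⊕ ι c ⊗ g √n ⊕ ι e ⊗ (g √m ⊗ g √n)
    gal-linear a b c e = trans (cong g (decompose a b c e))
      (trans (G.+-homo (ι a ⊕ ι b ⊗ √m ⊕ ι c ⊗ √n) (ι e ⊗ (√m ⊗ √n))) (cong₂ _⊕_
        (trans (G.+-homo (ι a ⊕ ι b ⊗ √m) (ι c ⊗ √n)) (cong₂ _⊕_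
          (trans (G.+-homo (ι a) (ι b ⊗ √m)) (cong₂ _⊕_ (InGal.fixes-ℚ g∈Gal a) (scalar b √m)))
          (scalar c √n)))
        (trans (scalar e (√m ⊗ √n)) (cong (ι e ⊗_) (gal-⊗ √m √n)))))
      where
      scalar : ∀ q v → g (ι q ⊗ v) ≡ ι q ⊗ g v
      scalar q v = trans (gal-⊗ (ι q) v) (cong (_⊗ g v) (InGal.fixes-ℚ g∈Gal q))

    gal-√ : ∀ {v q} → v ⊗ v ≡ ι q → g v ≡ v ⊎ g v ≡ ⊝ v
    gal-√ {v} {q} v²≡q = same-square (trans (sym (gal-⊗ v v))
      (trans (cong g v²≡q) (trans (InGal.fixes-ℚ g∈Gal q) (sym v²≡q))))

  gal-ext : ∀ {g h} → InGal g → InGal h → g √m ≡ h √m → g √n ≡ h √n → g ≗L h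
  gal-ext {g} {h} g∈ h∈ eqm eqn ⟨ a , b , c , e ⟩ = trans (gal-linear g∈ a b c e) (trans
    (cong₂ (λ s t → ι a ⊕ ι b ⊗ s ⊕ ι c ⊗ t ⊕ ι e ⊗ (s ⊗ t)) eqm eqn)
    (sym (gal-linear h∈ a b c e)))

  data Automorphism (g : L → L) : Set where
    is-id : g ≗L id → Automorphism g
    is-φ  : g ≗L φ  → Automorphism g
    is-ψ  : g ≗L ψ  → Automorphism g
    is-χ  : g ≗L χ  → Automorphism g

  -- In a field g can only change the signs of √m and √n, whose squares are rational, and these two
  -- signs determine g.
  classify : ∀ {g} → InGal g → Automorphism g
  classify {g} g∈ = go
    (gal-√ g∈ (⟨⟩-cong (√m²₁ M N) (√m²₂ N) (√m²₃ M) refl))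
    (gal-√ g∈ (⟨⟩-cong (√n²₁ M N) (√n²₂ N) (√n²₃ M) refl))
    where
    go : g √m ≡ √m ⊎ g √m ≡ ⊝ √m → g √n ≡ √n ⊎ g √n ≡ ⊝ √n → Automorphism g
    go (inj₁ p) (inj₁ q) = is-id (gal-ext g∈ id∈Gal p q)
    go (inj₂ p) (inj₁ q) = is-φ (gal-ext g∈ φ∈Gal p q)
    go (inj₁ p) (inj₂ q) = is-ψ (gal-ext g∈ ψ∈Gal p q)
    go (inj₂ p) (inj₂ q) = is-χ (gal-ext g∈ χ∈Gal p q)

-- The Hopf algebra in terms of explicit sign changes.

module HopfAction (m n : ℤ) (m-sf : SquareFree m) (n-sf : SquareFree n)
  (m≡1 : m ≡ 1ℤ [mod + 4 ]) (n≡1 : n ≡ 1ℤ [mod + 4 ])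
  (isField : Biquadratic.IsField m n m-sf n-sf) where
  open Galois m n m-sf n-sf m≡1 n≡1 isField public
  open ActionIdentities
  open EmbeddingIdentities hiding (2ℚ)
  open Endo L using (_^_)

  form : (ζ : L) (a b c e : ℚ) (v x y z : L) → L
  form ζ a b c e v x y z = a · v ⊕ b · x ⊕ c · (y ⊕ z) ⊕ e · (ζ ⊗ (y ⊖ z))

  -- Replacing σ by στ exchanges σ and στ, as τ² = id, which costs only the sign of e. Hence the
  -- span does not depend on the choice of σ.
  form-swap : ∀ ζ a b c e v x y z → form ζ a b c e v x z y ≡ form ζ a b c (ℚ.- e) v x y z
  form-swap ζ a b c e v x y z = cong₂ (λ s t → a · v ⊕ b · x ⊕ c · s ⊕ t) (⊕-comm z y)
    (trans (cong (λ w → e · (ζ ⊗ w)) (negate y z))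
      (trans (cong (e ·_) (sym (-‿distribʳ-* ζ (y ⊖ z)))) (scale (ζ ⊗ (y ⊖ z)))))
    where
    open CommutativeRing L-commutativeRing using () renaming (+-comm to ⊕-comm; ring to L-ring)
    open RingProperties L-ring using (-‿distribʳ-*)
    negate : ∀ y z → z ⊖ y ≡ ⊝ (y ⊖ z)
    negate ⟨ a , b , c , e ⟩ ⟨ a′ , b′ , c′ , e′ ⟩ = ⟨⟩-cong
      (swap-difference a a′) (swap-difference b b′) (swap-difference c c′) (swap-difference e e′)
    scale : ∀ w → e · (⊝ w) ≡ (ℚ.- e) · w
    scale ⟨ a , b , c , f ⟩ = ⟨⟩-cong
      (swap-scalar e a) (swap-scalar e b) (swap-scalar e c) (swap-scalar e f)

  -- ρ and θ are fixed sign changes standing for τ and σ. τ is forced, while σ may be either of the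
  -- two elements outside ⟨τ⟩.
  record Generators (ρ θ : L → L) {ζ : L} (S : NonClassical ζ) : Set where
    open NonClassical S
    field
      τ≗ρ : τ ≗L ρ
      σ≗  : σ ≗L θ ⊎ σ ≗L θ ∘ ρ
      ρ-involutive : ∀ v → ρ (ρ v) ≡ v

    canonical : (a b c e : ℚ) → L → L
    canonical a b c e v = form ζ a b c e v (ρ v) (θ v) (θ (ρ v))

    private
      form-cong : ∀ {a b c e v x x′ y y′ z z′} → x ≡ x′ → y ≡ y′ → z ≡ z′ →
        form ζ a b c e v x y z ≡ form ζ a b c e v x′ y′ z′
      form-cong refl refl refl = refl

      -- ε is the identity or negation according to the choice of σ. Being an involution, it
      -- transfers coefficients in both directions.
      sign-change : ∃ λ (ε : ℚ → ℚ) → (∀ e → ε (ε e) ≡ e) × ∀ a b c e v →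
        form ζ a b c e v (τ v) (σ v) (σ (τ v)) ≡ canonical a b c (ε e) v
      sign-change = go σ≗
        where
        go : σ ≗L θ ⊎ σ ≗L θ ∘ ρ → _
        go (inj₁ σ≗θ) = id , (λ _ → refl) , λ a b c e v →
          form-cong {a} {b} {c} {e} (τ≗ρ v) (σ≗θ v) (trans (σ≗θ (τ v)) (cong θ (τ≗ρ v)))
        go (inj₂ σ≗θρ) = ℚ.-_ , Scaling.neg-involutive , λ a b c e v → trans
          (form-cong {a} {b} {c} {e} (τ≗ρ v) (σ≗θρ v)
            (trans (σ≗θρ (τ v)) (cong θ (trans (cong ρ (τ≗ρ v)) (ρ-involutive v)))))
          (form-swap ζ a b c e v (ρ v) (θ v) (θ (ρ v)))

    InH⇒canonical : ∀ {h} → InH S h → ∃ λ a → ∃ λ b → ∃ λ c → ∃ λ e → h ≗L canonical a b c e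
    InH⇒canonical (a , b , c , e , h≡) =
      a , b , c , proj₁ sign-change e , λ v → trans (h≡ v) (proj₂ (proj₂ sign-change) a b c e v)

    canonical∈H : ∀ a b c e → InH S (canonical a b c e)
    canonical∈H a b c e = a , b , c , ε e , λ v → sym (trans
      (proj₂ (proj₂ sign-change) a b c (ε e) v)
      (cong (λ e → canonical a b c e v) (proj₁ (proj₂ sign-change) e)))
      where
      ε = proj₁ sign-change

  module _ {ζ : L} (S : NonClassical ζ) where
    open NonClassical S

    -- If τ were the identity, so would be all its powers, and among these is every automorphism
    -- fixing ζ, in particular the nontrivial ρ.
    τ≗id-impossible : ∀ {ρ v} → InGal ρ → ρ ζ ≡ ζ → ρ v ≢ v → ¬ (τ ≗L id)
    τ≗id-impossible {ρ} {v} ρ∈ ρζ≡ζ ρv≢v τ≗id =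
      ρv≢v (trans (proj₂ (τ-generates ρ ρ∈ ρζ≡ζ) v) (powers (proj₁ (τ-generates ρ ρ∈ ρζ≡ζ))))
      where
      powers : ∀ j → (τ ^ j) v ≡ v
      powers zero    = refl
      powers (suc j) = trans (τ≗id ((τ ^ j) v)) (powers j)

    σ≗id-impossible : ¬ (σ ≗L id)
    σ≗id-impossible = σ∉⟨τ⟩ 0

    σ≗τ-impossible : ∀ {ρ} → τ ≗L ρ → ¬ (σ ≗L ρ)
    σ≗τ-impossible τ≗ρ σ≗ρ = σ∉⟨τ⟩ 1 λ v → trans (σ≗ρ v) (sym (τ≗ρ v))

  -1≢1 : ℚ.- 1ℚ ≢ 1ℚ
  -1≢1 ()

  generators₁ : (S : NonClassical √m) → Generators ψ φ S
  generators₁ S = record { τ≗ρ = τ≗ψ (classify τ∈Gal) ; σ≗ = σ≗φ (classify σ∈Gal) ; ρ-involutive = ψ-involutive }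
    where
    open NonClassical S
    τ≗ψ : Automorphism τ → τ ≗L ψ
    τ≗ψ (is-id eq) = contradiction eq (τ≗id-impossible S {v = √n} ψ∈Gal refl λ e → -1≢1 (cong L.c√n e))
    τ≗ψ (is-φ eq)  = contradiction (cong L.c√m (trans (sym (eq √m)) τ-fixes-ζ)) -1≢1
    τ≗ψ (is-ψ eq)  = eq
    τ≗ψ (is-χ eq)  = contradiction (cong L.c√m (trans (sym (eq √m)) τ-fixes-ζ)) -1≢1
    σ≗φ : Automorphism σ → σ ≗L φ ⊎ σ ≗L φ ∘ ψ
    σ≗φ (is-id eq) = contradiction eq (σ≗id-impossible S)
    σ≗φ (is-φ eq)  = inj₁ eq
    σ≗φ (is-ψ eq)  = contradiction eq (σ≗τ-impossible S (τ≗ψ (classify τ∈Gal)))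
    σ≗φ (is-χ eq)  = inj₂ eq

  generators₂ : (S : NonClassical √n) → Generators φ ψ S
  generators₂ S = record { τ≗ρ = τ≗φ (classify τ∈Gal) ; σ≗ = σ≗ψ (classify σ∈Gal) ; ρ-involutive = φ-involutive }
    where
    open NonClassical S
    τ≗φ : Automorphism τ → τ ≗L φ
    τ≗φ (is-id eq) = contradiction eq (τ≗id-impossible S {v = √m} φ∈Gal refl λ e → -1≢1 (cong L.c√m e))
    τ≗φ (is-φ eq)  = eq
    τ≗φ (is-ψ eq)  = contradiction (cong L.c√n (trans (sym (eq √n)) τ-fixes-ζ)) -1≢1
    τ≗φ (is-χ eq)  = contradiction (cong L.c√n (trans (sym (eq √n)) τ-fixes-ζ)) -1≢1
    σ≗ψ : Automorphism σ → σ ≗L ψ ⊎ σ ≗L ψ ∘ φ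
    σ≗ψ (is-id eq) = contradiction eq (σ≗id-impossible S)
    σ≗ψ (is-φ eq)  = contradiction eq (σ≗τ-impossible S (τ≗φ (classify τ∈Gal)))
    σ≗ψ (is-ψ eq)  = inj₁ eq
    σ≗ψ (is-χ eq)  = inj₂ eq

  generators₃ : (S : NonClassical √k) → Generators χ ψ S
  generators₃ S = record { τ≗ρ = τ≗χ (classify τ∈Gal) ; σ≗ = σ≗ψ (classify σ∈Gal) ; ρ-involutive = χ-involutive }
    where
    open NonClassical S

    χ-involutive : ∀ v → χ (χ v) ≡ v
    χ-involutive v = trans (cong φ (cong φ (ψ-involutive v))) (φ-involutive v)

    χ√k≡√k : χ √k ≡ √k
    χ√k≡√k = trans (cong χ √k≡) (trans (⟨⟩-cong refl refl refl (Scaling.neg-involutive d⁻¹)) (sym √k≡))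

    d⁻¹≢0 : d⁻¹ ≢ 0ℚ
    d⁻¹≢0 d⁻¹≡0 = contradiction
      (trans (sym d⁻¹*d) (trans (cong (ℚ._* fromℤ d) d⁻¹≡0) (ℚₚ.*-zeroˡ (fromℤ d)))) λ ()

    not-fixed : ∀ {g} → τ ≗L g → g ⟨ 0ℚ , 0ℚ , 0ℚ , d⁻¹ ⟩ ≢ ⟨ 0ℚ , 0ℚ , 0ℚ , ℚ.- d⁻¹ ⟩
    not-fixed {g} eq moved = d⁻¹≢0 (Scaling.-b≡b⇒b≡0 (cong L.c√m√n
      (trans (sym moved) (trans (cong g (sym √k≡)) (trans (sym (eq √k)) (trans τ-fixes-ζ √k≡))))))

    τ≗χ : Automorphism τ → τ ≗L χ
    τ≗χ (is-id eq) = contradiction eq (τ≗id-impossible S {v = √n} χ∈Gal χ√k≡√k λ e → -1≢1 (cong L.c√n e))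
    τ≗χ (is-φ eq)  = contradiction refl (not-fixed eq)
    τ≗χ (is-ψ eq)  = contradiction refl (not-fixed eq)
    τ≗χ (is-χ eq)  = eq
    σ≗ψ : Automorphism σ → σ ≗L ψ ⊎ σ ≗L ψ ∘ χ
    σ≗ψ (is-id eq) = contradiction eq (σ≗id-impossible S)
    -- φ = ψχ, because the sign changes commute and ψ² = id.
    σ≗ψ (is-φ eq)  = inj₂ λ v → trans (eq v) (cong φ (sym (ψ-involutive v)))
    σ≗ψ (is-ψ eq)  = inj₁ eq
    σ≗ψ (is-χ eq)  = contradiction eq (σ≗τ-impossible S (τ≗χ (classify τ∈Gal)))

-- Generators of 𝒪, relative to a system of coordinates adapted to ζ.

module Core (m n : ℤ) (m-sf : SquareFree m) (n-sf : SquareFree n)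
  (m≡1 : m ≡ 1ℤ [mod + 4 ]) (n≡1 : n ≡ 1ℤ [mod + 4 ])
  (isField : Biquadratic.IsField m n m-sf n-sf) where
  open HopfAction m n m-sf n-sf m≡1 n≡1 isField public
  open ActionIdentities using (2ℚ)
  open CoreIdentities

  -- The three structures differ only in which root supplies X and which two supply Y and Z.
  -- Everything about freeness is proved over an arbitrary frame.
  record Frame : Set where
    field
      emb  : (A X Y Z : ℚ) → L
      surj : ∀ v → ∃₂ λ A X → ∃₂ λ Y Z → v ≡ emb A X Y Z
      inj  : ∀ {A X Y Z A′ X′ Y′ Z′} → emb A X Y Z ≡ emb A′ X′ Y′ Z′ → A ≡ A′ × X ≡ X′ × Y ≡ Y′ × Z ≡ Z′

    embℤ : (A X Y Z : ℤ) → L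
    embℤ A X Y Z = emb (fromℤ A) (fromℤ X) (fromℤ Y) (fromℤ Z)

    field
      integral⇒ : ∀ {v} → IsIntegral v → ∃₂ λ A X → ∃₂ λ Y Z → Admissible A X Y Z × v ≡ embℤ A X Y Z
      ⇒integral : ∀ {A X Y Z} → Admissible A X Y Z → IsIntegral (embℤ A X Y Z)

    record ActsBy (u w : ℤ) (h : L → L) (p q r s : ℚ) : Set where
      constructor actsBy
      field
        on-emb : ∀ A X Y Z → h (emb A X Y Z) ≡
          emb (p ℚ.* A) (q ℚ.* X) (r ℚ.* Y ℚ.- s ℚ.* fromℤ u ℚ.* Z) (r ℚ.* Z ℚ.+ s ℚ.* fromℤ w ℚ.* Y)

    open ActsBy public

    -- H is identified with ℚ × ℚ × ℚ[J], where J² = -uw. One direction reads coefficients off a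
    -- given element; the other builds the element with prescribed coefficients.
    record ActsThrough (u w : ℤ) {ζ} (S : NonClassical ζ) : Set where
      field
        InH⇒ : ∀ {h} → InH S h → ∃₂ λ p q → ∃₂ λ r s → ActsBy u w h p q r s
        ⇒InH : ∀ p q r s → ∃ λ h → InH S h × ActsBy u w h p q r s

  module FreeGenerators (F : Frame) {ζ : L} (S : NonClassical ζ) (υ μ : ℤ)
    (coprime : IsCoprime (IntegerAction.u υ μ) (IntegerAction.w υ μ))
    (acts : Frame.ActsThrough F (IntegerAction.u υ μ) (IntegerAction.w υ μ) S) where
    open IntegerAction υ μ
    open Frame F
    open ActsThrough acts

    emb-cong : ∀ {A X Y Z A′ X′ Y′ Z′} → A ≡ A′ → X ≡ X′ → Y ≡ Y′ → Z ≡ Z′ → emb A X Y Z ≡ emb A′ X′ Y′ Z′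
    emb-cong refl refl refl refl = refl

    plane₁-ℤ : ∀ r s Y Z → fromℤ (r * Y - s * u * Z)
      ≡ fromℤ r ℚ.* fromℤ Y ℚ.- fromℤ s ℚ.* fromℤ u ℚ.* fromℤ Z
    plane₁-ℤ r s Y Z = trans (fromℤ-- (r * Y) (s * u * Z)) (cong₂ ℚ._-_ (fromℤ-* r Y)
      (trans (fromℤ-* (s * u) Z) (cong (ℚ._* fromℤ Z) (fromℤ-* s u))))

    plane₂-ℤ : ∀ r s Y Z → fromℤ (r * Z + s * w * Y)
      ≡ fromℤ r ℚ.* fromℤ Z ℚ.+ fromℤ s ℚ.* fromℤ w ℚ.* fromℤ Y
    plane₂-ℤ r s Y Z = trans (fromℤ-+ (r * Z) (s * w * Y)) (cong₂ ℚ._+_ (fromℤ-* r Z)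
      (trans (fromℤ-* (s * w) Y) (cong (ℚ._* fromℤ Y) (fromℤ-* s w))))

    acts-ℤ : ∀ {h} p q r s → ActsBy u w h (fromℤ p) (fromℤ q) (fromℤ r) (fromℤ s) → ∀ A X Y Z →
      h (embℤ A X Y Z) ≡ embℤ (p * A) (q * X) (r * Y - s * u * Z) (r * Z + s * w * Y)
    acts-ℤ p q r s by A X Y Z = trans (on-emb by (fromℤ A) (fromℤ X) (fromℤ Y) (fromℤ Z))
      (emb-cong (sym (fromℤ-* p A)) (sym (fromℤ-* q X)) (sym (plane₁-ℤ r s Y Z)) (sym (plane₂-ℤ r s Y Z)))

    Image : (p q r s : ℚ) (A X Y Z : ℤ) → Set
    Image p q r s A X Y Z = ∃₂ λ A′ X′ → ∃₂ λ Y′ Z′ → Admissible A′ X′ Y′ Z′ ×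
      p ℚ.* fromℤ A ≡ fromℤ A′ × q ℚ.* fromℤ X ≡ fromℤ X′ ×
      r ℚ.* fromℤ Y ℚ.- s ℚ.* fromℤ u ℚ.* fromℤ Z ≡ fromℤ Y′ ×
      r ℚ.* fromℤ Z ℚ.+ s ℚ.* fromℤ w ℚ.* fromℤ Y ≡ fromℤ Z′

    image : ∀ (h : 𝔄 S) {p q r s} → ActsBy u w (𝔄.act h) p q r s → ∀ A X Y Z → Admissible A X Y Z →
      Image p q r s A X Y Z
    image h {p} {q} {r} {s} by A X Y Z adm =
      let A′ , X′ , Y′ , Z′ , adm′ , eq = integral⇒ (𝔄.preserves𝒪 h (embℤ A X Y Z) (⇒integral adm))
      in A′ , X′ , Y′ , Z′ , adm′ , inj (trans (sym (on-emb by (fromℤ A) (fromℤ X) (fromℤ Y) (fromℤ Z))) eq)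

    vanishes : ∀ {q z} → q ≡ fromℤ z → q ≡ 0ℚ → z ≡ 0ℤ
    vanishes q≡z q≡0 = fromℤ-injective (trans (sym q≡z) q≡0)

    half : ∀ {q z i} → q ℚ.* 2ℚ ≡ fromℤ z → z ≡ + 2 * i → IsInt q
    half {q} {i = i} eq refl = i , trans (sym (halve q)) (trans (cong (½ ℚ.*_) (trans eq (fromℤ-* (+ 2) i))) (halve′ (fromℤ i)))

    -- The images of 1 and of the three elements ½(1 + √·) suffice.
    order-integral : ∀ (h : 𝔄 S) {p q r s} → ActsBy u w (𝔄.act h) p q r s →
      IsInt p × IsInt q × IsInt r × IsInt s
    order-integral h {p} {q} {r} {s} by =
        p-int (image h by (+ 4) 0ℤ 0ℤ 0ℤ (admissible {i = 0ℤ} {0ℤ} {1ℤ} refl refl refl))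
      , q-int (image h by (+ 2) (+ 2) 0ℤ 0ℤ (admissible {i = -1ℤ} { -1ℤ} {0ℤ} refl refl refl))
      , proj₁ r,sw-int
      -- The plane only exhibits su and sw as integers; s itself is integral because u and w are
      -- coprime.
      , coprime-multipliers u w s coprime
          (subst IsInt (ℚₚ.*-comm s (fromℤ u)) (su-int (image h by (+ 2) 0ℤ 0ℤ (+ 2) (admissible {i = 0ℤ} {1ℤ} {0ℤ} refl refl refl))))
          (subst IsInt (ℚₚ.*-comm s (fromℤ w)) (proj₂ r,sw-int))
      where
      p-int : Image p q r s (+ 4) 0ℤ 0ℤ 0ℤ → IsInt p
      p-int (A′ , X′ , Y′ , Z′ , admissible {x = x} _ _ A≡ , eqA , eqX , eqY , eqZ) =
        x , trans (sym (quarter-of p)) (trans (cong (¼ ℚ.*_) (trans eqA (trans (cong fromℤ A′≡4x) (fromℤ-* (+ 4) x))))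
          (quarter-of′ (fromℤ x)))
        where
        A′≡4x : A′ ≡ + 4 * x
        A′≡4x = trans A≡ (trans (cong₂ (λ a b → a + b + + 4 * x)
          (cong₂ _+_ (vanishes eqX (ℚₚ.*-zeroʳ q)) (vanishes eqY (zero-plane₁ r (s ℚ.* fromℤ u))))
          (vanishes eqZ (zero-plane₂ r (s ℚ.* fromℤ w)))) (ℤₚ.+-identityˡ (+ 4 * x)))

      q-int : Image p q r s (+ 2) (+ 2) 0ℤ 0ℤ → IsInt q
      q-int (A′ , X′ , Y′ , Z′ , admissible {i} Y≡ _ _ , _ , eqX , eqY , _) = half eqX
        (trans (isolate X′ i) (trans (cong (λ y → y + + 2 * - i)
          (trans (sym Y≡) (vanishes eqY (zero-plane₁ r (s ℚ.* fromℤ u))))) (ℤₚ.+-identityˡ (+ 2 * - i))))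
        where
        isolate : ∀ X i → X ≡ X + + 2 * i + + 2 * - i
        isolate = ℤ-Solver.solve-∀

      even : ∀ {X Y i} → X ≡ 0ℤ → Y ≡ X + + 2 * i → Y ≡ + 2 * i
      even {i = i} refl Y≡ = trans Y≡ (ℤₚ.+-identityˡ (+ 2 * i))

      r,sw-int : IsInt r × IsInt (s ℚ.* fromℤ w)
      r,sw-int = go (image h by (+ 2) 0ℤ (+ 2) 0ℤ (admissible {i = 1ℤ} {0ℤ} {0ℤ} refl refl refl))
        where
        go : Image p q r s (+ 2) 0ℤ (+ 2) 0ℤ → IsInt r × IsInt (s ℚ.* fromℤ w)
        go (A′ , X′ , Y′ , Z′ , admissible Y≡ Z≡ _ , _ , eqX , eqY , eqZ) =
            half (trans (sym (only-first r (s ℚ.* fromℤ u))) eqY) (even (vanishes eqX (ℚₚ.*-zeroʳ q)) Y≡)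
          , half (trans (sym (only-second r (s ℚ.* fromℤ w))) eqZ) (even (vanishes eqX (ℚₚ.*-zeroʳ q)) Z≡)

      su-int : Image p q r s (+ 2) 0ℤ 0ℤ (+ 2) → IsInt (s ℚ.* fromℤ u)
      su-int (A′ , X′ , Y′ , Z′ , admissible Y≡ _ _ , _ , eqX , eqY , _) =
        subst IsInt (Scaling.neg-involutive (s ℚ.* fromℤ u)) (IsInt-neg
          (half (trans (sym (only-second⁻ r (s ℚ.* fromℤ u))) eqY) (even (vanishes eqX (ℚₚ.*-zeroʳ q)) Y≡)))

    free⇒norm≡±2 : Free S → ∃₂ λ Y Z → ±2 (norm Y Z)
    free⇒norm≡±2 (β , β∈𝒪 , _ , surjective) = go (integral⇒ β∈𝒪)
      where
      go : (∃₂ λ A X → ∃₂ λ Y Z → Admissible A X Y Z × β ≡ embℤ A X Y Z) → ∃₂ λ Y Z → ±2 (norm Y Z)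
      go (A , X , Y , Z , adm , β≡) = Y , Z , norm≡±2
        -- The targets are (1, 1, 1, -1), which makes X a unit, and (2, 0, 2, 0), (2, 0, 0, 2),
        -- which supply two right-hand sides on the plane. Their first coordinates meet the
        -- congruence A ≡ X + Y + Z mod 4.
        (reach (admissible {i = 0ℤ} { -1ℤ} {0ℤ} refl refl refl))
        (reach (admissible {i = 1ℤ} {0ℤ} {0ℤ} refl refl refl))
        (reach (admissible {i = 0ℤ} {1ℤ} {0ℤ} refl refl refl))
        where
        Reached : (A′ X′ Y′ Z′ : ℤ) → Set
        Reached A′ X′ Y′ Z′ = ∃₂ λ p q → ∃₂ λ r s → p * A ≡ A′ × q * X ≡ X′ ×
          r * Y - s * u * Z ≡ Y′ × r * Z + s * w * Y ≡ Z′

        reach : ∀ {A′ X′ Y′ Z′} → Admissible A′ X′ Y′ Z′ → Reached A′ X′ Y′ Z′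
        reach {A′} {X′} {Y′} {Z′} adm′ = by-integers
          (InH⇒ (𝔄.act∈H h))
          where
          preimage = surjective (embℤ A′ X′ Y′ Z′ , ⇒integral adm′)
          h = proj₁ preimage
          hβ≡ : 𝔄.act h (embℤ A X Y Z) ≡ embℤ A′ X′ Y′ Z′
          hβ≡ = trans (cong (𝔄.act h) (sym β≡)) (proj₂ preimage {h} λ _ → refl)

          by-integers : (∃₂ λ p q → ∃₂ λ r s → ActsBy u w (𝔄.act h) p q r s) → Reached A′ X′ Y′ Z′
          by-integers (p , q , r , s , by) = go′ (order-integral h by) by
            where
            go′ : ∀ {p q r s} → IsInt p × IsInt q × IsInt r × IsInt s → ActsBy u w (𝔄.act h) p q r s → Reached A′ X′ Y′ Z′
            go′ ((p , refl) , (q , refl) , (r , refl) , (s , refl)) by =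
              let a , b , c , e = inj (trans (sym (acts-ℤ p q r s by A X Y Z)) hβ≡)
              in p , q , r , s , fromℤ-injective a , fromℤ-injective b , fromℤ-injective c , fromℤ-injective e

        norm≡±2 : Reached 1ℤ 1ℤ 1ℤ -1ℤ → Reached (+ 2) 0ℤ (+ 2) 0ℤ → Reached (+ 2) 0ℤ 0ℤ (+ 2) → ±2 (norm Y Z)
        norm≡±2 (_ , q , _ , _ , _ , qX≡1 , _) (_ , _ , r , s , _ , _ , e₁ , e₂) (_ , _ , r′ , s′ , _ , _ , e₃ , e₄) =
          transitive⇒norm≡±2 adm q r s r′ s′ qX≡1 e₁ e₂ e₃ e₄

    -- Injectivity only uses that A, X and the determinant on the plane are invertible in ℚ.
    -- Surjectivity uses that the solution of the linear system is integral and satisfies the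
    -- congruences of the order.
    norm≡±2⇒generator : ∀ {A X Y Z} → Admissible A X Y Z → ±1 A → ±1 X → ±2 (norm Y Z) →
      IsGenerator S (embℤ A X Y Z)
    norm≡±2⇒generator {A} {X} {Y} {Z} adm A≡±1 X≡±1 D≡±2 =
      ⇒integral adm , (λ {h} {h′} → injective {h} {h′}) , surjective
      where
      β = embℤ A X Y Z
      D = fromℤ w ℚ.* (fromℤ Y ℚ.* fromℤ Y) ℚ.+ fromℤ u ℚ.* (fromℤ Z ℚ.* fromℤ Z)

      ±1-inverse : ∀ {z} → ±1 z → fromℤ z ℚ.* fromℤ z ≡ 1ℚ
      ±1-inverse (inj₁ refl) = refl
      ±1-inverse (inj₂ refl) = refl

      ±2-inverse : ∀ {z} → ±2 z → ∃ λ i → fromℤ z ℚ.* i ≡ 1ℚ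
      ±2-inverse (inj₁ refl) = ½ , refl
      ±2-inverse (inj₂ refl) = ℚ.- ½ , refl

      D≡ : fromℤ (norm Y Z) ≡ D
      D≡ = trans (fromℤ-+ (w * (Y * Y)) (u * (Z * Z))) (cong₂ ℚ._+_
        (trans (fromℤ-* w (Y * Y)) (cong (fromℤ w ℚ.*_) (fromℤ-* Y Y)))
        (trans (fromℤ-* u (Z * Z)) (cong (fromℤ u ℚ.*_) (fromℤ-* Z Z))))

      D⁻¹ : ∃ λ i → D ℚ.* i ≡ 1ℚ
      D⁻¹ = let i , eq = ±2-inverse D≡±2 in i , trans (cong (ℚ._* i) (sym D≡)) eq

      agree : ∀ {h h′ : L → L} {p q r s p′ q′ r′ s′} → ActsBy u w h p q r s → ActsBy u w h′ p′ q′ r′ s′ →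
        p ≡ p′ → q ≡ q′ → r ≡ r′ → s ≡ s′ → ∀ A X Y Z → h (emb A X Y Z) ≡ h′ (emb A X Y Z)
      agree by by′ refl refl refl refl A X Y Z = trans (on-emb by A X Y Z) (sym (on-emb by′ A X Y Z))

      injective : ∀ {h h′ : 𝔄 S} → 𝔄.act h β ≡ 𝔄.act h′ β → ∀ v → 𝔄.act h v ≡ 𝔄.act h′ v
      injective {h} {h′} hβ≡h′β v = compare (InH⇒ (𝔄.act∈H h)) (InH⇒ (𝔄.act∈H h′)) (surj v)
        where
        compare : (∃₂ λ p q → ∃₂ λ r s → ActsBy u w (𝔄.act h) p q r s) →
          (∃₂ λ p q → ∃₂ λ r s → ActsBy u w (𝔄.act h′) p q r s) →
          (∃₂ λ A X → ∃₂ λ Y Z → v ≡ emb A X Y Z) → 𝔄.act h v ≡ 𝔄.act h′ v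
        compare (p , q , r , s , by) (p′ , q′ , r′ , s′ , by′) (A₁ , X₁ , Y₁ , Z₁ , v≡) =
          trans (cong (𝔄.act h) v≡) (trans (agree by by′ p≡ q≡ r≡ s≡ A₁ X₁ Y₁ Z₁) (sym (cong (𝔄.act h′) v≡)))
          where
          coordinates = inj (trans (sym (on-emb by (fromℤ A) (fromℤ X) (fromℤ Y) (fromℤ Z)))
            (trans hβ≡h′β (on-emb by′ (fromℤ A) (fromℤ X) (fromℤ Y) (fromℤ Z))))
          e₁ = proj₁ (proj₂ (proj₂ coordinates))
          e₂ = proj₂ (proj₂ (proj₂ coordinates))
          p≡ : p ≡ p′
          p≡ = cancelʳ {p} {p′} {fromℤ A} {fromℤ A} (±1-inverse A≡±1) (proj₁ coordinates)
          q≡ : q ≡ q′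
          q≡ = cancelʳ {q} {q′} {fromℤ X} {fromℤ X} (±1-inverse X≡±1) (proj₁ (proj₂ coordinates))
          r≡ : r ≡ r′
          r≡ = cancelʳ {r} {r′} {D} {proj₁ D⁻¹} (proj₂ D⁻¹) (trans (recover-r r s (fromℤ u) (fromℤ w) (fromℤ Y) (fromℤ Z))
            (trans (cong₂ (λ a b → fromℤ w ℚ.* fromℤ Y ℚ.* a ℚ.+ fromℤ u ℚ.* fromℤ Z ℚ.* b) e₁ e₂)
              (sym (recover-r r′ s′ (fromℤ u) (fromℤ w) (fromℤ Y) (fromℤ Z)))))
          s≡ : s ≡ s′
          s≡ = cancelʳ {s} {s′} {D} {proj₁ D⁻¹} (proj₂ D⁻¹) (trans (recover-s r s (fromℤ u) (fromℤ w) (fromℤ Y) (fromℤ Z))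
            (trans (cong₂ (λ a b → fromℤ Y ℚ.* b ℚ.- fromℤ Z ℚ.* a) e₁ e₂)
              (sym (recover-s r′ s′ (fromℤ u) (fromℤ w) (fromℤ Y) (fromℤ Z)))))

      Preimage : L → Set
      Preimage v = ∃ λ (h : 𝔄 S) → 𝔄.act h β ≡ v

      preimage : ∀ {v} → (∃₂ λ A X → ∃₂ λ Y Z → Admissible A X Y Z × v ≡ embℤ A X Y Z) → Preimage v
      preimage (A′ , X′ , Y′ , Z′ , adm′ , v≡) = go (norm≡±2⇒transitive adm A≡±1 X≡±1 D≡±2 adm′)
        where
        go : (∃₂ λ p q → ∃₂ λ r s → InOrder p q r s × p * A ≡ A′ × q * X ≡ X′ ×
               r * Y - s * u * Z ≡ Y′ × r * Z + s * w * Y ≡ Z′) → Preimage _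
        go (p , q , r , s , in-order , refl , refl , refl , refl) = realise (⇒InH (fromℤ p) (fromℤ q) (fromℤ r) (fromℤ s))
          where
          realise : (∃ λ h → InH S h × ActsBy u w h (fromℤ p) (fromℤ q) (fromℤ r) (fromℤ s)) → Preimage _
          realise (h , h∈H , by) =
              record { act = h ; act∈H = h∈H ; preserves𝒪 = λ v v∈𝒪 → preserves (integral⇒ v∈𝒪) }
            , trans (acts-ℤ p q r s by A X Y Z) (sym v≡)
            where
            preserves : ∀ {v} → (∃₂ λ A X → ∃₂ λ Y Z → Admissible A X Y Z × v ≡ embℤ A X Y Z) → IsIntegral (h v)
            preserves (A₁ , X₁ , Y₁ , Z₁ , adm₁ , refl) =
              subst IsIntegral (sym (acts-ℤ p q r s by A₁ X₁ Y₁ Z₁)) (⇒integral (order-preserves in-order adm₁))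

      surjective : ∀ (v : 𝒪) → ∃ λ (h : 𝔄 S) → ∀ {h′ : 𝔄 S} → (∀ v → 𝔄.act h′ v ≡ 𝔄.act h v) → 𝔄.act h′ β ≡ proj₁ v
      surjective (v , v∈𝒪) = let h , hβ≡v = preimage (integral⇒ v∈𝒪) in h , λ h′≈h → trans (h′≈h β) hβ≡v

-- Admissibility is symmetric in X, Y, Z, which its parametrisation through X hides. This symmetry
-- lets one description of 𝒪 serve every frame.
admissible-swapXY : ∀ {A X Y Z} → Admissible A X Y Z → Admissible A Y X Z
admissible-swapXY {X = X} (admissible {i} {j} {x} refl refl refl) =
  admissible {i = - i} {j - i} {x} (eqY X i) (eqZ X i j) (eqA X i j x)
  where
  eqY : ∀ X i → X ≡ X + + 2 * i + + 2 * - i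
  eqY = ℤ-Solver.solve-∀
  eqZ : ∀ X i j → X + + 2 * j ≡ X + + 2 * i + + 2 * (j - i)
  eqZ = ℤ-Solver.solve-∀
  eqA : ∀ X i j x → X + (X + + 2 * i) + (X + + 2 * j) + + 4 * x
    ≡ X + + 2 * i + X + (X + + 2 * j) + + 4 * x
  eqA = ℤ-Solver.solve-∀

admissible-swapYZ : ∀ {A X Y Z} → Admissible A X Y Z → Admissible A X Z Y
admissible-swapYZ {X = X} (admissible {i} {j} {x} refl refl refl) = admissible refl refl (eqA X i j x)
  where
  eqA : ∀ X i j x → X + (X + + 2 * i) + (X + + 2 * j) + + 4 * x
    ≡ X + (X + + 2 * j) + (X + + 2 * i) + + 4 * x
  eqA = ℤ-Solver.solve-∀

admissible-swapXZ : ∀ {A X Y Z} → Admissible A X Y Z → Admissible A Z Y X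
admissible-swapXZ = admissible-swapYZ ∘ admissible-swapXY ∘ admissible-swapYZ

-- The frames of the three structures.

module Frames (m n : ℤ) (m-sf : SquareFree m) (n-sf : SquareFree n)
  (m≡1 : m ≡ 1ℤ [mod + 4 ]) (n≡1 : n ≡ 1ℤ [mod + 4 ])
  (isField : Biquadratic.IsField m n m-sf n-sf) where
  open Core m n m-sf n-sf m≡1 n≡1 isField public
  open ActionIdentities
  open EmbeddingIdentities hiding (2ℚ)
  open BasisIdentities using (4ℚ; quarter₄; quarter₄-d)
  open CoreIdentities using (cancelʳ)

  private
    M N D : ℚ
    M = fromℤ m
    N = fromℤ n
    D = fromℤ d

  δ : ℤ
  δ = proj₁ sign-of-d

  δ≡±1 : ±1 δ
  δ≡±1 = proj₁ (proj₂ sign-of-d)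

  δ²≡1 : δ * δ ≡ 1ℤ
  δ²≡1 = ±1⇒square δ≡±1

  Δ : ℚ
  Δ = fromℤ δ

  Δ²≡1 : Δ ℚ.* Δ ≡ 1ℚ
  Δ²≡1 = trans (sym (fromℤ-* δ δ)) (cong fromℤ δ²≡1)

  -- Since m/d ≡ d ≡ -δ mod 4, the coordinates (1, 1, m/d, δ) of 4γ₄ satisfy A ≡ X + Y + Z mod 4.
  -- This is where the sign δ is fixed.
  m/d+δ≡0 : ∃ λ ℓ → m/d + δ ≡ + 4 * ℓ
  m/d+δ≡0 = add m/d-mod4 (proj₂ (proj₂ sign-of-d))
    where
    add : (∃ λ μ → m/d ≡ d + + 4 * μ) → (∃ λ ν → d + δ ≡ + 4 * ν) → ∃ λ ℓ → m/d + δ ≡ + 4 * ℓ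
    add (μ , eq) (ν , eq′) = ν + μ , trans (cong (λ a → a + δ) eq)
      (trans (regroup d μ δ) (trans (cong (λ a → a + + 4 * μ) eq′) (collect ν μ)))
      where
      regroup : ∀ d μ δ → d + + 4 * μ + δ ≡ d + δ + + 4 * μ
      regroup = ℤ-Solver.solve-∀
      collect : ∀ ν μ → + 4 * ν + + 4 * μ ≡ + 4 * (ν + μ)
      collect = ℤ-Solver.solve-∀

  quarter-cong : ∀ {A B C E A′ B′ C′ E′} → A ≡ A′ → B ≡ B′ → C ≡ C′ → E ≡ E′ →
    quarter A B C E ≡ quarter A′ B′ C′ E′
  quarter-cong refl refl refl refl = refl

  quarter-injective : ∀ A B C E A′ B′ C′ E′ → quarter A B C E ≡ quarter A′ B′ C′ E′ →
    A ≡ A′ × B ≡ B′ × C ≡ C′ × E ≡ E′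
  quarter-injective A B C E A′ B′ C′ E′ eq =
      ¼-cancel A A′ (cong L.c₁ eq) , ¼-cancel B B′ (cong L.c√m eq) , ¼-cancel C C′ (cong L.c√n eq)
    , d⁻¹-cancel (¼-cancel (d⁻¹ ℚ.* E) (d⁻¹ ℚ.* E′) (cong L.c√m√n eq))
    where
    undo : ∀ A → 4ℚ ℚ.* (¼ ℚ.* A) ≡ A
    undo = solve-∀ ℚ-ring
    ¼-cancel : ∀ A A′ → ¼ ℚ.* A ≡ ¼ ℚ.* A′ → A ≡ A′
    ¼-cancel A A′ eq = trans (sym (undo A)) (trans (cong (4ℚ ℚ.*_) eq) (undo A′))
    d⁻¹-cancel : d⁻¹ ℚ.* E ≡ d⁻¹ ℚ.* E′ → E ≡ E′
    d⁻¹-cancel eq = cancelʳ {E} {E′} {d⁻¹} {D} d⁻¹*d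
      (trans (ℚₚ.*-comm E d⁻¹) (trans eq (ℚₚ.*-comm d⁻¹ E′)))

  quarter-surjective : ∀ v → ∃₂ λ A B → ∃₂ λ C E → v ≡ quarter A B C E
  quarter-surjective ⟨ a , b , c , e ⟩ = 4ℚ ℚ.* a , 4ℚ ℚ.* b , 4ℚ ℚ.* c , 4ℚ ℚ.* (D ℚ.* e) ,
    ⟨⟩-cong (quarter₄ a) (quarter₄ b) (quarter₄ c)
      (sym (trans (quarter₄-d d⁻¹ D e) (trans (cong (ℚ._* e) d⁻¹*d) (ℚₚ.*-identityˡ e))))

  Δ-cancel : ∀ E E′ → Δ ℚ.* E ≡ Δ ℚ.* E′ → E ≡ E′
  Δ-cancel E E′ eq = cancelʳ {E} {E′} {Δ} {Δ} Δ²≡1 (trans (ℚₚ.*-comm E Δ) (trans eq (ℚₚ.*-comm Δ E′)))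

  ΔΔ : ∀ E → E ≡ Δ ℚ.* (Δ ℚ.* E)
  ΔΔ E = sym (trans (sym (ℚₚ.*-assoc Δ Δ E)) (trans (cong (ℚ._* E) Δ²≡1) (ℚₚ.*-identityˡ E)))

  quarterℤ : (A B C E : ℤ) → L
  quarterℤ A B C E = quarter (fromℤ A) (fromℤ B) (fromℤ C) (Δ ℚ.* fromℤ E)

  span-quarterℤ : ∀ x₁ x₂ x₃ x₄ A B C E →
    A ≡ + 4 * x₁ + (+ 2 * x₂ + + 2 * x₃ + x₄) → B ≡ + 2 * x₂ + x₄ →
    C ≡ + 2 * x₃ + m/d * x₄ → δ * E ≡ x₄ →
    span (fromℤ x₁) (fromℤ x₂) (fromℤ x₃) (fromℤ x₄) ≡ quarterℤ A B C E
  span-quarterℤ x₁ x₂ x₃ x₄ A B C E A≡ B≡ C≡ E≡ = trans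
    (span≡quarter (fromℤ x₁) (fromℤ x₂) (fromℤ x₃) (fromℤ x₄))
    (quarter-cong
      (sym (trans (cong fromℤ A≡) (trans (fromℤ-+ (+ 4 * x₁) (+ 2 * x₂ + + 2 * x₃ + x₄)) (cong₂ ℚ._+_ (fromℤ-* (+ 4) x₁)
        (trans (fromℤ-+ (+ 2 * x₂ + + 2 * x₃) x₄) (cong (ℚ._+ fromℤ x₄)
          (trans (fromℤ-+ (+ 2 * x₂) (+ 2 * x₃)) (cong₂ ℚ._+_ (fromℤ-* (+ 2) x₂) (fromℤ-* (+ 2) x₃)))))))))
      (sym (trans (cong fromℤ B≡) (trans (fromℤ-+ (+ 2 * x₂) x₄) (cong (ℚ._+ fromℤ x₄) (fromℤ-* (+ 2) x₂)))))
      (sym (trans (cong fromℤ C≡) (trans (fromℤ-+ (+ 2 * x₃) (m/d * x₄)) (cong₂ ℚ._+_ (fromℤ-* (+ 2) x₃) (fromℤ-* m/d x₄)))))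
      (sym (trans (sym (fromℤ-* δ E)) (cong fromℤ E≡))))

  δ-odd : Odd δ
  δ-odd = ±1⇒odd δ≡±1

  δδ : ∀ x → δ * (δ * x) ≡ x
  δδ x = trans (sym (ℤₚ.*-assoc δ δ x)) (trans (cong (_* x) δ²≡1) (ℤₚ.*-identityˡ x))

  integral⇒quarterℤ : ∀ {v} → IsIntegral v →
    ∃₂ λ A B → ∃₂ λ C E → Admissible A B C E × v ≡ quarterℤ A B C E
  integral⇒quarterℤ {v} v∈𝒪 = from-span (ai⇒span (isIntegral⇒ai v∈𝒪))
    where
    -- The defect A - X - Y - Z is 4x₁ - (μ + δ)x₄, and μ + δ is a multiple of 4.
    admissible-coordinates : ∀ {μ δ} x₁ x₂ x₃ x₄ → Odd μ → Odd δ → (∃ λ ℓ → μ + δ ≡ + 4 * ℓ) →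
      Admissible (+ 4 * x₁ + (+ 2 * x₂ + + 2 * x₃ + x₄)) (+ 2 * x₂ + x₄)
                 (+ 2 * x₃ + μ * x₄) (δ * x₄)
    admissible-coordinates {μ} {δ} x₁ x₂ x₃ x₄ (h , μ≡) (e , δ≡) (ℓ , μ+δ≡) = admissible
      {i = x₃ - x₂ + h * x₄} {e * x₄ - x₂} {x₁ - ℓ * x₄}
      (trans (cong (λ μ → + 2 * x₃ + μ * x₄) μ≡) (eqY x₂ x₃ x₄ h))
      (trans (cong (_* x₄) δ≡) (eqZ x₂ x₄ e))
      (trans (eqA x₁ x₂ x₃ x₄ μ δ) (trans (cong (λ t → rest - t * x₄) μ+δ≡) (collect sum x₁ ℓ x₄)))
      where
      sum = + 2 * x₂ + x₄ + (+ 2 * x₃ + μ * x₄) + δ * x₄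
      rest = sum + + 4 * x₁
      eqY : ∀ x₂ x₃ x₄ h → + 2 * x₃ + (1ℤ + + 2 * h) * x₄
        ≡ + 2 * x₂ + x₄ + + 2 * (x₃ - x₂ + h * x₄)
      eqY = ℤ-Solver.solve-∀
      eqZ : ∀ x₂ x₄ e → (1ℤ + + 2 * e) * x₄ ≡ + 2 * x₂ + x₄ + + 2 * (e * x₄ - x₂)
      eqZ = ℤ-Solver.solve-∀
      eqA : ∀ x₁ x₂ x₃ x₄ μ δ → + 4 * x₁ + (+ 2 * x₂ + + 2 * x₃ + x₄)
        ≡ + 2 * x₂ + x₄ + (+ 2 * x₃ + μ * x₄) + δ * x₄ + + 4 * x₁ - (μ + δ) * x₄
      eqA = ℤ-Solver.solve-∀
      collect : ∀ s x₁ ℓ x₄ → s + + 4 * x₁ - + 4 * ℓ * x₄ ≡ s + + 4 * (x₁ - ℓ * x₄)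
      collect = ℤ-Solver.solve-∀

    from-span : (∃₂ λ x₁ x₂ → ∃₂ λ x₃ x₄ → v ≡ span (fromℤ x₁) (fromℤ x₂) (fromℤ x₃) (fromℤ x₄)) →
      ∃₂ λ A B → ∃₂ λ C E → Admissible A B C E × v ≡ quarterℤ A B C E
    from-span (x₁ , x₂ , x₃ , x₄ , v≡) =
        A , B , C , δ * x₄
      , admissible-coordinates x₁ x₂ x₃ x₄ m/d-odd δ-odd m/d+δ≡0
      , trans v≡ (span-quarterℤ x₁ x₂ x₃ x₄ A B C (δ * x₄) refl refl refl (δδ x₄))
      where
      A B C : ℤ
      A = + 4 * x₁ + (+ 2 * x₂ + + 2 * x₃ + x₄)
      B = + 2 * x₂ + x₄
      C = + 2 * x₃ + m/d * x₄

  quarterℤ⇒integral : ∀ {A B C E} → Admissible A B C E → IsIntegral (quarterℤ A B C E)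
  quarterℤ⇒integral adm = ai⇒isIntegral (integral adm m/d-odd δ-odd (proj₂ m/d+δ≡0))
    where
    integral : ∀ {A B C E ℓ} → Admissible A B C E → Odd m/d → Odd δ → m/d + δ ≡ + 4 * ℓ →
      AlmostIntegral (quarterℤ A B C E)
    integral {A} {B} {C} {E} {ℓ} (admissible {i} {j} {x} C≡ E≡ A≡) (h , μ≡) (e , δ≡) μ+δ≡ =
      subst AlmostIntegral (span-quarterℤ x₁ x₂ x₃ x₄ A B C E eqA′ eqB′ eqC′ refl) (ai-span x₁ x₂ x₃ x₄)
      where
      x₁ x₂ x₃ x₄ : ℤ
      -- The change of basis is inverted: x₄ is read off E, then x₂ and x₃ off B and C by means of δ
      -- = 1 + 2e and m/d = 1 + 2h.
      x₄ = δ * E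
      x₁ = x + ℓ * x₄
      x₂ = - (e * E) - j
      x₃ = i - j - (h + e + + 2 * (h * e)) * E

      B≡ : B ≡ E - + 2 * j
      B≡ = trans (ring B j) (cong (λ t → t - + 2 * j) (sym E≡))
        where
        ring : ∀ B j → B ≡ B + + 2 * j - + 2 * j
        ring = ℤ-Solver.solve-∀

      eqB′ : B ≡ + 2 * x₂ + x₄
      eqB′ = trans B≡ (trans (ring E j e) (cong (λ δ → + 2 * x₂ + δ * E) (sym δ≡)))
        where
        ring : ∀ E j e → E - + 2 * j ≡ + 2 * (- (e * E) - j) + (1ℤ + + 2 * e) * E
        ring = ℤ-Solver.solve-∀

      eqC′ : C ≡ + 2 * x₃ + m/d * x₄
      eqC′ = trans C≡ (trans (cong (λ B → B + + 2 * i) B≡)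
        (trans (ring E i j e h) (cong₂ (λ μ δ → + 2 * x₃ + μ * (δ * E)) (sym μ≡) (sym δ≡))))
        where
        ring : ∀ E i j e h → E - + 2 * j + + 2 * i
          ≡ + 2 * (i - j - (h + e + + 2 * (h * e)) * E)
            + (1ℤ + + 2 * h) * ((1ℤ + + 2 * e) * E)
        ring = ℤ-Solver.solve-∀

      eqA′ : A ≡ + 4 * x₁ + (+ 2 * x₂ + + 2 * x₃ + x₄)
      eqA′ = begin
        A ≡⟨ A≡ ⟩
        B + C + E + + 4 * x ≡⟨ cong₂ (λ B C → B + C + E + + 4 * x) eqB′ eqC′ ⟩
        b + c + E + + 4 * x ≡⟨ cong (λ E → b + c + E + + 4 * x) (sym (δδ E)) ⟩
        b + c + δ * x₄ + + 4 * x ≡⟨ ring₁ x x₂ x₃ x₄ m/d δ ⟩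
        + 4 * x + (m/d + δ) * x₄ + y ≡⟨ cong (λ t → + 4 * x + t * x₄ + y) μ+δ≡ ⟩
        + 4 * x + + 4 * ℓ * x₄ + y ≡⟨ ring₂ x ℓ x₄ y ⟩
        + 4 * (x + ℓ * x₄) + y ∎
        where
        open ≡-Reasoning
        b c y : ℤ
        b = + 2 * x₂ + x₄
        c = + 2 * x₃ + m/d * x₄
        y = + 2 * x₂ + + 2 * x₃ + x₄
        ring₁ : ∀ x x₂ x₃ x₄ μ δ → + 2 * x₂ + x₄ + (+ 2 * x₃ + μ * x₄) + δ * x₄ + + 4 * x
          ≡ + 4 * x + (μ + δ) * x₄ + (+ 2 * x₂ + + 2 * x₃ + x₄)
        ring₁ = ℤ-Solver.solve-∀
        ring₂ : ∀ x ℓ x₄ y → + 4 * x + + 4 * ℓ * x₄ + y ≡ + 4 * (x + ℓ * x₄) + y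
        ring₂ = ℤ-Solver.solve-∀

  -- X belongs to the root ζ, up to the sign δ for √k. The planes are (√n, δ√k), (√m, δ√k) and (√n,
  -- √m), ordered so that w is d up to sign in the first two and n/d in the third, as the right-hand
  -- sides of the equations demand.
  frame₁ frame₂ frame₃ : Frame
  frame₁ = record
    { emb  = λ A X Y Z → quarter A X Y (Δ ℚ.* Z)
    ; surj = λ v → let A , B , C , E , v≡ = quarter-surjective v in
        A , B , C , Δ ℚ.* E , trans v≡ (cong (quarter A B C) (ΔΔ E))
    ; inj  = λ {A} {X} {Y} {Z} {A′} {X′} {Y′} {Z′} eq →
        let a , b , c , e = quarter-injective A X Y (Δ ℚ.* Z) A′ X′ Y′ (Δ ℚ.* Z′) eq in a , b , c , Δ-cancel Z Z′ e
    ; integral⇒ = integral⇒quarterℤ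
    ; ⇒integral = quarterℤ⇒integral
    }
  frame₂ = record
    { emb  = λ A X Y Z → quarter A Y X (Δ ℚ.* Z)
    ; surj = λ v → let A , B , C , E , v≡ = quarter-surjective v in
        A , C , B , Δ ℚ.* E , trans v≡ (cong (quarter A B C) (ΔΔ E))
    ; inj  = λ {A} {X} {Y} {Z} {A′} {X′} {Y′} {Z′} eq →
        let a , b , c , e = quarter-injective A Y X (Δ ℚ.* Z) A′ Y′ X′ (Δ ℚ.* Z′) eq in a , c , b , Δ-cancel Z Z′ e
    ; integral⇒ = λ v∈𝒪 → let A , B , C , E , adm , v≡ = integral⇒quarterℤ v∈𝒪 in
        A , C , B , E , admissible-swapXY adm , v≡
    ; ⇒integral = λ adm → quarterℤ⇒integral (admissible-swapXY adm)
    }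
  frame₃ = record
    { emb  = λ A X Y Z → quarter A Z Y (Δ ℚ.* X)
    ; surj = λ v → let A , B , C , E , v≡ = quarter-surjective v in
        A , Δ ℚ.* E , C , B , trans v≡ (cong (quarter A B C) (ΔΔ E))
    ; inj  = λ {A} {X} {Y} {Z} {A′} {X′} {Y′} {Z′} eq →
        let a , b , c , e = quarter-injective A Z Y (Δ ℚ.* X) A′ Z′ Y′ (Δ ℚ.* X′) eq in a , Δ-cancel X X′ e , c , b
    ; integral⇒ = λ v∈𝒪 → let A , B , C , E , adm , v≡ = integral⇒quarterℤ v∈𝒪 in
        A , E , C , B , admissible-swapXZ adm , v≡
    ; ⇒integral = λ adm → quarterℤ⇒integral (admissible-swapXZ adm)
    }

  module _ (F : Frame) {ρ θ ζ} {S : NonClassical ζ} (G : Generators ρ θ S)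
    {u w : ℤ} (κ κ⁻¹ : ℚ) (κκ⁻¹≡1 : κ ℚ.* κ⁻¹ ≡ 1ℚ)
    (canonical-acts : ∀ a b c e → Frame.ActsBy F u w (Generators.canonical G a b c e)
      (a ℚ.+ b ℚ.+ 2ℚ ℚ.* c) (a ℚ.+ b ℚ.- 2ℚ ℚ.* c) (a ℚ.- b) (κ ℚ.* e)) where
    open Frame F
    open Generators G

    -- The passage from (a, b, c, e) to (p, q, r, s) is linear and invertible; κ is the ratio of s
    -- to e.
    acts-through : ActsThrough u w S
    acts-through = record
      { InH⇒ = λ h∈H → let a , b , c , e , h≗ = InH⇒canonical h∈H in
          a ℚ.+ b ℚ.+ 2ℚ ℚ.* c , a ℚ.+ b ℚ.- 2ℚ ℚ.* c , a ℚ.- b , κ ℚ.* e ,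
          actsBy λ A X Y Z → trans (h≗ (emb A X Y Z)) (on-emb (canonical-acts a b c e) A X Y Z)
      ; ⇒InH = λ p q r s →
          let a = ¼ ℚ.* (p ℚ.+ q) ℚ.+ ½ ℚ.* r
              b = ¼ ℚ.* (p ℚ.+ q) ℚ.- ½ ℚ.* r
              c = ¼ ℚ.* (p ℚ.- q)
              e = κ⁻¹ ℚ.* s
          in canonical a b c e , canonical∈H a b c e ,
             acts-subst (coefficient-p p q r) (coefficient-q p q r) (coefficient-r p q r)
               (trans (coefficient-s κ κ⁻¹ s) (trans (cong (ℚ._* s) κκ⁻¹≡1) (ℚₚ.*-identityˡ s)))
               (canonical-acts a b c e)
      }
      where
      acts-subst : ∀ {h p q r s p′ q′ r′ s′} → p ≡ p′ → q ≡ q′ → r ≡ r′ → s ≡ s′ →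
        ActsBy u w h p q r s → ActsBy u w h p′ q′ r′ s′
      acts-subst refl refl refl refl by = by

  plane₁-δ : ∀ {M u} → M ℚ.* (d⁻¹ ℚ.* Δ) ≡ u → ∀ r s Y Z →
    r ℚ.* (¼ ℚ.* Y) ℚ.- s ℚ.* (M ℚ.* (¼ ℚ.* (d⁻¹ ℚ.* (Δ ℚ.* Z)))) ≡ ¼ ℚ.* (r ℚ.* Y ℚ.- s ℚ.* u ℚ.* Z)
  plane₁-δ {M} refl r s Y Z = plane₁ r s Y M d⁻¹ Δ Z

  -- The second plane coordinate is read with respect to δ√k = (δ/d)√m√n, and w = δd undoes this
  -- factor.
  plane₂-δ : ∀ {w} → d⁻¹ ℚ.* Δ ℚ.* w ≡ 1ℚ → ∀ r s Y Z →
    r ℚ.* (¼ ℚ.* (d⁻¹ ℚ.* (Δ ℚ.* Z))) ℚ.+ s ℚ.* (¼ ℚ.* Y) ≡ ¼ ℚ.* (d⁻¹ ℚ.* (Δ ℚ.* (r ℚ.* Z ℚ.+ s ℚ.* w ℚ.* Y)))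
  plane₂-δ {w} eq r s Y Z = trans (plane₂-lhs r s Y d⁻¹ Δ Z)
    (trans (cong (λ t → ¼ ℚ.* (d⁻¹ ℚ.* (Δ ℚ.* (r ℚ.* Z)) ℚ.+ s ℚ.* t ℚ.* Y)) (sym eq)) (plane₂-rhs r s Y d⁻¹ Δ Z w))

  acts₁ : ∀ {u w} → M ℚ.* (d⁻¹ ℚ.* Δ) ≡ fromℤ u → d⁻¹ ℚ.* Δ ℚ.* fromℤ w ≡ 1ℚ →
    (S : NonClassical √m) → Frame.ActsThrough frame₁ u w S
  acts₁ {u} {w} u≡ w≡ S = acts-through frame₁ (generators₁ S) {u} {w} 2ℚ ½ refl λ a b c e →
    Frame.actsBy λ A X Y Z →
      let x = ¼ ℚ.* A ; y = ¼ ℚ.* X ; z = ¼ ℚ.* Y ; t = ¼ ℚ.* (d⁻¹ ℚ.* (Δ ℚ.* Z)) in ⟨⟩-cong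
        (trans (act₁-₁ M N a b c e x y z t) (line (a ℚ.+ b ℚ.+ 2ℚ ℚ.* c) A))
        (trans (act₁-₂ M N a b c e x y z t) (line (a ℚ.+ b ℚ.- 2ℚ ℚ.* c) X))
        (trans (act₁-₃ M N a b c e x y z t) (plane₁-δ {M} {fromℤ u} u≡ (a ℚ.- b) (2ℚ ℚ.* e) Y Z))
        (trans (act₁-₄ M N a b c e x y z t) (plane₂-δ {fromℤ w} w≡ (a ℚ.- b) (2ℚ ℚ.* e) Y Z))

  acts₂ : ∀ {u w} → N ℚ.* (d⁻¹ ℚ.* Δ) ≡ fromℤ u → d⁻¹ ℚ.* Δ ℚ.* fromℤ w ≡ 1ℚ →
    (S : NonClassical √n) → Frame.ActsThrough frame₂ u w S
  acts₂ {u} {w} u≡ w≡ S = acts-through frame₂ (generators₂ S) {u} {w} 2ℚ ½ refl λ a b c e →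
    Frame.actsBy λ A X Y Z →
      let x = ¼ ℚ.* A ; y = ¼ ℚ.* Y ; z = ¼ ℚ.* X ; t = ¼ ℚ.* (d⁻¹ ℚ.* (Δ ℚ.* Z)) in ⟨⟩-cong
        (trans (act₂-₁ M N a b c e x y z t) (line (a ℚ.+ b ℚ.+ 2ℚ ℚ.* c) A))
        (trans (act₂-₂ M N a b c e x y z t) (plane₁-δ {N} {fromℤ u} u≡ (a ℚ.- b) (2ℚ ℚ.* e) Y Z))
        (trans (act₂-₃ M N a b c e x y z t) (line (a ℚ.+ b ℚ.- 2ℚ ℚ.* c) X))
        (trans (act₂-₄ M N a b c e x y z t) (plane₂-δ {fromℤ w} w≡ (a ℚ.- b) (2ℚ ℚ.* e) Y Z))

  acts₃ : ∀ {u w} → M ℚ.* d⁻¹ ≡ fromℤ u → N ℚ.* d⁻¹ ≡ fromℤ w →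
    (S : NonClassical √k) → Frame.ActsThrough frame₃ u w S
  -- κ is negative because √n comes before √m in the plane; this order is what makes w equal to n/d
  -- and not m/d.
  acts₃ {u} {w} u≡ w≡ S = acts-through frame₃ (generators₃ S) {u} {w} (ℚ.- 2ℚ) (ℚ.- ½) refl λ a b c e →
    Frame.actsBy λ A X Y Z →
      let x = ¼ ℚ.* A ; y = ¼ ℚ.* Z ; z = ¼ ℚ.* Y ; t = ¼ ℚ.* (d⁻¹ ℚ.* (Δ ℚ.* X)) ; v = ⟨ x , y , z , t ⟩ in
      trans (cong (λ ζ → form ζ a b c e v (χ v) (ψ v) (ψ (χ v))) √k≡) (⟨⟩-cong
        (trans (act₃-₁ M N d⁻¹ a b c e x y z t) (line (a ℚ.+ b ℚ.+ 2ℚ ℚ.* c) A))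
        (trans (act₃-₂ M N d⁻¹ a b c e x y z t)
          (trans (cong (λ w → (a ℚ.- b) ℚ.* (¼ ℚ.* Z) ℚ.+ ℚ.- 2ℚ ℚ.* e ℚ.* (w ℚ.* (¼ ℚ.* Y))) w≡)
            (plane₃ (a ℚ.- b) (ℚ.- 2ℚ ℚ.* e) Y (fromℤ w) Z)))
        (trans (act₃-₃ M N d⁻¹ a b c e x y z t)
          (trans (cong (λ u → (a ℚ.- b) ℚ.* (¼ ℚ.* Y) ℚ.- ℚ.- 2ℚ ℚ.* e ℚ.* (u ℚ.* (¼ ℚ.* Z))) u≡)
            (plane₄ (a ℚ.- b) (ℚ.- 2ℚ ℚ.* e) Y (fromℤ u) Z)))
        (trans (act₃-₄ M N d⁻¹ a b c e x y z t) (line-√k (a ℚ.+ b ℚ.- 2ℚ ℚ.* c) d⁻¹ Δ X)))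

-- Residues, and solutions of the norm equations.

*-odd : ∀ {a b} → Odd a → Odd b → Odd (a * b)
*-odd (g , refl) (h , refl) = g + h + + 2 * (g * h) , ring g h
  where
  ring : ∀ g h → (1ℤ + + 2 * g) * (1ℤ + + 2 * h) ≡ 1ℤ + + 2 * (g + h + + 2 * (g * h))
  ring = ℤ-Solver.solve-∀

odd+even : ∀ {a b} → Odd a → Even b → Odd (a + b)
odd+even (g , refl) (h , refl) = g + h , ring g h
  where
  ring : ∀ g h → 1ℤ + + 2 * g + + 2 * h ≡ 1ℤ + + 2 * (g + h)
  ring = ℤ-Solver.solve-∀

*-even : ∀ a {b} → Even b → Even (a * b)
*-even a (h , refl) = a * h , ring a h
  where
  ring : ∀ a h → a * (+ 2 * h) ≡ + 2 * (a * h)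
  ring = ℤ-Solver.solve-∀

odd-difference : ∀ {a b} → Odd a → Odd b → ∃ λ i → b ≡ a + + 2 * i
odd-difference (g , refl) (h , refl) = h - g , ring g h
  where
  ring : ∀ g h → 1ℤ + + 2 * h ≡ 1ℤ + + 2 * g + + 2 * (h - g)
  ring = ℤ-Solver.solve-∀

odd-odd : ∀ {a b} → Odd a → Odd b → Even (a - b)
odd-odd (g , refl) (h , refl) = g - h , ring g h
  where
  ring : ∀ g h → 1ℤ + + 2 * g - (1ℤ + + 2 * h) ≡ + 2 * (g - h)
  ring = ℤ-Solver.solve-∀

±1-* : ∀ {δ} → ±1 δ → ∀ {t} → ±2 t → ±2 (δ * t)
±1-* (inj₁ refl) (inj₁ refl) = inj₁ refl
±1-* (inj₁ refl) (inj₂ refl) = inj₂ refl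
±1-* (inj₂ refl) (inj₁ refl) = inj₂ refl
±1-* (inj₂ refl) (inj₂ refl) = inj₁ refl

-- 1 - 2ε is the coordinate A of `β₁`, which has to be a unit.
residue-mod2 : ∀ z → ∃ λ (ε : Fin 2) → ±1 (1ℤ - + 2 * + toℕ ε) × ∃ λ t → z ≡ + toℕ ε + t * + 2
residue-mod2 z = [ (λ (h , eq) → zero , inj₁ refl , h , trans eq (ring₀ h))
                 , (λ (h , eq) → suc zero , inj₂ refl , h , trans eq (ring₁ h)) ]′ (even⊎odd z)
  where
  ring₀ : ∀ h → + 2 * h ≡ + 0 + h * + 2
  ring₀ = ℤ-Solver.solve-∀
  ring₁ : ∀ h → 1ℤ + + 2 * h ≡ + 1 + h * + 2
  ring₁ = ℤ-Solver.solve-∀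

-- An even number leaves only the residues 0 and 2, and these are the ones for which the coordinate
-- A = 1 - ε of `β₂` is a unit.
residue-mod4 : ∀ {z} → Even z → ∃ λ (ε : Fin 4) → ±1 (1ℤ - + toℕ ε) × ∃ λ t → z ≡ + toℕ ε + t * + 4
residue-mod4 (z , refl) = [ (λ (h , eq) → zero , inj₁ refl , h , trans (cong (+ 2 *_) eq) (ring₀ h))
                          , (λ (h , eq) → suc (suc zero) , inj₂ refl , h , trans (cong (+ 2 *_) eq) (ring₁ h)) ]′ (even⊎odd z)
  where
  ring₀ : ∀ h → + 2 * (+ 2 * h) ≡ + 0 + h * + 4
  ring₀ = ℤ-Solver.solve-∀
  ring₁ : ∀ h → + 2 * (1ℤ + + 2 * h) ≡ + 2 + h * + 4
  ring₁ = ℤ-Solver.solve-∀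

sign-mod4 : ∀ {z} → Odd z → ∃ λ ε → ±1 ε × ∃ λ t → z ≡ ε + t * + 4
sign-mod4 (z , refl) = [ (λ (h , eq) → 1ℤ , inj₁ refl , h , trans (cong (λ z → 1ℤ + + 2 * z) eq) (ring₀ h))
                       , (λ (h , eq) → -1ℤ , inj₂ refl , 1ℤ + h , trans (cong (λ z → 1ℤ + + 2 * z) eq) (ring₁ h)) ]′ (even⊎odd z)
  where
  ring₀ : ∀ h → 1ℤ + + 2 * (+ 2 * h) ≡ 1ℤ + h * + 4
  ring₀ = ℤ-Solver.solve-∀
  ring₁ : ∀ h → 1ℤ + + 2 * (1ℤ + + 2 * h) ≡ -1ℤ + (1ℤ + h) * + 4
  ring₁ = ℤ-Solver.solve-∀

-- With u and w odd, the norm is odd when exactly one of Y, Z is even and divisible by 4 when both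
-- are.
norm≡±2⇒odd : ∀ υ μ {Y Z} → ±2 (IntegerAction.norm υ μ Y Z) → Odd Y × Odd Z
norm≡±2⇒odd υ μ {Y} {Z} D≡±2 = go (even⊎odd Y) (even⊎odd Z) D≡±2
  where
  open IntegerAction υ μ

  ±2-even : ∀ {D} → ±2 D → Even D
  ±2-even (inj₁ refl) = 1ℤ , refl
  ±2-even (inj₂ refl) = -1ℤ , refl

  2∤1 : ∀ {k} → ¬ ±2 (+ 2 * (+ 2 * k))
  2∤1 {k} (inj₁ eq) = even≢odd (k , refl) (0ℤ , ℤₚ.*-cancelˡ-≡ (+ 2) (+ 2 * k) 1ℤ eq)
  2∤1 {k} (inj₂ eq) = even≢odd (k , refl) (-1ℤ , ℤₚ.*-cancelˡ-≡ (+ 2) (+ 2 * k) -1ℤ eq)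

  both-even : ∀ υ μ y z → (1ℤ + + 2 * υ + + 4 * μ) * (+ 2 * y * (+ 2 * y)) + (1ℤ + + 2 * υ) * (+ 2 * z * (+ 2 * z))
    ≡ + 2 * (+ 2 * ((1ℤ + + 2 * υ + + 4 * μ) * (y * y) + (1ℤ + + 2 * υ) * (z * z)))
  both-even = ℤ-Solver.solve-∀

  u-odd : Odd u
  u-odd = υ , refl

  w-odd : Odd w
  w-odd = υ + + 2 * μ , ring υ μ
    where
    ring : ∀ υ μ → 1ℤ + + 2 * υ + + 4 * μ ≡ 1ℤ + + 2 * (υ + + 2 * μ)
    ring = ℤ-Solver.solve-∀

  go : ∀ {Y Z} → Even Y ⊎ Odd Y → Even Z ⊎ Odd Z → ±2 (norm Y Z) → Odd Y × Odd Z
  go (inj₂ p) (inj₂ q) _ = p , q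
  go (inj₁ (y , refl)) (inj₁ (z , refl)) eq = contradiction (subst ±2 (both-even υ μ y z) eq) 2∤1
  go {Y} {Z} (inj₂ p) (inj₁ q) eq = contradiction (odd+even (*-odd w-odd (*-odd p p)) (*-even u (*-even Z q)))
    (even≢odd (±2-even eq))
  go {Y} {Z} (inj₁ p) (inj₂ q) eq = contradiction
    (subst Odd (ℤₚ.+-comm (u * (Z * Z)) (w * (Y * Y))) (odd+even (*-odd u-odd (*-odd q q)) (*-even w (*-even Y p))))
    (even≢odd (±2-even eq))

-- The common shape of the three equations, for (P, c) = (d, m), (d, n) and (n/d, k).
Equation : (P c x y : ℤ) → Set
Equation P c x y = x * x + c * (y * y) ≡ + 2 * P ⊎ x * x + c * (y * y) ≡ - (+ 2 * P)

-- As P is square-free, P ∣ x² forces P ∣ x.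
equation⇒norm : ∀ {P Q} → SquareFree P → ∀ x y → Equation P (Q * P) x y →
  ∃ λ Y → x ≡ Y * P × ±2 (P * (Y * Y) + Q * (y * y))
equation⇒norm {P} {Q} P-sf x y = [ solve (+ 2) (inj₁ refl) , solve (- + 2) (inj₂ refl) ∘ (λ eq → trans eq (ℤₚ.neg-distribˡ-* (+ 2) P)) ]′
  where
  instance _ = ℤ.≢-nonZero (squareFree⇒≢0 P-sf)

  solve : ∀ e → ±2 e → x * x + (Q * P) * (y * y) ≡ e * P →
    ∃ λ Y → x ≡ Y * P × ±2 (P * (Y * Y) + Q * (y * y))
  solve e e≡±2 eq = Y , x≡YP , subst ±2 (sym norm≡e) e≡±2
    where
    t : ℤ
    t = e - Q * (y * y)

    x²≡tP : x * x ≡ t * P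
    x²≡tP = trans (ring₁ (x * x) Q P (y * y)) (trans (cong (_- Q * P * (y * y)) eq) (ring₂ e Q P (y * y)))
      where
      ring₁ : ∀ X Q P y² → X ≡ X + Q * P * y² - Q * P * y²
      ring₁ = ℤ-Solver.solve-∀
      ring₂ : ∀ e Q P y² → e * P - Q * P * y² ≡ (e - Q * y²) * P
      ring₂ = ℤ-Solver.solve-∀

    Pq²≡t : ∀ {P q x t} i → P ℚ.* i ≡ 1ℚ → q ℚ.* P ≡ x → x ℚ.* x ≡ t ℚ.* P → P ℚ.* (q ℚ.* q) ≡ t
    Pq²≡t {P} {q} {x} {t} i Pi≡1 refl x²≡tP = CoreIdentities.cancelʳ {P ℚ.* (q ℚ.* q)} {t} {P} {i} Pi≡1
      (trans (ring P q) x²≡tP)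
      where
      ring : ∀ P q → P ℚ.* (q ℚ.* q) ℚ.* P ≡ q ℚ.* P ℚ.* (q ℚ.* P)
      ring = solve-∀ ℚ-ring

    -- x² = tP says that P(x/P)² = t is an integer, with P square-free.
    Y-int : IsInt (x ∕ P)
    Y-int = squareFree-multiplier P (x ∕ P) P-sf (t , Pq²≡t {fromℤ P} {x ∕ P} {fromℤ x} {fromℤ t} (ℚ.1/ fromℤ P)
      (ℚₚ.*-inverseʳ (fromℤ P)) (∕-* x P) (trans (sym (fromℤ-* x x)) (trans (cong fromℤ x²≡tP) (fromℤ-* t P))))

    Y : ℤ
    Y = proj₁ Y-int

    x≡YP : x ≡ Y * P
    x≡YP = fromℤ-injective (trans (sym (∕-* x P)) (trans (cong (ℚ._* fromℤ P) (proj₂ Y-int)) (sym (fromℤ-* Y P))))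

    norm≡e : P * (Y * Y) + Q * (y * y) ≡ e
    norm≡e = ℤₚ.*-cancelʳ-≡ _ _ P (trans (ring P Q Y y)
      (trans (cong (λ x → x * x + Q * P * (y * y)) (sym x≡YP)) eq))
      where
      ring : ∀ P Q Y y → (P * (Y * Y) + Q * (y * y)) * P ≡ Y * P * (Y * P) + Q * P * (y * y)
      ring = ℤ-Solver.solve-∀

norm⇒equation : ∀ {P Q Y y} → ±2 (P * (Y * Y) + Q * (y * y)) → Equation P (Q * P) (Y * P) y
norm⇒equation {P} {Q} {Y} {y} = [ (λ eq → inj₁ (scaled (+ 2) eq)) , (λ eq → inj₂ (trans (scaled (- + 2) eq) (sym (ℤₚ.neg-distribˡ-* (+ 2) P)))) ]′
  where
  scaled : ∀ e → P * (Y * Y) + Q * (y * y) ≡ e → Y * P * (Y * P) + Q * P * (y * y) ≡ e * P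
  scaled e refl = ring P Q Y y
    where
    ring : ∀ P Q Y y → Y * P * (Y * P) + Q * P * (y * y) ≡ (P * (Y * Y) + Q * (y * y)) * P
    ring = ℤ-Solver.solve-∀

2*∕ : ∀ a t b .{{_ : ℤ.NonZero b}} .{{_ : ℤ.NonZero (+ 2 * b)}} → a ≡ t * b →
  fromℤ (+ 2) ℚ.* (a ∕ (+ 2 * b)) ≡ fromℤ t
2*∕ a t b refl = CoreIdentities.cancelʳ {fromℤ (+ 2) ℚ.* q} {fromℤ t} {fromℤ b} {ℚ.1/ fromℤ b} (ℚₚ.*-inverseʳ (fromℤ b))
  (trans (ring (fromℤ (+ 2)) q (fromℤ b)) (trans (cong (q ℚ.*_) (sym (fromℤ-* (+ 2) b)))
    (trans (∕-* (t * b) (+ 2 * b)) (fromℤ-* t b))))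
  where
  q : ℚ
  q = (t * b) ∕ (+ 2 * b)
  ring : ∀ c q b → c ℚ.* q ℚ.* b ≡ q ℚ.* (c ℚ.* b)
  ring = solve-∀ ℚ-ring

-- Coordinates of the proposed generators.

module Cases (m n : ℤ) (m-sf : SquareFree m) (n-sf : SquareFree n)
  (m≡1 : m ≡ 1ℤ [mod + 4 ]) (n≡1 : n ≡ 1ℤ [mod + 4 ])
  (isField : Biquadratic.IsField m n m-sf n-sf) where
  open Frames m n m-sf n-sf m≡1 n≡1 isField public
  open ActionIdentities using (2ℚ)
  open BasisIdentities using (4ℚ)

  span≡quarterℤ : ∀ q₁ q₂ q₃ x₄ A B C E →
    4ℚ ℚ.* q₁ ℚ.+ (2ℚ ℚ.* q₂ ℚ.+ 2ℚ ℚ.* q₃ ℚ.+ fromℤ x₄) ≡ fromℤ A →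
    2ℚ ℚ.* q₂ ℚ.+ fromℤ x₄ ≡ fromℤ B →
    2ℚ ℚ.* q₃ ℚ.+ fromℤ m/d ℚ.* fromℤ x₄ ≡ fromℤ C →
    x₄ ≡ δ * E → span q₁ q₂ q₃ (fromℤ x₄) ≡ quarterℤ A B C E
  span≡quarterℤ q₁ q₂ q₃ x₄ A B C E A≡ B≡ C≡ E≡ = trans (span≡quarter q₁ q₂ q₃ (fromℤ x₄))
    (quarter-cong A≡ B≡ C≡ (trans (cong fromℤ E≡) (fromℤ-* δ E)))

  +-fromℤ : ∀ {q} x y z → q ≡ fromℤ x → x + y ≡ z → q ℚ.+ fromℤ y ≡ fromℤ z
  +-fromℤ x y z refl refl = sym (fromℤ-+ x y)

  +*-fromℤ : ∀ {q} x a y z → q ≡ fromℤ x → x + a * y ≡ z → q ℚ.+ fromℤ a ℚ.* fromℤ y ≡ fromℤ z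
  +*-fromℤ x a y z refl refl = trans (cong (fromℤ x ℚ.+_) (sym (fromℤ-* a y))) (sym (fromℤ-+ x (a * y)))

  four-fromℤ : ∀ {q₁ q₂ q₃} x y z t s → q₁ ≡ fromℤ x → q₂ ≡ fromℤ y → q₃ ≡ fromℤ z →
    x + (y + z + t) ≡ s → q₁ ℚ.+ (q₂ ℚ.+ q₃ ℚ.+ fromℤ t) ≡ fromℤ s
  four-fromℤ x y z t s refl refl refl refl = sym (trans (fromℤ-+ x (y + z + t))
    (cong (fromℤ x ℚ.+_) (trans (fromℤ-+ (y + z) t) (cong (ℚ._+ fromℤ t) (fromℤ-+ y z)))))

  2*∕2 : ∀ a → 2ℚ ℚ.* (a ∕ + 2) ≡ fromℤ a
  2*∕2 a = trans (ℚₚ.*-comm 2ℚ (a ∕ + 2)) (∕-* a (+ 2))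

  -- This explains the shape of the generators: the coordinate of ζ is made a unit (1 here and for
  -- `β₂`, δ for `β₃`), the plane carries a solution of the norm equation, and the coefficient of γ₁
  -- adjusts A to ±1 by means of ε.
  β₁≡ : ∀ x y ε Y → x ≡ Y * d → β₁ x y ε ≡ quarterℤ (1ℤ - + 2 * ε) 1ℤ Y (δ * y)
  β₁≡ x y ε Y x≡ = span≡quarterℤ (½ ℚ.* ((m * y - x) ∕ (+ 2 * d) ℚ.- fromℤ ε)) ((1ℤ - y) ∕ + 2)
    ((x - m * y) ∕ (+ 2 * d)) y (1ℤ - + 2 * ε) 1ℤ Y (δ * y)
    (four-fromℤ (m/d * y - Y - + 2 * ε) (1ℤ - y) (Y - m/d * y) y (1ℤ - + 2 * ε)
      first (2*∕2 (1ℤ - y)) third (ringA Y y m/d ε))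
    (+-fromℤ (1ℤ - y) y 1ℤ (2*∕2 (1ℤ - y)) (ringB y))
    (+*-fromℤ (Y - m/d * y) m/d y Y third (ringC Y (m/d * y)))
    (sym (δδ y))
    where
    third : 2ℚ ℚ.* ((x - m * y) ∕ (+ 2 * d)) ≡ fromℤ (Y - m/d * y)
    third = 2*∕ (x - m * y) (Y - m/d * y) d
      (trans (cong₂ (λ x m → x - m * y) x≡ m≡) (ring Y d m/d y))
      where
      ring : ∀ Y d μ y → Y * d - μ * d * y ≡ (Y - μ * y) * d
      ring = ℤ-Solver.solve-∀
    half-first : 2ℚ ℚ.* ((m * y - x) ∕ (+ 2 * d)) ≡ fromℤ (m/d * y - Y)
    half-first = 2*∕ (m * y - x) (m/d * y - Y) d
      (trans (cong₂ (λ x m → m * y - x) x≡ m≡) (ring Y d m/d y))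
      where
      ring : ∀ Y d μ y → μ * d * y - Y * d ≡ (μ * y - Y) * d
      ring = ℤ-Solver.solve-∀
    first : 4ℚ ℚ.* (½ ℚ.* ((m * y - x) ∕ (+ 2 * d) ℚ.- fromℤ ε)) ≡ fromℤ (m/d * y - Y - + 2 * ε)
    first = trans (ring ((m * y - x) ∕ (+ 2 * d)) (fromℤ ε)) (trans
      (cong₂ ℚ._-_ half-first (sym (fromℤ-* (+ 2) ε))) (sym (fromℤ-- (m/d * y - Y) (+ 2 * ε))))
      where
      ring : ∀ q e → 4ℚ ℚ.* (½ ℚ.* (q ℚ.- e)) ≡ 2ℚ ℚ.* q ℚ.- 2ℚ ℚ.* e
      ring = solve-∀ ℚ-ring
    ringA : ∀ Y y μ ε → μ * y - Y - + 2 * ε + (1ℤ - y + (Y - μ * y) + y) ≡ 1ℤ - + 2 * ε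
    ringA = ℤ-Solver.solve-∀
    ringB : ∀ y → 1ℤ - y + y ≡ 1ℤ
    ringB = ℤ-Solver.solve-∀
    ringC : ∀ Y z → Y - z + z ≡ Y
    ringC = ℤ-Solver.solve-∀

  my-x∕d : ∀ x y Y → x ≡ Y * d → (m * y - x) ∕ d ≡ fromℤ (m/d * y - Y)
  my-x∕d x y Y x≡ = ∕-exact (m * y - x) d (m/d * y - Y)
    (trans (cong₂ (λ x m → m * y - x) x≡ m≡) (ring Y d m/d y))
    where
    ring : ∀ Y d μ y → μ * d * y - Y * d ≡ (μ * y - Y) * d
    ring = ℤ-Solver.solve-∀

  k-x∕n/d-y : ∀ x y Y → x ≡ Y * n/d → (k - x) ∕ n/d ℚ.- fromℤ y ≡ fromℤ (m/d - Y - y)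
  k-x∕n/d-y x y Y x≡ = trans (cong (ℚ._- fromℤ y) (∕-exact (k - x) n/d (m/d - Y)
    (trans (cong₂ _-_ k≡ x≡) (ring Y n/d m/d)))) (sym (fromℤ-- (m/d - Y) y))
    where
    ring : ∀ Y ν μ → μ * ν - Y * ν ≡ (μ - Y) * ν
    ring = ℤ-Solver.solve-∀

  β₂≡ : ∀ x y ε Y → x ≡ Y * d → β₂ x y ε ≡ quarterℤ (1ℤ - ε) Y 1ℤ (δ * y)
  β₂≡ x y ε Y x≡ = span≡quarterℤ ((1ℤ ∕ + 4) ℚ.* ((m * y - x) ∕ d ℚ.- fromℤ ε)) ((x - y * d) ∕ (+ 2 * d))
    ((d - m * y) ∕ (+ 2 * d)) y (1ℤ - ε) Y 1ℤ (δ * y)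
    (four-fromℤ (m/d * y - Y - ε) (Y - y) (1ℤ - m/d * y) y (1ℤ - ε)
      first second third (ringA Y y m/d ε))
    (+-fromℤ (Y - y) y Y second (ringC Y y))
    (+*-fromℤ (1ℤ - m/d * y) m/d y 1ℤ third (ringC 1ℤ (m/d * y)))
    (sym (δδ y))
    where
    second : 2ℚ ℚ.* ((x - y * d) ∕ (+ 2 * d)) ≡ fromℤ (Y - y)
    second = 2*∕ (x - y * d) (Y - y) d (trans (cong (λ x → x - y * d) x≡) (ring Y d y))
      where
      ring : ∀ Y d y → Y * d - y * d ≡ (Y - y) * d
      ring = ℤ-Solver.solve-∀
    third : 2ℚ ℚ.* ((d - m * y) ∕ (+ 2 * d)) ≡ fromℤ (1ℤ - m/d * y)
    third = 2*∕ (d - m * y) (1ℤ - m/d * y) d (trans (cong (λ m → d - m * y) m≡) (ring d m/d y))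
      where
      ring : ∀ d μ y → d - μ * d * y ≡ (1ℤ - μ * y) * d
      ring = ℤ-Solver.solve-∀
    quotient₂ : (m * y - x) ∕ d ≡ fromℤ (m/d * y - Y)
    quotient₂ = my-x∕d x y Y x≡
    first : 4ℚ ℚ.* ((1ℤ ∕ + 4) ℚ.* ((m * y - x) ∕ d ℚ.- fromℤ ε)) ≡ fromℤ (m/d * y - Y - ε)
    first = trans (ring ((m * y - x) ∕ d) (fromℤ ε)) (trans
      (cong (ℚ._- fromℤ ε) quotient₂) (sym (fromℤ-- (m/d * y - Y) ε)))
      where
      ring : ∀ q e → 4ℚ ℚ.* ((1ℤ ∕ + 4) ℚ.* (q ℚ.- e)) ≡ q ℚ.- e
      ring = solve-∀ ℚ-ring
    ringA : ∀ Y y μ ε → μ * y - Y - ε + (Y - y + (1ℤ - μ * y) + y) ≡ 1ℤ - ε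
    ringA = ℤ-Solver.solve-∀
    ringC : ∀ Y z → Y - z + z ≡ Y
    ringC = ℤ-Solver.solve-∀

  β₃≡ : ∀ x y ε Y → x ≡ Y * n/d → β₃ x y ε ≡ quarterℤ ε y Y δ
  β₃≡ x y ε Y x≡ = trans (cong (λ v → q₁ · γ₁ ⊕ q₂ · γ₂ ⊕ q₃ · γ₃ ⊕ v) (sym (1· γ₄)))
    (span≡quarterℤ q₁ q₂ q₃ 1ℤ ε y Y δ
      (four-fromℤ (m/d - Y - y + ε) (y - 1ℤ) (Y - m/d) 1ℤ ε
        first (2*∕2 (y - 1ℤ)) third (ringA Y y m/d ε))
      (+-fromℤ (y - 1ℤ) 1ℤ y (2*∕2 (y - 1ℤ)) (ringB y))
      (+*-fromℤ (Y - m/d) m/d 1ℤ Y third (ringC Y m/d))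
      (sym δ²≡1))
    where
    q₁ q₂ q₃ : ℚ
    q₁ = (1ℤ ∕ + 4) ℚ.* ((k - x) ∕ n/d ℚ.- fromℤ y ℚ.+ fromℤ ε)
    q₂ = (y - 1ℤ) ∕ + 2
    q₃ = (x - k) ∕ (+ 2 * n/d)
    1· : ∀ v → 1ℚ · v ≡ v
    1· ⟨ a , b , c , e ⟩ = ⟨⟩-cong (ℚₚ.*-identityˡ a) (ℚₚ.*-identityˡ b) (ℚₚ.*-identityˡ c) (ℚₚ.*-identityˡ e)
    third : 2ℚ ℚ.* q₃ ≡ fromℤ (Y - m/d)
    third = 2*∕ (x - k) (Y - m/d) n/d (trans (cong₂ _-_ x≡ k≡) (ring Y n/d m/d))
      where
      ring : ∀ Y ν μ → Y * ν - μ * ν ≡ (Y - μ) * ν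
      ring = ℤ-Solver.solve-∀
    first : 4ℚ ℚ.* q₁ ≡ fromℤ (m/d - Y - y + ε)
    first = trans (ring ((k - x) ∕ n/d ℚ.- fromℤ y) (fromℤ ε)) (trans
      (cong (ℚ._+ fromℤ ε) (k-x∕n/d-y x y Y x≡)) (sym (fromℤ-+ (m/d - Y - y) ε)))
      where
      ring : ∀ q e → 4ℚ ℚ.* ((1ℤ ∕ + 4) ℚ.* (q ℚ.+ e)) ≡ q ℚ.+ e
      ring = solve-∀ ℚ-ring
    ringA : ∀ Y y μ ε → μ - Y - y + ε + (y - 1ℤ + (Y - μ) + 1ℤ) ≡ ε
    ringA = ℤ-Solver.solve-∀
    ringB : ∀ y → y - 1ℤ + 1ℤ ≡ y
    ringB = ℤ-Solver.solve-∀
    ringC : ∀ Y z → Y - z + z * 1ℤ ≡ Y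
    ringC = ℤ-Solver.solve-∀

IsCoprime-unitˡ : ∀ {δ a b} → δ * δ ≡ 1ℤ → IsCoprime a b → IsCoprime (δ * a) (δ * b)
IsCoprime-unitˡ {δ} {a} {b} δ²≡1 c g (divides p δa≡) (divides q δb≡) =
  c g (divides (δ * p) (strip a p δa≡)) (divides (δ * q) (strip b q δb≡))
  where
  strip : ∀ a p → δ * a ≡ p * g → a ≡ δ * p * g
  strip a p eq = trans (sym (trans (sym (ℤₚ.*-assoc δ δ a)) (trans (cong (_* a) δ²≡1) (ℤₚ.*-identityˡ a))))
    (trans (cong (δ *_) eq) (sym (ℤₚ.*-assoc δ p g)))

-- The choice of ε gives 2ε ≡ Y - μy ≡ Y + δy mod 4. As Y and δy are odd, Y + δy is even, so 1 - (Y
-- + δy) ≡ 1 + (Y + δy) mod 4.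
admissible₁ : ∀ ε t Y y δ μ ℓ → Y ≡ μ * y + + 2 * (ε + t * + 2) → Odd Y → Odd (δ * y) →
  μ + δ ≡ + 4 * ℓ → Admissible (1ℤ - + 2 * ε) 1ℤ Y (δ * y)
admissible₁ ε t Y y δ μ ℓ Y≡ (a , Y≡1+2a) (b , δy≡1+2b) μ+δ≡ = admissible {i = a} {b}
  {t + ℓ * y - 1ℤ - a - b} Y≡1+2a δy≡1+2b (begin
    1ℤ - + 2 * ε ≡⟨ ring₁ ε t (μ * y) (δ * y) ⟩
    1ℤ + (Y′ + δ * y) - + 2 * (Y′ + δ * y) + s
      ≡⟨ cong (λ Y → 1ℤ + (Y + δ * y) - + 2 * (Y + δ * y) + s) (sym Y≡) ⟩
    1ℤ + (Y + δ * y) - + 2 * (Y + δ * y) + s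
      ≡⟨ cong₂ (λ Y Z → 1ℤ + (Y₀ + Z₀) - + 2 * (Y + Z) + s) Y≡1+2a δy≡1+2b ⟩
    1ℤ + (Y + δ * y) - + 2 * (1ℤ + + 2 * a + (1ℤ + + 2 * b)) + s
      ≡⟨ cong (λ s → 1ℤ + (Y + δ * y) - + 2 * (1ℤ + + 2 * a + (1ℤ + + 2 * b)) + s) s≡ ⟩
    1ℤ + (Y + δ * y) - + 2 * (1ℤ + + 2 * a + (1ℤ + + 2 * b)) + (+ 4 * ℓ * y + + 4 * t)
      ≡⟨ ring₃ Y (δ * y) a b (ℓ * y) t ℓ y ⟩
    1ℤ + Y + δ * y + + 4 * (t + ℓ * y - 1ℤ - a - b) ∎)
  where
  open ≡-Reasoning
  Y′ Y₀ Z₀ s : ℤ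
  Y′ = μ * y + + 2 * (ε + t * + 2)
  Y₀ = Y
  Z₀ = δ * y
  s = μ * y + δ * y + + 4 * t
  s≡ : s ≡ + 4 * ℓ * y + + 4 * t
  s≡ = cong (_+ + 4 * t) (trans (sym (ℤₚ.*-distribʳ-+ y μ δ)) (cong (_* y) μ+δ≡))
  ring₁ : ∀ ε t μy δy → 1ℤ - + 2 * ε ≡
    1ℤ + (μy + + 2 * (ε + t * + 2) + δy) - + 2 * (μy + + 2 * (ε + t * + 2) + δy)
    + (μy + δy + + 4 * t)
  ring₁ = ℤ-Solver.solve-∀
  ring₃ : ∀ Y δy a b ℓy t ℓ y → 1ℤ + (Y + δy) - + 2 * (1ℤ + + 2 * a + (1ℤ + + 2 * b)) + (+ 4 * ℓ * y + + 4 * t)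
    ≡ 1ℤ + Y + δy + + 4 * (t + ℓ * y - 1ℤ - a - b)
  ring₃ = ℤ-Solver.solve-∀

-- Here ε ≡ μy - Y ≡ -δy - Y mod 4, whence 1 - ε ≡ 1 + Y + δy directly.
admissible₂ : ∀ ε t Y y δ μ ℓ → μ * y - Y ≡ ε + t * + 4 → Odd Y → Odd (δ * y) →
  μ + δ ≡ + 4 * ℓ → Admissible (1ℤ - ε) 1ℤ Y (δ * y)
admissible₂ ε t Y y δ μ ℓ eq (a , Y≡1+2a) (b , δy≡1+2b) μ+δ≡ = admissible {i = a} {b}
  {t - ℓ * y} Y≡1+2a δy≡1+2b (begin
    1ℤ - ε ≡⟨ ring₁ ε t ⟩
    1ℤ - (ε + t * + 4) + + 4 * t ≡⟨ cong (λ r → 1ℤ - r + + 4 * t) (sym eq) ⟩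
    1ℤ - (μ * y - Y) + + 4 * t ≡⟨ ring₂ Y y μ δ t ⟩
    1ℤ + Y + δ * y + (+ 4 * t - (μ + δ) * y) ≡⟨ cong (λ r → 1ℤ + Y + δ * y + (+ 4 * t - r * y)) μ+δ≡ ⟩
    1ℤ + Y + δ * y + (+ 4 * t - + 4 * ℓ * y) ≡⟨ cong (λ r → 1ℤ + Y + δ * y + r) (ring₃ t ℓ y) ⟩
    1ℤ + Y + δ * y + + 4 * (t - ℓ * y) ∎)
  where
  open ≡-Reasoning
  ring₁ : ∀ ε t → 1ℤ - ε ≡ 1ℤ - (ε + t * + 4) + + 4 * t
  ring₁ = ℤ-Solver.solve-∀
  ring₂ : ∀ Y y μ δ t → 1ℤ - (μ * y - Y) + + 4 * t ≡ 1ℤ + Y + δ * y + (+ 4 * t - (μ + δ) * y)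
  ring₂ = ℤ-Solver.solve-∀
  ring₃ : ∀ t ℓ y → + 4 * t - + 4 * ℓ * y ≡ + 4 * (t - ℓ * y)
  ring₃ = ℤ-Solver.solve-∀

-- Here ε ≡ Y + y - μ ≡ Y + y + δ mod 4, the sum of the other three coordinates.
admissible₃ : ∀ ε t Y y δ μ ℓ → - (μ - Y - y) ≡ ε + t * + 4 → μ + δ ≡ + 4 * ℓ →
  (∃ λ i → Y ≡ δ + + 2 * i) → (∃ λ j → y ≡ δ + + 2 * j) → Admissible ε δ Y y
admissible₃ ε t Y y δ μ ℓ eq μ+δ≡ (_ , Y≡) (_ , y≡) = admissible {x = - (ℓ + t)} Y≡ y≡ (begin
    ε ≡⟨ ring₁ ε t ⟩
    ε + t * + 4 - + 4 * t ≡⟨ cong (λ r → r - + 4 * t) (sym eq) ⟩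
    - (μ - Y - y) - + 4 * t ≡⟨ ring₂ Y y μ δ t ⟩
    δ + Y + y - (μ + δ) - + 4 * t ≡⟨ cong (λ r → δ + Y + y - r - + 4 * t) μ+δ≡ ⟩
    δ + Y + y - + 4 * ℓ - + 4 * t ≡⟨ ring₃ (δ + Y + y) ℓ t ⟩
    δ + Y + y + + 4 * - (ℓ + t) ∎)
  where
  open ≡-Reasoning
  ring₁ : ∀ ε t → ε ≡ ε + t * + 4 - + 4 * t
  ring₁ = ℤ-Solver.solve-∀
  ring₂ : ∀ Y y μ δ t → - (μ - Y - y) - + 4 * t ≡ δ + Y + y - (μ + δ) - + 4 * t
  ring₂ = ℤ-Solver.solve-∀
  ring₃ : ∀ s ℓ t → s - + 4 * ℓ - + 4 * t ≡ s + + 4 * - (ℓ + t)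
  ring₃ = ℤ-Solver.solve-∀

-- The criterion and the generator for each structure.

module Conclusion (m n : ℤ) (m-sf : SquareFree m) (n-sf : SquareFree n)
  (m≡1 : m ≡ 1ℤ [mod + 4 ]) (n≡1 : n ≡ 1ℤ [mod + 4 ])
  (isField : Biquadratic.IsField m n m-sf n-sf) where
  open Cases m n m-sf n-sf m≡1 n≡1 isField public

  private
    M N D : ℚ
    M = fromℤ m
    N = fromℤ n
    D = fromℤ d

  -- For Hᵢ with i = 1, 2 the plane is spanned by the other given root and δ√k.
  module Twisted (c : ℤ) (c-odd : Odd c) (c-mod4 : ∃ λ μ → c ≡ d + + 4 * μ) (c-coprime : IsCoprime c d) where

    υ μ : ℤ
    υ = proj₁ (*-odd δ-odd c-odd)
    -- Chosen so that w becomes δd: c = d + 4ν gives δc - 4δν = δd.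
    μ = - (δ * proj₁ c-mod4)

    open IntegerAction υ μ public

    u≡ : u ≡ δ * c
    u≡ = sym (proj₂ (*-odd δ-odd c-odd))

    w≡ : w ≡ δ * d
    w≡ = trans (cong (λ t → t + + 4 * μ) (trans u≡ (cong (δ *_) (proj₂ c-mod4)))) (ring δ d (proj₁ c-mod4))
      where
      ring : ∀ δ d ν → δ * (d + + 4 * ν) + + 4 * - (δ * ν) ≡ δ * d
      ring = ℤ-Solver.solve-∀

    coprime : IsCoprime u w
    coprime = subst₂ IsCoprime (sym u≡) (sym w≡) (IsCoprime-unitˡ {δ} {c} {d} δ²≡1 c-coprime)

    rational-u : ∀ R → R ℚ.* d⁻¹ ≡ fromℤ c → R ℚ.* (d⁻¹ ℚ.* Δ) ≡ fromℤ u
    rational-u R eq = trans (sym (ℚₚ.*-assoc R d⁻¹ Δ)) (trans (cong (ℚ._* Δ) eq)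
      (trans (sym (fromℤ-* c δ)) (cong fromℤ (trans (ℤₚ.*-comm c δ) (sym u≡)))))

    rational-w : d⁻¹ ℚ.* Δ ℚ.* fromℤ w ≡ 1ℚ
    rational-w = trans (cong (d⁻¹ ℚ.* Δ ℚ.*_) (trans (cong fromℤ w≡) (fromℤ-* δ d)))
      (trans (ring d⁻¹ Δ D) (trans (cong₂ ℚ._*_ d⁻¹*d Δ²≡1) refl))
      where
      ring : ∀ i Δ D → i ℚ.* Δ ℚ.* (Δ ℚ.* D) ≡ i ℚ.* D ℚ.* (Δ ℚ.* Δ)
      ring = solve-∀ ℚ-ring

    norm≡ : ∀ Y Z → norm Y Z ≡ δ * (d * (Y * Y) + c * (Z * Z))
    norm≡ Y Z = trans (cong₂ (λ w u → w * (Y * Y) + u * (Z * Z)) w≡ u≡) (ring δ d c (Y * Y) (Z * Z))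
      where
      ring : ∀ δ d c y z → δ * d * y + δ * c * z ≡ δ * (d * y + c * z)
      ring = ℤ-Solver.solve-∀

    -- The factor δ merely exchanges the two signs on the right-hand side of the equation.
    norm⇒form : ∀ Y Z → ±2 (norm Y Z) → ±2 (d * (Y * Y) + c * (Z * Z))
    norm⇒form Y Z eq = subst ±2 (trans (cong (δ *_) (norm≡ Y Z)) (δδ (d * (Y * Y) + c * (Z * Z)))) (±1-* δ≡±1 eq)

    form⇒norm : ∀ Y y → ±2 (d * (Y * Y) + c * (y * y)) → ±2 (norm Y (δ * y))
    form⇒norm Y y eq = subst ±2 (sym (trans (norm≡ Y (δ * y))
      (cong (λ t → δ * (d * (Y * Y) + c * t)) (trans (ring δ y) (trans (cong (_* (y * y)) δ²≡1) (ℤₚ.*-identityˡ (y * y)))))))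
      (±1-* δ≡±1 eq)
      where
      ring : ∀ δ y → δ * y * (δ * y) ≡ δ * δ * (y * y)
      ring = ℤ-Solver.solve-∀

    odd⁻ : ∀ {y} → Odd (δ * y) → Odd y
    odd⁻ {y} odd = subst Odd (δδ y) (*-odd δ-odd odd)

  module Case₁ (S : NonClassical √m) where
    open Twisted m/d m/d-odd m/d-mod4 m/d-coprime-d
    open FreeGenerators frame₁ S υ μ coprime (acts₁ {u} {w} (rational-u M M*d⁻¹) rational-w S)

    free⇒eq : Free S → ∃₂ λ x y → Eq₁ x y
    free⇒eq free = go (free⇒norm≡±2 free)
      where
      go : (∃₂ λ Y Z → ±2 (norm Y Z)) → ∃₂ λ x y → Eq₁ x y
      go (Y , Z , eq) = Y * d , Z , subst (λ c → Equation d c (Y * d) Z) (sym m≡)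
        (norm⇒equation {d} {m/d} {Y} {Z} (norm⇒form Y Z eq))

    generator : ∀ x y → Eq₁ x y → ∃ λ ε → Residue₁ x y ε × IsGenerator S (β₁ x y (+ toℕ ε))
    generator x y eq = go (equation⇒norm {d} {m/d} d-squareFree x y (subst (λ c → Equation d c x y) m≡ eq))
      where
      go : (∃ λ Y → x ≡ Y * d × ±2 (d * (Y * Y) + m/d * (y * y))) →
        ∃ λ ε → Residue₁ x y ε × IsGenerator S (β₁ x y (+ toℕ ε))
      go (Y , x≡ , form≡±2) = with-odd (norm≡±2⇒odd υ μ {Y} {δ * y} norm≡±2)
        where
        norm≡±2 : ±2 (norm Y (δ * y))
        norm≡±2 = form⇒norm Y y form≡±2

        with-odd : Odd Y × Odd (δ * y) → ∃ λ ε → Residue₁ x y ε × IsGenerator S (β₁ x y (+ toℕ ε))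
        -- The number z = (Y - (m/d)y)/2 is the quotient (x - my)/(2d) whose residue mod 2 is
        -- prescribed; it is an integer because Y, y and m/d are odd.
        with-odd (Y-odd , δy-odd) = with-z (odd-difference {m/d * y} {Y} (*-odd m/d-odd (odd⁻ {y} δy-odd)) Y-odd)
          where
          with-residue : ∀ z → Y ≡ m/d * y + + 2 * z →
            (∃ λ (ε : Fin 2) → ±1 (1ℤ - + 2 * + toℕ ε) × ∃ λ t → z ≡ + toℕ ε + t * + 2) →
            ∃ λ ε → Residue₁ x y ε × IsGenerator S (β₁ x y (+ toℕ ε))
          with-residue z Y≡ (ε , A≡±1 , t , z≡) = ε , (t , trans residue (cong fromℤ z≡)) ,
            subst (IsGenerator S) (sym (β₁≡ x y (+ toℕ ε) Y x≡)) (norm≡±2⇒generator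
              (admissible₁ (+ toℕ ε) t Y y δ m/d (proj₁ m/d+δ≡0)
                (trans Y≡ (cong (λ z → m/d * y + + 2 * z) z≡)) Y-odd δy-odd (proj₂ m/d+δ≡0))
              A≡±1 (inj₁ refl) norm≡±2)
            where
            residue : (x - m * y) ∕ (+ 2 * d) ≡ fromℤ z
            residue = ∕-exact (x - m * y) (+ 2 * d) z
              (trans (cong₂ (λ x m → x - m * y) (trans x≡ (cong (_* d) Y≡)) m≡) (ring m/d d y z))
              where
              ring : ∀ μ d y z → (μ * y + + 2 * z) * d - μ * d * y ≡ z * (+ 2 * d)
              ring = ℤ-Solver.solve-∀

          with-z : (∃ λ z → Y ≡ m/d * y + + 2 * z) → ∃ λ ε → Residue₁ x y ε × IsGenerator S (β₁ x y (+ toℕ ε))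
          with-z (z , Y≡) = with-residue z Y≡ (residue-mod2 z)

    case₁ : (Free S ⇔ ∃₂ λ x y → Eq₁ x y) ×
      (∀ x y → Eq₁ x y → ∃ λ ε → Residue₁ x y ε × IsGenerator S (β₁ x y (+ toℕ ε)))
    case₁ = mk⇔ free⇒eq (λ (x , y , eq) → let ε , _ , gen = generator x y eq in β₁ x y (+ toℕ ε) , gen) , generator

  module Case₂ (S : NonClassical √n) where
    open Twisted n/d n/d-odd n/d-mod4 n/d-coprime-d
    open FreeGenerators frame₂ S υ μ coprime (acts₂ {u} {w} (rational-u N (*d⁻¹ n≡)) rational-w S)

    free⇒eq : Free S → ∃₂ λ x y → Eq₂ x y
    free⇒eq free = go (free⇒norm≡±2 free)
      where
      go : (∃₂ λ Y Z → ±2 (norm Y Z)) → ∃₂ λ x y → Eq₂ x y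
      go (Y , Z , eq) = Y * d , Z , subst (λ c → Equation d c (Y * d) Z) (sym n≡)
        (norm⇒equation {d} {n/d} {Y} {Z} (norm⇒form Y Z eq))

    generator : ∀ x y → Eq₂ x y → ∃ λ ε → Residue₂ x y ε × IsGenerator S (β₂ x y (+ toℕ ε))
    generator x y eq = go (equation⇒norm {d} {n/d} d-squareFree x y (subst (λ c → Equation d c x y) n≡ eq))
      where
      go : (∃ λ Y → x ≡ Y * d × ±2 (d * (Y * Y) + n/d * (y * y))) →
        ∃ λ ε → Residue₂ x y ε × IsGenerator S (β₂ x y (+ toℕ ε))
      go (Y , x≡ , form≡±2) = with-odd (norm≡±2⇒odd υ μ {Y} {δ * y} norm≡±2)
        where
        norm≡±2 : ±2 (norm Y (δ * y))
        norm≡±2 = form⇒norm Y y form≡±2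

        with-odd : Odd Y × Odd (δ * y) → ∃ λ ε → Residue₂ x y ε × IsGenerator S (β₂ x y (+ toℕ ε))
        with-odd (Y-odd , δy-odd) =
          with-residue (residue-mod4 (odd-odd (*-odd m/d-odd (odd⁻ {y} δy-odd)) Y-odd))
          where
          with-residue : (∃ λ (ε : Fin 4) → ±1 (1ℤ - + toℕ ε) × ∃ λ t → m/d * y - Y ≡ + toℕ ε + t * + 4) →
            ∃ λ ε → Residue₂ x y ε × IsGenerator S (β₂ x y (+ toℕ ε))
          with-residue (ε , A≡±1 , t , eq) = ε , (t , trans (my-x∕d x y Y x≡) (cong fromℤ eq)) ,
            subst (IsGenerator S) (sym (β₂≡ x y (+ toℕ ε) Y x≡)) (norm≡±2⇒generator
              (admissible₂ (+ toℕ ε) t Y y δ m/d (proj₁ m/d+δ≡0) eq Y-odd δy-odd (proj₂ m/d+δ≡0))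
              A≡±1 (inj₁ refl) norm≡±2)

    case₂ : (Free S ⇔ ∃₂ λ x y → Eq₂ x y) ×
      (∀ x y → Eq₂ x y → ∃ λ ε → Residue₂ x y ε × IsGenerator S (β₂ x y (+ toℕ ε)))
    case₂ = mk⇔ free⇒eq (λ (x , y , eq) → let ε , _ , gen = generator x y eq in β₂ x y (+ toℕ ε) , gen) , generator

  module Case₃ (S : NonClassical √k) where

    υ μ : ℤ
    υ = proj₁ m/d-odd
    -- Both m/d and n/d are d mod 4, so they differ by a multiple of 4. The plane is spanned by √n
    -- and √m, hence u and w carry no δ.
    μ = proj₁ n/d-mod4 - proj₁ m/d-mod4

    open IntegerAction υ μ

    u≡ : u ≡ m/d
    u≡ = sym (proj₂ m/d-odd)

    w≡ : w ≡ n/d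
    w≡ = trans (cong (_+ + 4 * μ) (trans u≡ (proj₂ m/d-mod4)))
      (trans (ring d (proj₁ n/d-mod4) (proj₁ m/d-mod4)) (sym (proj₂ n/d-mod4)))
      where
      ring : ∀ d ν μ → d + + 4 * μ + + 4 * (ν - μ) ≡ d + + 4 * ν
      ring = ℤ-Solver.solve-∀

    norm≡ : ∀ Y Z → norm Y Z ≡ n/d * (Y * Y) + m/d * (Z * Z)
    norm≡ Y Z = cong₂ (λ w u → w * (Y * Y) + u * (Z * Z)) w≡ u≡

    open FreeGenerators frame₃ S υ μ (subst₂ IsCoprime (sym u≡) (sym w≡) m/d-coprime-n/d)
      (acts₃ {u} {w} (trans M*d⁻¹ (cong fromℤ (sym u≡))) (trans (*d⁻¹ n≡) (cong fromℤ (sym w≡))) S)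

    free⇒eq : Free S → ∃₂ λ x y → Eq₃ x y
    free⇒eq free = go (free⇒norm≡±2 free)
      where
      go : (∃₂ λ Y Z → ±2 (norm Y Z)) → ∃₂ λ x y → Eq₃ x y
      go (Y , Z , eq) = Y * n/d , Z , subst (λ c → Equation n/d c (Y * n/d) Z) (sym k≡)
        (norm⇒equation {n/d} {m/d} {Y} {Z} (subst ±2 (norm≡ Y Z) eq))

    generator : ∀ x y → Eq₃ x y → ∃ λ ε → Sign₃ x y ε × IsGenerator S (β₃ x y ε)
    generator x y eq = go (equation⇒norm {n/d} {m/d} n/d-squareFree x y (subst (λ c → Equation n/d c x y) k≡ eq))
      where
      go : (∃ λ Y → x ≡ Y * n/d × ±2 (n/d * (Y * Y) + m/d * (y * y))) →
        ∃ λ ε → Sign₃ x y ε × IsGenerator S (β₃ x y ε)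
      go (Y , x≡ , form≡±2) = with-odd (norm≡±2⇒odd υ μ {Y} {y} norm≡±2)
        where
        norm≡±2 : ±2 (norm Y y)
        norm≡±2 = subst ±2 (sym (norm≡ Y y)) form≡±2

        with-odd : Odd Y × Odd y → ∃ λ ε → Sign₃ x y ε × IsGenerator S (β₃ x y ε)
        with-odd (Y-odd , y-odd) = with-sign (sign-mod4 (parity m/d-odd Y-odd y-odd))
          where
          parity : ∀ {μ Y y} → Odd μ → Odd Y → Odd y → Odd (- (μ - Y - y))
          parity (a , refl) (b , refl) (c , refl) = b + c - a , ring a b c
            where
            ring : ∀ a b c → - (1ℤ + + 2 * a - (1ℤ + + 2 * b) - (1ℤ + + 2 * c)) ≡ 1ℤ + + 2 * (b + c - a)
            ring = ℤ-Solver.solve-∀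

          with-sign : (∃ λ ε → ±1 ε × ∃ λ t → - (m/d - Y - y) ≡ ε + t * + 4) →
            ∃ λ ε → Sign₃ x y ε × IsGenerator S (β₃ x y ε)
          with-sign (ε , ε≡±1 , t , eq) = ε
            , (ε≡±1 , t , trans (cong ℚ.-_ (k-x∕n/d-y x y Y x≡)) (trans (sym (fromℤ-neg (m/d - Y - y))) (cong fromℤ eq)))
            , subst (IsGenerator S) (sym (β₃≡ x y ε Y x≡))
                (norm≡±2⇒generator (admissible₃ ε t Y y δ m/d (proj₁ m/d+δ≡0) eq (proj₂ m/d+δ≡0)
                  (odd-difference {δ} {Y} δ-odd Y-odd) (odd-difference {δ} {y} δ-odd y-odd)) ε≡±1 δ≡±1 norm≡±2)

    case₃ : (Free S ⇔ ∃₂ λ x y → Eq₃ x y) ×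
      (∀ x y → Eq₃ x y → ∃ λ ε → Sign₃ x y ε × IsGenerator S (β₃ x y ε))
    case₃ = mk⇔ free⇒eq (λ (x , y , eq) → let ε , _ , gen = generator x y eq in β₃ x y ε , gen) , generator

proposition5p7 :
    (m n : ℤ) (m-sf : SquareFree m) (n-sf : SquareFree n) →
    m ≡ 1ℤ [mod + 4 ] → n ≡ 1ℤ [mod + 4 ] →
    let open Biquadratic m n m-sf n-sf in
    IsField →
      ((H₁ : NonClassical √m) →
          (Free H₁ ⇔ ∃₂ λ x y → Eq₁ x y)
        × (∀ x y → Eq₁ x y →
             ∃ λ ε → Residue₁ x y ε × IsGenerator H₁ (β₁ x y (+ toℕ ε))))
    × ((H₂ : NonClassical √n) →
          (Free H₂ ⇔ ∃₂ λ x y → Eq₂ x y)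
        × (∀ x y → Eq₂ x y →
             ∃ λ ε → Residue₂ x y ε × IsGenerator H₂ (β₂ x y (+ toℕ ε))))
    × ((H₃ : NonClassical √k) →
          (Free H₃ ⇔ ∃₂ λ x y → Eq₃ x y)
        × (∀ x y → Eq₃ x y →
             ∃ λ ε → Sign₃ x y ε × IsGenerator H₃ (β₃ x y ε)))
proposition5p7 m n m-sf n-sf m≡1 n≡1 isField = Case₁.case₁ , Case₂.case₂ , Case₃.case₃
  where
  open Conclusion m n m-sf n-sf m≡1 n≡1 isField
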